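{- Let $n=p_1^{\alpha_1}\cdots p_r^{\alpha_r}$ be the prime factorization of $n$ with all $p_i\ge3$, let $D_n=\langle a,b\mid a^n=b^2=1,\ bab=a^{ -1}\rangle$, and let $S=S_1\cup S_2\subseteq D_n\setminus\{1\}$ with $S=S^{ -1}$, $S_1\subseteq\langle a\rangle$, $S_2\subseteq b\langle a\rangle$. Suppose $S_2^2$ is $2$-integral. Then $X(D_n,S)$ is integral if and only if $S_1\in B(\langle a\rangle)$ and $S_2=ba^j\langle a^{n/p_i}\rangle\setminus\{ba^{kn/p_i+j}\}$ or $S_2=ba^j\langle a^{n/p_i}\rangle$ for some $1\le i\le r$, $0\le k\le p_i-1$ and $0\le j\le\frac{n}{p_i}-1$.
   Context: The Cayley graph $X(G,S)$ has vertex set $G$, $x,y$ adjacent iff $x^{ -1}y\in S$; it is integral if all adjacency eigenvalues are integers. $S_2^2$ is the multiset $\{xy:x,y\in S_2\}$ (ordered pairs). An atom of $\langle a\rangle$ is $[g]=\{x\in\langle a\rangle:\langle x\rangle=\langle g\rangle\}$; $m*[g]$ means each element of $[g]$ with multiplicity $m$. $S_2^2$ is called $2$-integral if $S_2^2=t*\{1\}\cup m_2*[a^{d_2}]$ where $t=|S_2|$, $d_2$ is a divisor of $n$ with $d_2\neq n$, and $m_2\ge1$. $B(\langle a\rangle)$ is the Boolean algebra of subsets of $\langle a\rangle$ generated by its subgroups under finite unions, intersections and complements; equivalently, unions of atoms. -}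

module Defs where

open import Data.Nat as ℕ using (ℕ; zero; suc; NonZero; _∸_)
open import Data.Nat.DivMod using (_mod_)
open import Data.Nat.Divisibility using (_∣_)
open import Data.Fin as Fin using (Fin; toℕ; splitAt; punchIn)
open import Data.Fin.Properties using (any?)
open import Data.Fin.Subset using (Subset; ∣_∣)
open import Data.Integer as ℤ using (ℤ; +_; -_)
open import Data.Bool as Bool using (Bool; true; false; if_then_else_; _∧_)
open import Data.Product using (_×_; _,_; ∃₂; ∃)
open import Data.Sum using ([_,_])
open import Data.Vec using (Vec; tabulate; lookup)
open import Data.Vec.Properties using (≡-dec)
open import Data.Fin.Subset using (∁; _∪_; _∩_)
open import Relation.Nullary using (does)
open import Relation.Binary.PropositionalEquality using (_≡_; _≢_)

sumF : ∀ {m} → (Fin m → ℤ) → ℤ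
sumF {zero}  f = + 0
sumF {suc m} f = f Fin.zero ℤ.+ sumF (λ i → f (Fin.suc i))

prodF : ∀ {m} → (Fin m → ℤ) → ℤ
prodF {zero}  f = + 1
prodF {suc m} f = f Fin.zero ℤ.* prodF (λ i → f (Fin.suc i))

sumFℕ : ∀ {m} → (Fin m → ℕ) → ℕ
sumFℕ {zero}  f = 0
sumFℕ {suc m} f = f Fin.zero ℕ.+ sumFℕ (λ i → f (Fin.suc i))

sign : ℕ → ℤ
sign zero    = + 1
sign (suc k) = - sign k

det : ∀ {m} → (Fin m → Fin m → ℤ) → ℤ
det {zero}  A = + 1
det {suc m} A =
  sumF (λ j → sign (toℕ j) ℤ.* A Fin.zero j
                ℤ.* det (λ r c → A (Fin.suc r) (punchIn j c)))

charPoly : ∀ {m} → (Fin m → Fin m → ℤ) → ℤ → ℤ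
charPoly A x = det (λ i j → (if does (i Fin.≟ j) then x else + 0) ℤ.- A i j)

-- A square integer matrix is integral iff all its eigenvalues (the roots,
-- with multiplicity, of its characteristic polynomial) are integers, i.e.
-- the characteristic polynomial equals ∏ (x - λᵢ) for integers λᵢ.
-- (Equality of these monic polynomials of degree m is tested at all x ∈ ℤ.)
IntegralMatrix : ∀ {m} → (Fin m → Fin m → ℤ) → Set
IntegralMatrix {m} A =
  ∃ λ (ev : Fin m → ℤ) → ∀ (x : ℤ) → charPoly A x ≡ prodF (λ i → x ℤ.- ev i)

-- The dihedral group D_n = ⟨a, b | aⁿ = b² = 1, bab = a⁻¹⟩.
-- (false , k) represents aᵏ and (true , k) represents b aᵏ.

module Dihedral (n : ℕ) .{{nz : NonZero n}} where

  e : Fin n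
  e = 0 mod n

  _⊕_ : Fin n → Fin n → Fin n
  k ⊕ l = (toℕ k ℕ.+ toℕ l) mod n

  ⊖_ : Fin n → Fin n
  ⊖ k = (n ∸ toℕ k) mod n

  D : Set
  D = Bool × Fin n

  -- aᵏaˡ = aᵏ⁺ˡ, aᵏ(baˡ) = ba^(l-k), (baᵏ)aˡ = ba^(k+l), (baᵏ)(baˡ) = a^(l-k)
  _·_ : D → D → D
  (false , k) · (false , l) = false , (k ⊕ l)
  (false , k) · (true  , l) = true  , (l ⊕ (⊖ k))
  (true  , k) · (false , l) = true  , (k ⊕ l)
  (true  , k) · (true  , l) = false , (l ⊕ (⊖ k))

  inv : D → D
  inv (false , k) = false , (⊖ k)
  inv (true  , k) = true , k

  vertex : Fin (n ℕ.+ n) → D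
  vertex i = [ (λ k → false , k) , (λ k → true , k) ] (splitAt n i)

  memberS : Subset n → Subset n → D → Bool
  memberS S1 S2 (false , k) = lookup S1 k
  memberS S1 S2 (true  , k) = lookup S2 k

  adj : Subset n → Subset n → Fin (n ℕ.+ n) → Fin (n ℕ.+ n) → ℤ
  adj S1 S2 i j = if memberS S1 S2 (inv (vertex i) · vertex j) then + 1 else + 0

  IntegralCayley : Subset n → Subset n → Set
  IntegralCayley S1 S2 = IntegralMatrix (adj S1 S2)

  cyc : ℕ → Subset n
  cyc d = tabulate (λ m → does (any? {n = n} {P = λ j → ((toℕ j ℕ.* d) mod n) ≡ m} (λ j → ((toℕ j ℕ.* d) mod n) Fin.≟ m)))

  inAtom? : ℕ → Fin n → Bool
  inAtom? g m = does (≡-dec Bool._≟_ (cyc (toℕ m)) (cyc g))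

  data InB : Subset n → Set where
    subgrp : ∀ d → InB (cyc d)
    compl  : ∀ {s} → InB s → InB (∁ s)
    union  : ∀ {s t} → InB s → InB t → InB (s ∪ t)
    inter  : ∀ {s t} → InB s → InB t → InB (s ∩ t)

  -- multiplicity of a^m in the multiset S₂² = {xy : x, y ∈ S₂} (ordered pairs);
  -- (baᵏ)(baˡ) = a^(l-k)
  mult : Subset n → Fin n → ℕ
  mult S2 m = sumFℕ (λ k → sumFℕ (λ l →
    if lookup S2 k ∧ lookup S2 l ∧ does ((l ⊕ (⊖ k)) Fin.≟ m) then 1 else 0))

  -- S₂² = t*{1} ∪ m₂*[a^{d₂}] with t = |S₂|, d₂ ∣ n, d₂ ≠ n, m₂ ≥ 1
  TwoIntegral : Subset n → Set
  TwoIntegral S2 = ∃₂ λ d2 m2 → (d2 ∣ n) × (d2 ≢ n) × (1 ℕ.≤ m2) ×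
    (∀ m → mult S2 m ≡ (if does (m Fin.≟ e) then ∣ S2 ∣ else 0)
                        ℕ.+ (if inAtom? d2 m then m2 else 0))

  coset : ℕ → ℕ → Subset n
  coset j q = tabulate (λ l → does (any? {n = n} {P = λ i → ((j ℕ.+ toℕ i ℕ.* q) mod n) ≡ l} (λ i → ((j ℕ.+ toℕ i ℕ.* q) mod n) Fin.≟ l)))

{-# OPTIONS --safe #-}
module Submission where

-- Acting on functions on D_n by right translation, the adjacency operator is s + β with s = Σ a^l over S₁ and
-- β = b Σ a^l over S₂. These commute because S₁ = S₁⁻¹, and β² = h is the element of ℤ⟨a⟩ whose coefficients are
-- the multiplicities of S₂². Call an operator split if it is annihilated by a product of factors x - ν with ν ∈ ℤ.
-- A matrix is integral iff it is split (Cayley–Hamilton; conversely a monic factor of a product of linear factors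
-- is such a product), and a sum of commuting split operators is split.
--
-- If s + β is split, so is its conjugate s - β, hence so are 2s and 2β. Modulo an odd prime p not dividing n every
-- s - ν divides s^p - s, so high powers of the Frobenius map agree on s; as s^(p^j) ≡ Σ a^(l p^j), the set S₁ is
-- closed under multiplication by p, hence under all units: it is a union of atoms. That 2β is split makes every
-- integer eigenvalue of h a perfect square. Distinct elements of S₂ differ by a generator of ⟨a^d₂⟩. If the order
-- n / d₂ were composite, counting differences that agree modulo one prime would leave only |S₂| = q for a prime q
-- with q² ∣ n / d₂, and |S₂| would be an eigenvalue of h. So n / d₂ = q is prime, the eigenvalue |S₂| - m₂ is a
-- square, and |S₂|² = |S₂| + m₂ (q - 1) forces |S₂| ≥ q - 1.
--
-- Conversely, indicators of members of B(⟨a⟩) are ℤ-combinations of indicators of subgroups H, which are split since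
-- H² = |H| H, and β² is the square of H or of H - 1.

open import Defs
open import Level using (0ℓ)
open import Function using (_∘_; _$_)
open import Function.Bundles using (_⇔_; mk⇔)
open import Data.Bool as Bool using (Bool; true; false; if_then_else_; not; _∧_; _∨_)
open import Data.Empty using (⊥; ⊥-elim)
open import Data.Product using (_×_; _,_; ∃; ∃-syntax; Σ-syntax; proj₁; proj₂)
open import Data.Sum using (_⊎_; inj₁; inj₂; [_,_]; [_,_]′)
open import Data.Nat as ℕ using (ℕ; zero; suc; NonZero; _≤_; _<_; _∸_; z≤n; s≤s; _!)
import Data.Nat.Properties as ℕ
open import Data.Nat.Properties using (_!*_!≢0)
open import Data.Nat.Combinatorics using (nCk≡n!/k![n-k]!; k![n∸k]!∣n!; nCn≡1) renaming (_C_ to infixl 6.5 _choose_)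
open import Data.Nat.Coprimality as Coprimality using (Coprime; coprime-divisor)
open import Data.Nat.Divisibility
open import Data.Nat.DivMod
open import Data.Nat.GCD using (gcd; gcd[m,n]∣m; gcd[m,n]∣n; gcd-greatest; gcd[m,n]≢0; gcd-GCD; module Bézout)
open import Data.Nat.ListAction using (product)
open import Data.Nat.Primality using (Prime; euclidsLemma; prime[2]; prime⇒irreducible; prime⇒nonZero; prime⇒nonTrivial)
open import Data.Nat.Primality.Factorisation using (factorise)
open import Data.Nat.Tactic.RingSolver using () renaming (solve-∀ to solveℕ-∀)
open import Data.Integer as ℤ using (ℤ; +_; -_; -[1+_])
import Data.Integer.Properties as ℤ
open import Data.Integer.Tactic.RingSolver using (solve-∀)
open import Data.Fin as Fin using (Fin; zero; suc; toℕ; fromℕ; fromℕ<; inject₁; punchIn; punchOut; splitAt; _↑ˡ_; _↑ʳ_)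
import Data.Fin.Properties as Fin
open import Data.Fin.Properties using (any?; suc-injective; punchIn-punchOut; punchOut-punchIn; punchOut-cong; punchInᵢ≢i; punchIn-injective)
open import Data.Fin.Permutation using (permutation)
open import Data.Fin.Subset using (Subset; _∈_; _∉_; ∁; _∩_; _∪_; ⁅_⁆) renaming (∣_∣ to card)
open import Data.List as List using (List; []; _∷_; _++_; length)
open import Data.List.Relation.Unary.All using (All; []; _∷_)
open import Data.Vec using (lookup; tabulate; []; _∷_)
open import Data.Vec.Properties using ([]=⇒lookup; lookup⇒[]=; lookup∘tabulate; tabulate∘lookup; tabulate-cong; lookup-map; lookup-zipWith; lookup-replicate; ≡-dec)
open import Data.Vec.Functional using (insertAt; tail) renaming (_∷_ to infixr 5 _◂_)
open import Data.Vec.Functional.Properties using (insertAt-lookup; insertAt-punchIn)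
import Data.Maybe as Maybe
open import Relation.Nullary using (Dec; yes; no; does; contradiction; ¬_)
open import Relation.Nullary.Decidable using (dec-true; dec-false; dec⇒maybe; _×-dec_)
open import Relation.Binary.Definitions using (Tri; tri<; tri≈; tri>)
open import Relation.Binary.PropositionalEquality as ≡ using (_≡_; _≢_; refl; sym; trans; cong; cong₂; subst; subst₂; module ≡-Reasoning)
import Relation.Binary.Reasoning.Setoid
open import Algebra.Bundles using (CommutativeRing; AbelianGroup)
import Algebra.Properties.AbelianGroup
import Algebra.Properties.CommutativeSemiring.Binomial
import Algebra.Properties.CommutativeSemiring.Exp
import Algebra.Properties.Group
import Algebra.Properties.Semiring.Mult
import Algebra.Properties.Semiring.Sum
import Algebra.Solver.Ring
open import Algebra.Solver.Ring.AlmostCommutativeRing using (fromCommutativeRing; _-Raw-AlmostCommutative⟶_)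

-- No eigenvalue outside ℤ ever appears. The characteristic polynomial is known only through its
-- values at integers, so polynomials are functions ℤ → ℤ with a Horner derivation, and identities
-- between them come from vanishing at all large integers. Splitness allows repeated factors; the
-- nilpotent part that this leaves is what high powers of Frobenius remove.
--
-- Only 2s and 2β, the sum and the difference of s + β and s - β, are reached integrally. The factor
-- 2 is harmless: modulo an odd prime it is nonzero, and if 4c is a square then so is c. But the
-- prime 2 is lost in the Frobenius argument, which is why units modulo the order of an element are
-- lifted to integers coprime to 2n: these are products of the odd primes for which closure is
-- available.
--
-- Eigenvectors of h are differences of two point masses, at 1 and at y: wherever h is c times 1
-- plus a part invariant under y, the constant c is an eigenvalue. With y of order q this yields
-- |S₂| when q² ∣ n / d₂, and |S₂| - m₂ when n / d₂ = q.

private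
  module ℤ+ = Algebra.Properties.AbelianGroup ℤ.+-0-abelianGroup
  module ℤSum = Algebra.Properties.Semiring.Sum ℤ.+-*-semiring

-- Determinants over the integers: alternating forms, products, cofactors

module Determinant where

  open import Data.Integer using (_+_; _*_; _-_)

  private variable
    m d n k : ℕ

  sumF≡sum : (f : Fin m → ℤ) → sumF f ≡ ℤSum.sum f
  sumF≡sum {zero} f = refl
  sumF≡sum {suc m} f = cong (λ z → f zero + z) (sumF≡sum (f ∘ suc))

  sumF-cong : {f g : Fin m → ℤ} → (∀ i → f i ≡ g i) → sumF f ≡ sumF g
  sumF-cong {zero} eq = refl
  sumF-cong {suc m} eq = cong₂ _+_ (eq zero) (sumF-cong (eq ∘ suc))

  sumF-linear : (a : ℤ) (f g : Fin m → ℤ) → sumF (λ i → f i + a * g i) ≡ sumF f + a * sumF g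
  sumF-linear {zero} a f g = lem a
    where
    lem : ∀ a → + 0 ≡ + 0 + a * + 0
    lem = solve-∀
  sumF-linear {suc m} a f g = trans (cong (λ z → f zero + a * g zero + z) (sumF-linear a (f ∘ suc) (g ∘ suc)))
    (lem (f zero) a (g zero) (sumF (f ∘ suc)) (sumF (g ∘ suc)))
    where
    lem : ∀ x a y u v → x + a * y + (u + a * v) ≡ x + u + a * (y + v)
    lem = solve-∀

  sumF-* : (a : ℤ) (f : Fin m → ℤ) → sumF (λ i → a * f i) ≡ a * sumF f
  sumF-* {zero} a f = sym (ℤ.*-zeroʳ a)
  sumF-* {suc m} a f = trans (cong (λ z → a * f zero + z) (sumF-* a (f ∘ suc))) (sym (ℤ.*-distribˡ-+ a _ _))

  sumF-zero : {f : Fin m → ℤ} → (∀ i → f i ≡ + 0) → sumF f ≡ + 0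
  sumF-zero {zero} eq = refl
  sumF-zero {suc m} eq = cong₂ _+_ (eq zero) (sumF-zero (eq ∘ suc))

  sumF-comm : (f : Fin m → Fin n → ℤ) → sumF (λ i → sumF (f i)) ≡ sumF (λ j → sumF (λ i → f i j))
  sumF-comm f = begin
    sumF (λ i → sumF (f i))           ≡⟨ sumF-cong (λ i → sumF≡sum (f i)) ⟩
    sumF (λ i → ℤSum.sum (f i))        ≡⟨ sumF≡sum (λ i → ℤSum.sum (f i)) ⟩
    ℤSum.sum (λ i → ℤSum.sum (f i))     ≡⟨ ℤSum.∑-comm f ⟩
    ℤSum.sum (λ j → ℤSum.sum (λ i → f i j)) ≡⟨ sumF≡sum (λ j → ℤSum.sum (λ i → f i j)) ⟨
    sumF (λ j → ℤSum.sum (λ i → f i j)) ≡⟨ sumF-cong (λ j → sumF≡sum (λ i → f i j)) ⟨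
    sumF (λ j → sumF (λ i → f i j)) ∎
    where open ≡-Reasoning

  sumF-punchIn : (i : Fin (suc m)) (f : Fin (suc m) → ℤ) → sumF f ≡ f i + sumF (f ∘ punchIn i)
  sumF-punchIn i f = trans (sumF≡sum f) (trans (ℤSum.sum-remove {i = i} f)
      (cong (λ z → f i + z) (sym (sumF≡sum (f ∘ punchIn i)))))

  δ : Fin m → Fin m → ℤ
  δ i j = if does (i Fin.≟ j) then + 1 else + 0

  δ-refl : (i : Fin m) → δ i i ≡ + 1
  δ-refl i = cong (if_then + 1 else + 0) (dec-true (i Fin.≟ i) refl)

  δ-≢ : {i j : Fin m} → i ≢ j → δ i j ≡ + 0
  δ-≢ {i = i} {j} i≢j = cong (if_then + 1 else + 0) (dec-false (i Fin.≟ j) i≢j)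

  sumF-only : (i : Fin m) (f : Fin m → ℤ) → (∀ j → i ≢ j → f j ≡ + 0) → sumF f ≡ f i
  sumF-only {suc m} i f eq = trans (sumF-punchIn i f)
    (trans (cong (λ z → f i + z) (sumF-zero (λ j → eq (punchIn i j) (punchInᵢ≢i i j ∘ sym)))) (ℤ.+-identityʳ (f i)))

  sumF-δˡ : (i : Fin m) (f : Fin m → ℤ) → sumF (λ j → δ i j * f j) ≡ f i
  sumF-δˡ i f = trans (sumF-only i _ (λ j i≢j → cong (_* f j) (δ-≢ i≢j)))
    (trans (cong (_* f i) (δ-refl i)) (ℤ.*-identityˡ (f i)))

  sumF-δʳ : (i : Fin m) (f : Fin m → ℤ) → sumF (λ j → f j * δ j i) ≡ f i
  sumF-δʳ i f = trans (sumF-only i _ (λ j i≢j → trans (cong (f j *_) (δ-≢ (i≢j ∘ sym))) (ℤ.*-zeroʳ (f j))))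
    (trans (cong (f i *_) (δ-refl i)) (ℤ.*-identityʳ (f i)))

  Matrix : ℕ → ℕ → Set
  Matrix m d = Fin m → Fin d → ℤ

  -- `linear` relates three matrices that agree off row `i` instead of substituting a row; with the
  -- scalar `a` it covers additivity and homogeneity at once. Row count and column count are
  -- separate so that the top row can be fixed and the rest treated as a form again.
  record Multilinear (D : Matrix m d → ℤ) : Set where
    field
      ext : ∀ {M N} → (∀ r c → M r c ≡ N r c) → D M ≡ D N
      linear : ∀ i a {M U V} →
        (∀ r → r ≢ i → ∀ c → M r c ≡ U r c) → (∀ r → r ≢ i → ∀ c → M r c ≡ V r c) →
        (∀ c → M i c ≡ U i c + a * V i c) → D M ≡ D U + a * D V

  record Alternating (D : Matrix m d → ℤ) : Set where
    field
      multilinear : Multilinear D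
      equal-rows : ∀ {i j} → i ≢ j → ∀ {M} → (∀ c → M i c ≡ M j c) → D M ≡ + 0
    open Multilinear multilinear public

  det-ext : {A B : Matrix m m} → (∀ r c → A r c ≡ B r c) → det A ≡ det B
  det-ext {zero} eq = refl
  det-ext {suc m} eq = sumF-cong λ j →
    cong₂ _*_ (cong (sign (toℕ j) *_) (eq zero j)) (det-ext (λ r c → eq (suc r) (punchIn j c)))

  det-linear : ∀ (i : Fin m) a {M U V : Matrix m m} →
    (∀ r → r ≢ i → ∀ c → M r c ≡ U r c) → (∀ r → r ≢ i → ∀ c → M r c ≡ V r c) →
    (∀ c → M i c ≡ U i c + a * V i c) → det M ≡ det U + a * det V
  det-linear zero a {M} {U} {V} mu mv eq = trans (sumF-cong term) (sumF-linear a (summand U) (summand V))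
    where
    lem : ∀ s u a v w → s * (u + a * v) * w ≡ s * u * w + a * (s * v * w)
    lem = solve-∀
    minor : Matrix _ _ → Fin _ → ℤ
    minor X j = det (λ r c → X (suc r) (punchIn j c))
    summand : Matrix _ _ → Fin _ → ℤ
    summand X j = sign (toℕ j) * X zero j * minor X j
    term : ∀ j → summand M j ≡ summand U j + a * summand V j
    term j = trans (cong (λ z → sign (toℕ j) * z * minor M j) (eq j)) $
      trans (lem (sign (toℕ j)) (U zero j) a (V zero j) (minor M j)) $
      cong₂ (λ x y → sign (toℕ j) * U zero j * x + a * (sign (toℕ j) * V zero j * y))
        (det-ext (λ r c → mu (suc r) (λ ()) (punchIn j c))) (det-ext (λ r c → mv (suc r) (λ ()) (punchIn j c)))
  det-linear (suc i) a {M} {U} {V} mu mv eq = trans (sumF-cong term) (sumF-linear a (summand U) (summand V))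
    where
    lem : ∀ s x a u v → s * x * (u + a * v) ≡ s * x * u + a * (s * x * v)
    lem = solve-∀
    minor : Matrix _ _ → Fin _ → ℤ
    minor X j = det (λ r c → X (suc r) (punchIn j c))
    summand : Matrix _ _ → Fin _ → ℤ
    summand X j = sign (toℕ j) * X zero j * minor X j
    term : ∀ j → summand M j ≡ summand U j + a * summand V j
    term j = trans (cong (λ z → sign (toℕ j) * M zero j * z)
        (det-linear i a (λ r r≢i c → mu (suc r) (r≢i ∘ suc-injective) (punchIn j c))
          (λ r r≢i c → mv (suc r) (r≢i ∘ suc-injective) (punchIn j c)) (λ c → eq (punchIn j c)))) $
      trans (lem (sign (toℕ j)) (M zero j) a (minor U j) (minor V j)) $
      cong₂ (λ x y → sign (toℕ j) * x * minor U j + a * (sign (toℕ j) * y * minor V j))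
        (mu zero (λ ()) j) (mv zero (λ ()) j)

  det-multilinear : Multilinear (det {m})
  det-multilinear = record { ext = det-ext ; linear = det-linear }

  self-negative : ∀ x → x ≡ - x → x ≡ + 0
  self-negative (+ zero) _ = refl
  self-negative (+ suc _) ()
  self-negative (ℤ.-[1+ _ ]) ()

  -- Expand D at the matrix whose rows i and j both equal M i + M j.
  swap-rows : {D : Matrix m d → ℤ} → Multilinear D → ∀ i j → i ≢ j →
    (∀ {M} → (∀ c → M i c ≡ M j c) → D M ≡ + 0) →
    ∀ {M N} → (∀ c → N i c ≡ M j c) → (∀ c → N j c ≡ M i c) →
    (∀ r → r ≢ i → r ≢ j → ∀ c → N r c ≡ M r c) → D N ≡ - D M
  swap-rows {m} {d} {D} ml i j i≢j vanish {M} {N} Ni Nj Nr = finish (D M) (D N) (begin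
    D (rows u v) + + 1 * D (rows v u) ≡⟨ cong₂ (λ x y → x + + 1 * y) DM DN ⟩
    D M + + 1 * D N ∎) total
    where
    open Multilinear ml
    open ≡-Reasoning
    u v w : Fin d → ℤ
    u = M i
    v = M j
    w c = M i c + + 1 * M j c
    rows : (x y : Fin d → ℤ) → Matrix m d
    rows x y r with r Fin.≟ i | r Fin.≟ j
    ... | yes _ | _     = x
    ... | no _  | yes _ = y
    ... | no _  | no _  = M r
    row-i : ∀ x y → rows x y i ≡ x
    row-i x y with i Fin.≟ i | i Fin.≟ j
    ... | yes _ | _ = refl
    ... | no i≢i | _ = contradiction refl i≢i
    row-j : ∀ x y → rows x y j ≡ y
    row-j x y with j Fin.≟ i | j Fin.≟ j
    ... | yes j≡i | _ = contradiction (sym j≡i) i≢j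
    ... | no _ | yes _ = refl
    ... | no _ | no j≢j = contradiction refl j≢j
    not-i : ∀ x x' y r → r ≢ i → ∀ c → rows x y r c ≡ rows x' y r c
    not-i x x' y r r≢i c with r Fin.≟ i | r Fin.≟ j
    ... | yes p | _ = contradiction p r≢i
    ... | no _ | yes p = refl
    ... | no _ | no _ = refl
    not-j : ∀ x y y' r → r ≢ j → ∀ c → rows x y r c ≡ rows x y' r c
    not-j x y y' r r≢j c with r Fin.≟ i | r Fin.≟ j
    ... | yes p | _ = refl
    ... | no _ | yes p = contradiction p r≢j
    ... | no _ | no _ = refl
    lin-i : ∀ y → D (rows w y) ≡ D (rows u y) + + 1 * D (rows v y)
    lin-i y = linear i (+ 1) (not-i w u y) (not-i w v y) λ c →
      trans (cong (λ f → f c) (row-i w y)) (sym (cong₂ (λ f g → f c + + 1 * g c) (row-i u y) (row-i v y)))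
    lin-j : ∀ x → D (rows x w) ≡ D (rows x u) + + 1 * D (rows x v)
    lin-j x = linear j (+ 1) (not-j x w u) (not-j x w v) λ c →
      trans (cong (λ f → f c) (row-j x w)) (sym (cong₂ (λ f g → f c + + 1 * g c) (row-j x u) (row-j x v)))
    diag : ∀ x → D (rows x x) ≡ + 0
    diag x = vanish (λ c → cong (λ f → f c) (trans (row-i x x) (sym (row-j x x))))
    lem : ∀ p q → (+ 0 + + 1 * p) + + 1 * (q + + 1 * + 0) ≡ p + + 1 * q
    lem = solve-∀
    total : D (rows u v) + + 1 * D (rows v u) ≡ + 0
    total = begin
      D (rows u v) + + 1 * D (rows v u) ≡⟨ lem (D (rows u v)) (D (rows v u)) ⟨
      (+ 0 + + 1 * D (rows u v)) + + 1 * (D (rows v u) + + 1 * + 0)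
        ≡⟨ cong₂ (λ x y → (x + + 1 * D (rows u v)) + + 1 * (D (rows v u) + + 1 * y)) (diag u) (diag v) ⟨
      (D (rows u u) + + 1 * D (rows u v)) + + 1 * (D (rows v u) + + 1 * D (rows v v))
        ≡⟨ cong₂ (λ x y → x + + 1 * y) (lin-j u) (lin-j v) ⟨
      D (rows u w) + + 1 * D (rows v w) ≡⟨ lin-i w ⟨
      D (rows w w) ≡⟨ diag w ⟩
      + 0 ∎
    DM : D (rows u v) ≡ D M
    DM = ext λ r c → at r c
      where
      at : ∀ r c → rows u v r c ≡ M r c
      at r c with r Fin.≟ i | r Fin.≟ j
      ... | yes refl | _ = refl
      ... | no _ | yes refl = refl
      ... | no _ | no _ = refl
    DN : D (rows v u) ≡ D N
    DN = ext λ r c → at r c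
      where
      at : ∀ r c → rows v u r c ≡ N r c
      at r c with r Fin.≟ i | r Fin.≟ j
      ... | yes refl | _ = sym (Ni c)
      ... | no _ | yes refl = sym (Nj c)
      ... | no r≢i | no r≢j = sym (Nr r r≢i r≢j c)
    finish : ∀ x y {z} → z ≡ x + + 1 * y → z ≡ + 0 → y ≡ - x
    finish x y p q = trans (lem′ x y) (trans (cong (λ z → z + - x) (trans (sym p) q)) (ℤ.+-identityˡ (- x)))
      where
      lem′ : ∀ x y → y ≡ x + + 1 * y + - x
      lem′ = solve-∀

  -- Exchanging the order of summation negates the sum, and ℤ has no 2-torsion.
  antisymmetric-sum : (H : Fin m → Fin m → ℤ) → (∀ i j → H i j ≡ - H j i) → sumF (λ i → sumF (H i)) ≡ + 0
  antisymmetric-sum H anti = self-negative _ (begin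
    sumF (λ i → sumF (H i))                 ≡⟨ sumF-comm H ⟩
    sumF (λ j → sumF (λ i → H i j))         ≡⟨ sumF-cong
        (λ j → sumF-cong (λ i → trans (anti i j) (sym (ℤ.-1*i≡-i (H j i))))) ⟩
    sumF (λ j → sumF (λ i → ℤ.-1ℤ * H j i)) ≡⟨ sumF-cong (λ j → sumF-* ℤ.-1ℤ (H j)) ⟩
    sumF (λ j → ℤ.-1ℤ * sumF (H j))       ≡⟨ sumF-* ℤ.-1ℤ (λ j → sumF (H j)) ⟩
    ℤ.-1ℤ * sumF (λ j → sumF (H j))       ≡⟨ ℤ.-1*i≡-i _ ⟩
    - sumF (λ j → sumF (H j)) ∎)
    where open ≡-Reasoning

  punchIn-punchIn : (i j : Fin (suc (suc m))) (i≢j : i ≢ j) (j≢i : j ≢ i) (c : Fin m) →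
    punchIn i (punchIn (punchOut i≢j) c) ≡ punchIn j (punchIn (punchOut j≢i) c)
  punchIn-punchIn zero zero i≢j j≢i c = contradiction refl i≢j
  punchIn-punchIn zero (suc j) i≢j j≢i c = refl
  punchIn-punchIn (suc i) zero i≢j j≢i c = refl
  punchIn-punchIn (suc i) (suc j) i≢j j≢i zero = refl
  punchIn-punchIn (suc i) (suc j) i≢j j≢i (suc c) =
    cong suc (punchIn-punchIn i j (i≢j ∘ cong suc) (j≢i ∘ cong suc) c)

  -- Of two deleted columns only the right-hand one changes its index when the other is deleted
  -- first, so reversing the order of deletion costs exactly one sign.
  sign-punchOut : (i j : Fin (suc (suc m))) (i≢j : i ≢ j) (j≢i : j ≢ i) →
    sign (toℕ i) * sign (toℕ (punchOut i≢j)) ≡ - (sign (toℕ j) * sign (toℕ (punchOut j≢i)))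
  sign-punchOut zero zero i≢j j≢i = contradiction refl i≢j
  sign-punchOut zero (suc j) i≢j j≢i = lem (sign (toℕ j))
    where
    lem : ∀ s → + 1 * s ≡ - (- s * + 1)
    lem = solve-∀
  sign-punchOut (suc i) zero i≢j j≢i = lem (sign (toℕ i))
    where
    lem : ∀ s → - s * + 1 ≡ - (+ 1 * s)
    lem = solve-∀
  sign-punchOut {zero} (suc zero) (suc zero) i≢j j≢i = contradiction refl i≢j
  sign-punchOut {suc m} (suc i) (suc j) i≢j j≢i =
    trans (lem (sign (toℕ i)) _) (trans (sign-punchOut i j (i≢j ∘ cong suc) (j≢i ∘ cong suc))
        (cong -_ (sym (lem (sign (toℕ j)) _))))
    where
    lem : ∀ s t → - s * - t ≡ s * t
    lem = solve-∀

  -- Expansion along both rows is a sum over ordered pairs of distinct columns. Interchanging the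
  -- columns keeps the remaining minor and, the rows being equal, the product of entries, while the
  -- sign flips. `H` is extended by zero to the diagonal to obtain a square antisymmetric sum.
  det-first-two-rows : (M : Matrix (suc (suc m)) (suc (suc m))) →
    (∀ c → M zero c ≡ M (suc zero) c) → det M ≡ + 0
  det-first-two-rows {m} M eq = trans (sumF-cong term) (antisymmetric-sum H H-anti)
    where
    open ≡-Reasoning
    a = M zero
    W : Fin (suc (suc m)) → Fin (suc m) → ℤ
    W j k = det (λ r c → M (suc (suc r)) (punchIn j (punchIn k c)))
    E : ∀ {j l} → j ≢ l → ℤ
    E {j} {l} j≢l = sign (toℕ j) * sign (toℕ (punchOut j≢l)) * (a j * a l) * W j (punchOut j≢l)
    H′ : ∀ j l → Dec (j ≡ l) → ℤ
    H′ j l (yes _)  = + 0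
    H′ j l (no j≢l) = E j≢l
    H : Fin (suc (suc m)) → Fin (suc (suc m)) → ℤ
    H j l = H′ j l (j Fin.≟ l)
    H-diag : ∀ j → H j j ≡ + 0
    H-diag j with j Fin.≟ j
    ... | yes _ = refl
    ... | no j≢j = contradiction refl j≢j
    H-anti : ∀ j l → H j l ≡ - H l j
    H-anti j l with j Fin.≟ l | l Fin.≟ j
    ... | yes _ | yes _ = refl
    ... | yes p | no q = contradiction (sym p) q
    ... | no p | yes q = contradiction (sym q) p
    ... | no p | no q = trans
      (cong₂ (λ x y → x * (a j * a l) * y) (sign-punchOut j l p q)
        (det-ext (λ r c → cong (M (suc (suc r))) (punchIn-punchIn j l p q c))))
      (lem (sign (toℕ l) * sign (toℕ (punchOut q))) (a j) (a l) (W l (punchOut q)))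
      where
      lem : ∀ s x y w → (- s) * (x * y) * w ≡ - (s * (y * x) * w)
      lem = solve-∀
    H-punchIn : ∀ j k → H j (punchIn j k) ≡ sign (toℕ j) * a j * (sign (toℕ k) * M (suc zero) (punchIn j k) * W j k)
    H-punchIn j k with j Fin.≟ punchIn j k
    ... | yes p = contradiction (sym p) (punchInᵢ≢i j k)
    ... | no p = begin
      E p ≡⟨ cong (λ z → sign (toℕ j) * sign (toℕ z) * (a j * a (punchIn j k)) * W j z)
               (trans (punchOut-cong j {i≢k = punchInᵢ≢i j k ∘ sym} refl) (punchOut-punchIn j)) ⟩
      sign (toℕ j) * sign (toℕ k) * (a j * a (punchIn j k)) * W j k
        ≡⟨ cong (λ z → sign (toℕ j) * sign (toℕ k) * (a j * z) * W j k) (eq (punchIn j k)) ⟩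
      sign (toℕ j) * sign (toℕ k) * (a j * M (suc zero) (punchIn j k)) * W j k
        ≡⟨ lem (sign (toℕ j)) (sign (toℕ k)) (a j) (M (suc zero) (punchIn j k)) (W j k) ⟩
      sign (toℕ j) * a j * (sign (toℕ k) * M (suc zero) (punchIn j k) * W j k) ∎
      where
      lem : ∀ s t x y w → s * t * (x * y) * w ≡ s * x * (t * y * w)
      lem = solve-∀
    term : ∀ j → sign (toℕ j) * M zero j * det (λ r c → M (suc r) (punchIn j c)) ≡ sumF (H j)
    term j = begin
      sign (toℕ j) * a j * sumF (λ k → sign (toℕ k) * M (suc zero) (punchIn j k) * W j k)
        ≡⟨ sumF-* (sign (toℕ j) * a j) (λ k → sign (toℕ k) * M (suc zero) (punchIn j k) * W j k) ⟨
      sumF (λ k → sign (toℕ j) * a j * (sign (toℕ k) * M (suc zero) (punchIn j k) * W j k))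
        ≡⟨ sumF-cong (H-punchIn j) ⟨
      sumF (λ k → H j (punchIn j k)) ≡⟨ ℤ.+-identityˡ _ ⟨
      + 0 + sumF (λ k → H j (punchIn j k)) ≡⟨ cong (_+ sumF (λ k → H j (punchIn j k))) (H-diag j) ⟨
      H j j + sumF (λ k → H j (punchIn j k)) ≡⟨ sumF-punchIn j (H j) ⟨
      sumF (H j) ∎

  -- If both rows lie below the top, every minor vanishes. For the top row and a later one, a swap
  -- below the top brings the equal row to second place; the swap negates each minor by `swap-rows`
  -- in the smaller size, where vanishing is already known.
  det-equal-rows : {i j : Fin m} → i ≢ j → {M : Matrix m m} → (∀ c → M i c ≡ M j c) → det M ≡ + 0
  det-equal-zero : (j : Fin m) {M : Matrix (suc m) (suc m)} → (∀ c → M zero c ≡ M (suc j) c) → det M ≡ + 0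
  det-equal-rows {i = zero} {zero} i≢j eq = contradiction refl i≢j
  det-equal-rows {i = zero} {suc j} i≢j {M} eq = det-equal-zero j {M} eq
  det-equal-rows {i = suc i} {zero} i≢j {M} eq = det-equal-zero i {M} (sym ∘ eq)
  det-equal-rows {i = suc i} {suc j} i≢j {M} eq = sumF-zero λ k →
    trans (cong (λ z → sign (toℕ k) * M zero k * z) (det-equal-rows (i≢j ∘ cong suc) {λ r c → M (suc r) (punchIn k c)}
        (λ c → eq (punchIn k c))))
      (ℤ.*-zeroʳ (sign (toℕ k) * M zero k))
  det-equal-zero {suc m} zero {M} eq = det-first-two-rows M eq
  det-equal-zero {suc m} (suc j) {M} eq = begin
    det M       ≡⟨ ℤ.neg-involutive (det M) ⟨
    - - det M   ≡⟨ cong -_ det-M′ ⟨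
    - det M′    ≡⟨ cong -_ (det-first-two-rows M′ eq) ⟩
    + 0 ∎
    where
    open ≡-Reasoning
    s : Fin (suc m) → Fin (suc m)
    s zero = suc j
    s (suc r) = if does (r Fin.≟ j) then zero else suc r
    M′ : Matrix (suc (suc m)) (suc (suc m))
    M′ zero = M zero
    M′ (suc r) = M (suc (s r))
    s-j : s (suc j) ≡ zero
    s-j = cong (if_then zero else suc j) (dec-true (j Fin.≟ j) refl)
    s-r : ∀ r → r ≢ zero → r ≢ suc j → s r ≡ r
    s-r zero r≢0 _ = contradiction refl r≢0
    s-r (suc r) _ r≢j = cong (if_then zero else suc r) (dec-false (r Fin.≟ j) (r≢j ∘ cong suc))
    minor : Matrix _ _ → Fin (suc (suc m)) → ℤ
    minor X k = det (λ r c → X (suc r) (punchIn k c))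
    det-M′ : det M′ ≡ - det M
    det-M′ = begin
      det M′ ≡⟨ sumF-cong (λ k → cong (λ z → sign (toℕ k) * M zero k * z)
          (swap-rows det-multilinear zero (suc j) (λ ()) (λ {X} → det-equal-zero j {X})
            {M = λ r c → M (suc r) (punchIn k c)}
            (λ c → refl) (λ c → cong (λ z → M (suc z) (punchIn k c)) s-j)
            (λ r p q c → cong (λ z → M (suc z) (punchIn k c)) (s-r r p q)))) ⟩
      sumF (λ k → sign (toℕ k) * M zero k * - minor M k) ≡⟨ sumF-cong (λ k → lem (sign (toℕ k)) (M zero k) (minor M k)) ⟩
      sumF (λ k → ℤ.-1ℤ * (sign (toℕ k) * M zero k * minor M k)) ≡⟨ sumF-* ℤ.-1ℤ
          (λ k → sign (toℕ k) * M zero k * minor M k) ⟩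
      ℤ.-1ℤ * det M ≡⟨ ℤ.-1*i≡-i _ ⟩
      - det M ∎
      where
      lem : ∀ s x y → s * x * - y ≡ ℤ.-1ℤ * (s * x * y)
      lem = solve-∀

  det-alternating : Alternating (det {m})
  det-alternating = record { multilinear = det-multilinear ; equal-rows = λ i≢j {M} → det-equal-rows i≢j {M} }

  linear-functional : (L : (Fin d → ℤ) → ℤ) → (∀ {u v} → (∀ c → u c ≡ v c) → L u ≡ L v) →
    (∀ a u v → L (λ c → u c + a * v c) ≡ L u + a * L v) →
    ∀ u → L u ≡ sumF (λ j → u j * L (δ j))
  -- All vectors over `Fin 0` coincide, so linearity with scalar 1 reads L u = L u + L u.
  linear-functional {zero} L ext lin u = ℤ+.∙-cancelˡ (L u) (L u) (+ 0) (begin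
    L u + L u         ≡⟨ cong (λ z → L u + z) (ℤ.*-identityˡ (L u)) ⟨
    L u + + 1 * L u ≡⟨ lin (+ 1) u u ⟨
    L _                 ≡⟨ ext (λ ()) ⟩
    L u                 ≡⟨ ℤ.+-identityʳ (L u) ⟨
    L u + + 0 ∎)
    where open ≡-Reasoning
  linear-functional {suc d} L ext lin u = begin
    L u ≡⟨ ext split ⟩
    L (λ c → (+ 0 ◂ tail u) c + u zero * δ zero c) ≡⟨ lin (u zero) (+ 0 ◂ tail u) (δ zero) ⟩
    L (+ 0 ◂ tail u) + u zero * L (δ zero) ≡⟨ ℤ.+-comm (L (+ 0 ◂ tail u)) _ ⟩
    u zero * L (δ zero) + L (+ 0 ◂ tail u) ≡⟨ cong (λ z → u zero * L (δ zero) + z) rest ⟩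
    sumF (λ j → u j * L (δ j)) ∎
    where
    open ≡-Reasoning
    split : ∀ c → u c ≡ (+ 0 ◂ tail u) c + u zero * δ zero c
    split zero = sym (trans (ℤ.+-identityˡ _) (ℤ.*-identityʳ (u zero)))
    split (suc c) = sym (trans (cong (λ z → u (suc c) + z) (ℤ.*-zeroʳ (u zero))) (ℤ.+-identityʳ _))
    L′ : (Fin d → ℤ) → ℤ
    L′ v = L (+ 0 ◂ v)
    lem0 : ∀ a → + 0 ≡ + 0 + a * + 0
    lem0 = solve-∀
    rest : L′ (tail u) ≡ sumF (λ j → u (suc j) * L (δ (suc j)))
    rest = trans (linear-functional L′ (λ eq → ext λ { zero → refl ; (suc c) → eq c })
      (λ a x y → trans (ext λ { zero → lem0 a ; (suc c) → refl }) (lin a (+ 0 ◂ x) (+ 0 ◂ y))) (tail u))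
      (sumF-cong λ j → cong (u (suc j) *_) (ext λ { zero → refl ; (suc c) → refl }))

  cons-row : {D : Matrix (suc m) d → ℤ} → Multilinear D → (u : Fin d → ℤ) → Multilinear (λ R → D (u ◂ R))
  cons-row ml u = record
    { ext = λ eq → ext λ { zero c → refl ; (suc r) c → eq r c }
    ; linear = λ i a mu mv eq → linear (suc i) a
        (λ { zero _ c → refl ; (suc r) r≢i c → mu r (r≢i ∘ cong suc) c })
        (λ { zero _ c → refl ; (suc r) r≢i c → mv r (r≢i ∘ cong suc) c })
        eq
    }
    where open Multilinear ml

  expand-head : {D : Matrix (suc m) d → ℤ} → Multilinear D → ∀ M → D M ≡ sumF (λ j → M zero j * D (δ j ◂ tail M))
  expand-head {D = D} ml M = trans (ext λ { zero c → refl ; (suc r) c → refl })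
    (linear-functional (λ u → D (u ◂ tail M))
      (λ eq → ext λ { zero c → eq c ; (suc r) c → refl })
      (λ a u v → linear zero a (λ { zero p → contradiction refl p ; (suc r) _ c → refl })
        (λ { zero p → contradiction refl p ; (suc r) _ c → refl }) (λ c → refl)) (M zero))
    where open Multilinear ml

  -- Each added multiple of `e` contributes, by linearity in its row, a matrix that has `e` as a
  -- row, and those are killed. With `e` the pivot row this clears a column by row operations.
  absorb : {D : Matrix m d → ℤ} → Multilinear D → (e : Fin d → ℤ) →
    (∀ {R} r → (∀ c → R r c ≡ e c) → D R ≡ + 0) →
    (a : Fin m → ℤ) (R : Matrix m d) → D (λ r c → R r c + a r * e c) ≡ D R
  absorb {zero} ml e vanish a R = Multilinear.ext ml (λ ())
  absorb {suc m} {D = D} ml e vanish a R = begin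
    D R+ ≡⟨ linear zero (a zero) {R+} {u ◂ tail R+} {e ◂ tail R+} same same (λ c → refl) ⟩
    D (u ◂ tail R+) + a zero * D (e ◂ tail R+) ≡⟨ cong (λ z → D (u ◂ tail R+) + a zero * z) (vanish zero (λ c → refl)) ⟩
    D (u ◂ tail R+) + a zero * + 0 ≡⟨ cong (λ z → D (u ◂ tail R+) + z) (ℤ.*-zeroʳ (a zero)) ⟩
    D (u ◂ tail R+) + + 0 ≡⟨ ℤ.+-identityʳ _ ⟩
    D (u ◂ tail R+) ≡⟨ absorb (cons-row ml u) e (λ r eq → vanish (suc r) eq) (tail a) (tail R) ⟩
    D (u ◂ tail R) ≡⟨ ext (λ { zero c → refl ; (suc r) c → refl }) ⟩
    D R ∎
    where
    open ≡-Reasoning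
    open Multilinear ml
    u = R zero
    R+ : Matrix _ _
    R+ r c = R r c + a r * e c
    same : ∀ {v : Fin _ → ℤ} r → r ≢ zero → ∀ c → R+ r c ≡ (v ◂ tail R+) r c
    same zero r≢0 = contradiction refl r≢0
    same (suc r) _ c = refl

  data PunchView (i : Fin (suc m)) : Fin (suc m) → Set where
    hole  : PunchView i i
    other : ∀ k → PunchView i (punchIn i k)

  punchView : (i j : Fin (suc m)) → PunchView i j
  punchView i j with i Fin.≟ j
  ... | yes refl = hole
  ... | no i≢j = subst (PunchView i) (punchIn-punchOut i≢j) (other (punchOut i≢j))

  -- The row δ j swallows all entries of column j, so D restricts to a form on the minor.
  delete-column : (D : Matrix (suc m) (suc m) → ℤ) → Fin (suc m) → Matrix m m → ℤ
  delete-column D j B = D (δ j ◂ λ r → insertAt (B r) j (+ 0))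

  delete-column-alternating : {D : Matrix (suc m) (suc m) → ℤ} → Alternating D → ∀ j → Alternating (delete-column D j)
  delete-column-alternating {D = D} alt j = record
    { multilinear = record
      { ext = λ eq → E.ext (λ r → insert-ext (eq r))
      ; linear = λ i a mu mv eq → E.linear i a (λ r p → insert-ext (mu r p)) (λ r p → insert-ext (mv r p))
          (insert-linear a eq)
      }
    ; equal-rows = λ i≢k eq → equal-rows (i≢k ∘ suc-injective) (insert-ext eq)
    }
    where
    open Alternating alt
    module E = Multilinear (cons-row multilinear (δ j))
    insert-ext : ∀ {u v} → (∀ c → u c ≡ v c) → ∀ c → insertAt u j (+ 0) c ≡ insertAt v j (+ 0) c
    insert-ext {u} {v} eq c with punchView j c
    ... | hole = trans (insertAt-lookup u j _) (sym (insertAt-lookup v j _))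
    ... | other k = trans (insertAt-punchIn u j _ k) (trans (eq k) (sym (insertAt-punchIn v j _ k)))
    lem0 : ∀ a → + 0 ≡ + 0 + a * + 0
    lem0 = solve-∀
    insert-linear : ∀ a {w u v} → (∀ c → w c ≡ u c + a * v c) →
      ∀ c → insertAt w j (+ 0) c ≡ insertAt u j (+ 0) c + a * insertAt v j (+ 0) c
    insert-linear a {w} {u} {v} eq c with punchView j c
    ... | hole = trans (insertAt-lookup w j _) (trans (lem0 a)
          (sym (cong₂ (λ x y → x + a * y) (insertAt-lookup u j _) (insertAt-lookup v j _))))
    ... | other k = trans (insertAt-punchIn w j _ k) (trans (eq k)
          (sym (cong₂ (λ x y → x + a * y) (insertAt-punchIn u j _ k) (insertAt-punchIn v j _ k))))

  reduce-to-minor : {D : Matrix (suc m) (suc m) → ℤ} → Alternating D → ∀ j R →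
    D (δ j ◂ R) ≡ delete-column D j (λ r c → R r (punchIn j c))
  reduce-to-minor {m} {D = D} alt j R = begin
    D (δ j ◂ R) ≡⟨ E.ext decompose ⟩
    D (δ j ◂ λ r c → R₀ r c + R r j * δ j c) ≡⟨ absorb (cons-row multilinear (δ j)) (δ j)
        (λ r eq → equal-rows {zero} {suc r} (λ ()) (sym ∘ eq)) (λ r → R r j) R₀ ⟩
    D (δ j ◂ R₀) ∎
    where
    open ≡-Reasoning
    open Alternating alt
    module E = Multilinear (cons-row multilinear (δ j))
    R₀ : Matrix m (suc m)
    R₀ r = insertAt (λ c → R r (punchIn j c)) j (+ 0)
    decompose : ∀ r c → R r c ≡ R₀ r c + R r j * δ j c
    decompose r c with punchView j c
    ... | hole = sym (trans (cong₂ (λ x y → x + R r j * y) (insertAt-lookup _ j _) (δ-refl j)) (lem (R r j)))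
      where
      lem : ∀ x → + 0 + x * + 1 ≡ x
      lem = solve-∀
    ... | other k = sym (trans (cong₂ (λ x y → x + R r j * y) (insertAt-punchIn _ j _ k) (δ-≢ (punchInᵢ≢i j k ∘ sym)))
        (lem (R r (punchIn j k)) (R r j)))
      where
      lem : ∀ x y → x + y * + 0 ≡ x
      lem = solve-∀

  δ-punchIn : (j : Fin (suc m)) (r : Fin m) → ∀ c → δ (punchIn j r) c ≡ insertAt (δ r) j (+ 0) c
  δ-punchIn j r c with punchView j c
  ... | hole = trans (δ-≢ (punchInᵢ≢i j r)) (sym (insertAt-lookup _ j _))
  ... | other k with r Fin.≟ k
  ...   | yes refl = trans (δ-refl (punchIn j r)) (sym (trans (insertAt-punchIn _ j _ r) (δ-refl r)))
  ...   | no r≢k = trans (δ-≢ (r≢k ∘ punchIn-injective j r k)) (sym (trans (insertAt-punchIn _ j _ k) (δ-≢ r≢k)))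

  punchIn-suc-hit : (j : Fin m) → punchIn (suc j) j ≡ inject₁ j
  punchIn-suc-hit zero = refl
  punchIn-suc-hit (suc j) = cong suc (punchIn-suc-hit j)

  punchIn-inject₁-hit : (j : Fin m) → punchIn (inject₁ j) j ≡ suc j
  punchIn-inject₁-hit zero = refl
  punchIn-inject₁-hit (suc j) = cong suc (punchIn-inject₁-hit j)

  punchIn-suc-miss : (j r : Fin m) → r ≢ j → punchIn (suc j) r ≡ punchIn (inject₁ j) r
  punchIn-suc-miss zero zero r≢j = contradiction refl r≢j
  punchIn-suc-miss zero (suc r) r≢j = refl
  punchIn-suc-miss (suc j) zero r≢j = refl
  punchIn-suc-miss (suc j) (suc r) r≢j = cong suc (punchIn-suc-miss j r (r≢j ∘ cong suc))

  -- Bringing row `j` of the identity to the top is done in stages: consecutive rotations differ by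
  -- a single transposition involving the top row, so only signs change.
  vanish-rotated : {D : Matrix (suc m) (suc m) → ℤ} → Alternating D → D δ ≡ + 0 →
    ∀ j → D (δ j ◂ λ r → δ (punchIn j r)) ≡ + 0
  vanish-rotated {m} {D} alt D0 j = go (toℕ j) j refl
    where
    open Alternating alt
    Z : Fin (suc m) → Matrix (suc m) (suc m)
    Z j = δ j ◂ λ r → δ (punchIn j r)
    go : ∀ t j → toℕ j ≡ t → D (Z j) ≡ + 0
    go _ zero _ = trans (ext λ { zero c → refl ; (suc r) c → refl }) D0
    go (suc t) (suc j) eq = trans
      (swap-rows multilinear zero (suc j) (λ ()) (equal-rows (λ ())) {M = Z (inject₁ j)}
        (λ c → cong (λ z → δ z c) (sym (punchIn-inject₁-hit j)))
        (λ c → cong (λ z → δ z c) (punchIn-suc-hit j))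
        (λ { zero p _ → contradiction refl p ; (suc r) _ p c → cong (λ z → δ z c) (punchIn-suc-miss j r (p ∘ cong suc)) }))
      (cong -_ (go t (inject₁ j) (trans (Fin.toℕ-inject₁ j) (ℕ.suc-injective eq))))

  -- Induction on the size: expansion in the top row reduces `D` to forms on minors, each of them
  -- again alternating, with value at the identity equal to that of `D` at a rotated identity.
  alternating-zero : {D : Matrix m m → ℤ} → Alternating D → D δ ≡ + 0 → ∀ M → D M ≡ + 0
  alternating-zero {zero} alt D0 M = trans (Alternating.ext alt (λ ())) D0
  alternating-zero {suc m} {D} alt D0 M = trans (expand-head multilinear M) (sumF-zero λ j →
    trans (cong (M zero j *_) (trans (reduce-to-minor alt j (tail M))
      (alternating-zero (delete-column-alternating alt j) (base j) _))) (ℤ.*-zeroʳ (M zero j)))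
    where
    open Alternating alt
    base : ∀ j → delete-column D j δ ≡ + 0
    base j = trans (ext λ { zero c → refl ; (suc r) c → sym (δ-punchIn j r c) }) (vanish-rotated alt D0 j)

  scalar : ℤ → Matrix m m
  scalar q i j = if does (i Fin.≟ j) then q else + 0

  det-scalar : ∀ m q → det {m} (scalar q) ≡ q ℤ.^ m
  det-scalar zero q = refl
  det-scalar (suc m) q = trans (sumF-only zero term vanish)
      (trans (lem′ q (det {m} (scalar q))) (cong (q *_) (det-scalar m q)))
    where
    lem : ∀ s w → s * + 0 * w ≡ + 0
    lem = solve-∀
    lem′ : ∀ q w → + 1 * q * w ≡ q * w
    lem′ = solve-∀
    term : Fin (suc m) → ℤ
    term j = sign (toℕ j) * scalar q zero j * det (λ r c → scalar q (suc r) (punchIn j c))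
    vanish : ∀ j → zero ≢ j → term j ≡ + 0
    vanish zero p = contradiction refl p
    vanish (suc j) _ = lem (- sign (toℕ j)) (det (λ r c → scalar q (suc r) (punchIn (suc j) c)))

  det-δ : ∀ m → det {m} δ ≡ + 1
  det-δ m = trans (det-scalar m (+ 1)) (ℤ.^-zeroˡ m)

  -- The difference of `D` and `D δ` times the determinant is alternating and vanishes at the
  -- identity.
  alternating-unique : {D : Matrix m m → ℤ} → Alternating D → ∀ M → D M ≡ D δ * det M
  alternating-unique {m} {D} alt M = ℤ.i-j≡0⇒i≡j (D M) (D δ * det M) (alternating-zero {D = D′} alt′ D′δ M)
    where
    open Alternating alt
    D′ : Matrix m m → ℤ
    D′ M = D M - D δ * det M
    alt′ : Alternating D′
    alt′ = record
      { multilinear = record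
        { ext = λ eq → cong₂ (λ x y → x - D δ * y) (ext eq) (det-ext eq)
        ; linear = λ i a {X} {U} {V} mu mv eq → trans
            (cong₂ (λ x y → x - D δ * y) (linear i a mu mv eq) (det-linear i a mu mv eq))
            (lem (D U) a (D V) (D δ) (det U) (det V))
        }
      ; equal-rows = λ {i} {j} i≢j {X} eq → trans
            (cong₂ (λ x y → x - D δ * y) (equal-rows i≢j eq) (det-equal-rows i≢j {X} eq)) (lem0 (D δ))
      }
      where
      lem : ∀ u a v t x y → u + a * v - t * (x + a * y) ≡ u - t * x + a * (v - t * y)
      lem = solve-∀
      lem0 : ∀ t → + 0 - t * + 0 ≡ + 0
      lem0 = solve-∀
    D′δ : D′ δ ≡ + 0
    D′δ = trans (cong (λ z → D δ - D δ * z) (det-δ m)) (lem (D δ))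
      where
      lem : ∀ t → t - t * + 1 ≡ + 0
      lem = solve-∀

  _⊡_ : Matrix m n → Matrix n d → Matrix m d
  (M ⊡ N) i j = sumF (λ k → M i k * N k j)

  -- For fixed `N` the determinant of the product is alternating in the rows of `M` and takes the
  -- value `det N` at the identity, so uniqueness applies.
  det-⊡ : (M N : Matrix m m) → det (M ⊡ N) ≡ det N * det M
  det-⊡ {m} M N = trans (alternating-unique alt M)
    (cong (_* det M) (det-ext λ i j → sumF-δˡ i (λ k → N k j)))
    where
    open Alternating (det-alternating {m})
    D : Matrix m m → ℤ
    D M = det (M ⊡ N)
    alt : Alternating D
    alt = record
      { multilinear = record
        { ext = λ eq → ext λ i j → sumF-cong λ k → cong (_* N k j) (eq i k)
        ; linear = λ i a {X} {U} {V} mu mv eq → linear i a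
            (λ r p c → sumF-cong λ k → cong (_* N k c) (mu r p k))
            (λ r p c → sumF-cong λ k → cong (_* N k c) (mv r p k))
            (λ c → trans (sumF-cong λ k → trans (cong (_* N k c) (eq k)) (lem (U i k) a (V i k) (N k c)))
              (sumF-linear a (λ k → U i k * N k c) (λ k → V i k * N k c)))
        }
      ; equal-rows = λ i≢j {X} eq → equal-rows i≢j {X ⊡ N} λ c → sumF-cong λ k → cong (_* N k c) (eq k)
      }
      where
      lem : ∀ u a v x → (u + a * v) * x ≡ u * x + a * (v * x)
      lem = solve-∀

  replaceRow : Matrix m d → Fin m → (Fin d → ℤ) → Matrix m d
  replaceRow M i u r c = if does (r Fin.≟ i) then u c else M r c

  replaceRow-at : (M : Matrix m d) (i : Fin m) (u : Fin d → ℤ) → ∀ c → replaceRow M i u i c ≡ u c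
  replaceRow-at M i u c = cong (if_then u c else M i c) (dec-true (i Fin.≟ i) refl)

  replaceRow-off : (M : Matrix m d) (i : Fin m) (u : Fin d → ℤ) → ∀ r → r ≢ i → ∀ c → replaceRow M i u r c ≡ M r c
  replaceRow-off M i u r r≢i c = cong (if_then u c else M r c) (dec-false (r Fin.≟ i) r≢i)

  -- This is the signed minor at row `k` and column `j`, the entry (j , k) of the adjugate;
  -- replacing a row by a unit vector avoids signs and deleted indices.
  cofactor : Matrix m m → Fin m → Fin m → ℤ
  cofactor M k j = det (replaceRow M k (δ j))

  -- By linearity in row `k` the sum is the determinant of `M` with row `k` replaced by row `i`:
  -- either `M` itself or a matrix with a repeated row.
  cramer : (M : Matrix m m) (i k : Fin m) → sumF (λ j → M i j * cofactor M k j) ≡ δ k i * det M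
  cramer M i k = trans (sym (linear-functional (λ u → det (replaceRow M k u)) ext-k lin-k (M i))) at-row
    where
    open Alternating det-alternating
    ext-k : ∀ {u v} → (∀ c → u c ≡ v c) → det (replaceRow M k u) ≡ det (replaceRow M k v)
    ext-k {u} {v} eq = ext λ r c → cong (λ z → if does (r Fin.≟ k) then z else M r c) (eq c)
    lin-k : ∀ a u v → det (replaceRow M k (λ c → u c + a * v c)) ≡ det (replaceRow M k u) + a * det (replaceRow M k v)
    lin-k a u v = linear k a
      (λ r p c → trans (replaceRow-off M k w r p c) (sym (replaceRow-off M k u r p c)))
      (λ r p c → trans (replaceRow-off M k w r p c) (sym (replaceRow-off M k v r p c)))
      (λ c → trans (replaceRow-at M k w c) (sym (cong₂ (λ x y → x + a * y) (replaceRow-at M k u c)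
          (replaceRow-at M k v c))))
      where
      w : Fin _ → ℤ
      w c = u c + a * v c
    at-row : det (replaceRow M k (M i)) ≡ δ k i * det M
    at-row with k Fin.≟ i
    ... | yes refl = trans (ext same) (sym (trans (ℤ.*-identityˡ (det M)) refl))
      where
      same : ∀ r c → replaceRow M k (M k) r c ≡ M r c
      same r c with r Fin.≟ k
      ... | yes refl = refl
      ... | no _ = refl
    ... | no k≢i = equal-rows k≢i {replaceRow M k (M i)}
      (λ c → trans (replaceRow-at M k (M i) c) (sym (replaceRow-off M k (M i) i (k≢i ∘ sym) c)))

open Determinant

-- Polynomial functions on the integers

module IntegralMatrices where

  open import Data.Integer using (_+_; _*_; _-_)

  private variable
    m d n k l : ℕ
    f g h : ℤ → ℤ

  -- Polynomial functions of degree below the index, in Horner form. Functions are compared by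
  -- values only, which matches a notion of integrality that tests the characteristic polynomial at
  -- integers. In `Monic` the index is the exact degree.
  data Poly : ℕ → (ℤ → ℤ) → Set where
    zero : (∀ x → f x ≡ + 0) → Poly k f
    step : ∀ c → Poly k g → (∀ x → f x ≡ c + x * g x) → Poly (suc k) f

  data Monic : ℕ → (ℤ → ℤ) → Set where
    one  : (∀ x → f x ≡ + 1) → Monic 0 f
    step : ∀ c → Monic k g → (∀ x → f x ≡ c + x * g x) → Monic (suc k) f

  poly-ext : Poly k f → (∀ x → g x ≡ f x) → Poly k g
  poly-ext (zero e) eq = zero λ x → trans (eq x) (e x)
  poly-ext (step c p e) eq = step c p λ x → trans (eq x) (e x)

  poly-weaken : k ≤ l → Poly k f → Poly l f
  poly-weaken k≤l (zero e) = zero e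
  poly-weaken (s≤s k≤l) (step c p e) = step c (poly-weaken k≤l p) e

  poly-+* : ∀ a → Poly k f → Poly k g → Poly k (λ x → f x + a * g x)
  poly-+* {f = f} {g} a (zero e) (zero e′) = zero λ x → trans (cong₂ (λ u v → u + a * v) (e x) (e′ x)) (lem a)
    where
    lem : ∀ a → + 0 + a * + 0 ≡ + 0
    lem = solve-∀
  poly-+* a (zero e) (step {g = g′} c q e′) =
    step (a * c) (poly-+* a (zero {f = λ _ → + 0} (λ _ → refl)) q) λ x →
      trans (cong₂ (λ u v → u + a * v) (e x) (e′ x)) (lem a c x (g′ x))
    where
    lem : ∀ a c x u → + 0 + a * (c + x * u) ≡ a * c + x * (+ 0 + a * u)
    lem = solve-∀
  poly-+* {f = f} a (step c p e) (zero e′) = poly-ext (step c p e) λ x →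
      trans (cong (λ v → f x + a * v) (e′ x)) (lem a (f x))
    where
    lem : ∀ a u → u + a * + 0 ≡ u
    lem = solve-∀
  poly-+* a (step {g = u} c p e) (step {g = v} c′ q e′) = step (c + a * c′) (poly-+* a p q) λ x →
      trans (cong₂ (λ u v → u + a * v) (e x) (e′ x)) (lem a c c′ x (u x) (v x))
    where
    lem : ∀ a c c′ x u v → c + x * u + a * (c′ + x * v) ≡ c + a * c′ + x * (u + a * v)
    lem = solve-∀

  poly-scale : ∀ a → Poly k f → Poly k (λ x → a * f x)
  poly-scale {f = f} a p = poly-ext (poly-+* a (zero {f = λ _ → + 0} (λ _ → refl)) p) λ x → sym (ℤ.+-identityˡ (a * f x))

  poly-+ : Poly k f → Poly k g → Poly k (λ x → f x + g x)
  poly-+ {f = f} {g} p q = poly-ext (poly-+* (+ 1) p q) λ x → cong (λ z → f x + z) (sym (ℤ.*-identityˡ (g x)))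

  poly-x : Poly k f → Poly (suc k) (λ x → x * f x)
  poly-x {f = f} p = step (+ 0) p λ x → sym (ℤ.+-identityˡ (x * f x))

  poly-const : ∀ c → Poly (suc k) (λ _ → c)
  poly-const c = step c (zero {f = λ _ → + 0} (λ _ → refl)) λ x →
      sym (trans (cong (λ z → c + z) (ℤ.*-zeroʳ x)) (ℤ.+-identityʳ c))

  poly-sum : (F : Fin m → ℤ → ℤ) → (∀ j → Poly k (F j)) → Poly k (λ x → sumF (λ j → F j x))
  poly-sum {zero} F p = zero λ _ → refl
  poly-sum {suc m} F p = poly-+ (p zero) (poly-sum (F ∘ suc) (p ∘ suc))

  poly-* : Poly k f → Poly l g → Poly (k ℕ.+ l) (λ x → f x * g x)
  poly-* (zero e) q = zero λ x → cong (_* _) (e x)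
  poly-* {k = suc k} {l = l} {g = h} (step {g = g} c p e) q =
    poly-ext (poly-+ (poly-weaken (ℕ.m≤n+m l (suc k)) (poly-scale c q)) (poly-x (poly-* p q)))
      λ x → trans (cong (_* h x) (e x)) (lem c x (g x) (h x))
    where
    lem : ∀ c x g h → (c + x * g) * h ≡ c * h + x * (g * h)
    lem = solve-∀

  monic⇒poly : Monic k f → Poly (suc k) f
  monic⇒poly (one e) = poly-ext (poly-const (+ 1)) e
  monic⇒poly (step c p e) = step c (monic⇒poly p) e

  monic-+ : Monic k f → Poly k g → Monic k (λ x → f x + g x)
  monic-+ (one e) (zero e′) = one λ x → cong₂ _+_ (e x) (e′ x)
  monic-+ {f = f} {g} (step {g = u} c p e) (zero e′) = step c p λ x → trans (cong₂ _+_ (e x) (e′ x)) (ℤ.+-identityʳ _)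
  monic-+ (step {g = u} c p e) (step {g = v} c′ q e′) = step (c + c′) (monic-+ p q) λ x →
      trans (cong₂ _+_ (e x) (e′ x)) (lem c c′ x (u x) (v x))
    where
    lem : ∀ c c′ x u v → c + x * u + (c′ + x * v) ≡ c + c′ + x * (u + v)
    lem = solve-∀

  monic-ext : Monic k f → (∀ x → g x ≡ f x) → Monic k g
  monic-ext (one e) eq = one λ x → trans (eq x) (e x)
  monic-ext (step c p e) eq = step c p λ x → trans (eq x) (e x)

  monic-x : Monic k f → Monic (suc k) (λ x → x * f x)
  monic-x {f = f} p = step (+ 0) p λ x → sym (ℤ.+-identityˡ (x * f x))

  poly-det-affine : (a b : Matrix m m) → Poly (suc m) (λ x → det (λ i j → a i j + b i j * x))
  poly-det-affine {zero} a b = poly-const (+ 1)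
  poly-det-affine {suc m} a b = poly-sum _ λ j →
    let D = λ x → det (λ r c → a (suc r) (punchIn j c) + b (suc r) (punchIn j c) * x)
        p = poly-det-affine (λ r c → a (suc r) (punchIn j c)) (λ r c → b (suc r) (punchIn j c))
    in poly-ext (poly-+ (poly-weaken (ℕ.n≤1+n (suc m)) (poly-scale (sign (toℕ j) * a zero j) p)) (poly-x (poly-scale (sign (toℕ j) * b zero j) p)))
         λ x → lem (sign (toℕ j)) (a zero j) (b zero j) x (D x)
    where
    lem : ∀ s a b x w → s * (a + b * x) * w ≡ s * a * w + x * (s * b * w)
    lem = solve-∀

  ≤-sumFℕ : (K : Fin m → ℕ) → ∀ j → K j ≤ sumFℕ K
  ≤-sumFℕ K zero = ℕ.m≤m+n (K zero) _
  ≤-sumFℕ K (suc j) = ℕ.≤-trans (≤-sumFℕ (K ∘ suc) j) (ℕ.m≤n+m _ (K zero))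

  poly-det : (E : Fin m → Fin m → ℤ → ℤ) → (∀ i j → ∃[ k ] Poly k (E i j)) → ∃[ k ] Poly k (λ x → det (λ i j → E i j x))
  poly-det {zero} E p = 1 , poly-const (+ 1)
  poly-det {suc m} E p = _ , poly-sum _ λ j → poly-weaken (≤-sumFℕ (proj₁ ∘ summand) j) (proj₂ (summand j))
    where
    summand : ∀ j → ∃[ k ] Poly k (λ x → sign (toℕ j) * E zero j x * det (λ r c → E (suc r) (punchIn j c) x))
    summand j = _ , poly-* (poly-scale (sign (toℕ j)) (proj₂ (p zero j)))
        (proj₂ (poly-det _ (λ r c → p (suc r) (punchIn j c))))

  charMatrix : Matrix m m → ℤ → Matrix m m
  charMatrix A x i j = (if does (i Fin.≟ j) then x else + 0) - A i j

  charMatrix-affine : (A : Matrix m m) → ∀ x i j → charMatrix A x i j ≡ - A i j + δ i j * x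
  charMatrix-affine A x i j with does (i Fin.≟ j)
  ... | true = lem x (A i j)
    where
    lem : ∀ x a → x - a ≡ - a + + 1 * x
    lem = solve-∀
  ... | false = lem x (A i j)
    where
    lem : ∀ x a → + 0 - a ≡ - a + + 0 * x
    lem = solve-∀

  -- Only the diagonal term of the first-row expansion reaches full degree; the others are constants
  -- times minors of size m, whose degree is at most m because their entries are affine in x.
  charPoly-monic : (A : Matrix m m) → Monic m (charPoly A)
  charPoly-monic {zero} A = one λ _ → refl
  charPoly-monic {suc m} A = monic-ext
    (monic-+ (monic-x M) (poly-+ (poly-scale (- A zero zero) (monic⇒poly M)) (poly-sum _ rest)))
    λ x → trans (cong (λ z → z + tailSum x) (lem x (A zero zero) (charPoly A₀ x)))
        (ℤ.+-assoc (x * charPoly A₀ x) (- A zero zero * charPoly A₀ x) (tailSum x))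
    where
    A₀ : Matrix m m
    A₀ r c = A (suc r) (suc c)
    M = charPoly-monic A₀
    summand : Fin m → ℤ → ℤ
    summand j x = sign (toℕ (suc j)) * (+ 0 - A zero (suc j)) * det (λ r c → charMatrix A x (suc r) (punchIn (suc j) c))
    tailSum : ℤ → ℤ
    tailSum x = sumF (λ j → summand j x)
    rest : ∀ j → Poly (suc m) (summand j)
    rest j = poly-scale (sign (toℕ (suc j)) * (+ 0 - A zero (suc j)))
      (poly-ext (poly-det-affine (λ r c → - A (suc r) (punchIn (suc j) c)) (λ r c → δ (suc r) (punchIn (suc j) c)))
        λ x → det-ext λ r c → charMatrix-affine A x (suc r) (punchIn (suc j) c))
    lem : ∀ x a w → + 1 * (x - a) * w ≡ x * w + - a * w
    lem = solve-∀

  Eventually : (ℕ → Set) → Set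
  Eventually P = ∃[ B ] ∀ x → B ≤ x → P x

  -- Wherever the sum vanishes, x divides c; one such x above the absolute value of c forces c = 0.
  constant-term : ∀ c (y : ℕ → ℤ) → Eventually (λ x → c + + x * y x ≡ + 0) → c ≡ + 0
  constant-term c y (B , eq) = ℤ.∣i∣≡0⇒i≡0 (vanish ℤ.∣ y x ∣ ∣c∣≡)
    where
    open ≡-Reasoning
    x = B ℕ.+ suc ℤ.∣ c ∣
    lem : ∀ c z → c ≡ c + z - z
    lem = solve-∀
    ∣c∣≡ : ℤ.∣ c ∣ ≡ x ℕ.* ℤ.∣ y x ∣
    ∣c∣≡ = begin
      ℤ.∣ c ∣ ≡⟨ cong ℤ.∣_∣ (lem c (+ x * y x)) ⟩
      ℤ.∣ c + + x * y x - + x * y x ∣ ≡⟨ cong (λ z → ℤ.∣ z - + x * y x ∣) (eq x (ℕ.m≤m+n B _)) ⟩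
      ℤ.∣ + 0 - + x * y x ∣ ≡⟨ cong ℤ.∣_∣ (ℤ.+-identityˡ (- (+ x * y x))) ⟩
      ℤ.∣ - (+ x * y x) ∣ ≡⟨ ℤ.∣-i∣≡∣i∣ (+ x * y x) ⟩
      ℤ.∣ + x * y x ∣ ≡⟨ ℤ.abs-* (+ x) (y x) ⟩
      x ℕ.* ℤ.∣ y x ∣ ∎
    vanish : ∀ z → ℤ.∣ c ∣ ≡ x ℕ.* z → ℤ.∣ c ∣ ≡ 0
    vanish zero e = trans e (ℕ.*-zeroʳ x)
    vanish (suc z) e = contradiction (ℕ.≤-trans (ℕ.m≤n+m (suc ℤ.∣ c ∣) B)
        (ℕ.≤-trans (ℕ.m≤m*n x (suc z)) (ℕ.≤-reflexive (sym e)))) (ℕ.<-irrefl refl)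

  higher-terms : ∀ c (y : ℕ → ℤ) → Eventually (λ x → c + + x * y x ≡ + 0) → Eventually (λ x → y x ≡ + 0)
  -- The threshold moves to `suc B` so that x is positive and can be cancelled.
  higher-terms c y ev@(B , eq) = suc B , λ { (suc x) (s≤s B≤x) →
    ℤ.*-cancelˡ-≡ (+ suc x) (y (suc x)) (+ 0) (begin
      + suc x * y (suc x)          ≡⟨ ℤ.+-identityˡ _ ⟨
      + 0 + + suc x * y (suc x)  ≡⟨ cong (λ z → z + + suc x * y (suc x)) (constant-term c y ev) ⟨
      c + + suc x * y (suc x)    ≡⟨ eq (suc x) (ℕ.m≤n⇒m≤1+n B≤x) ⟩
      + 0                            ≡⟨ ℤ.*-zeroʳ (+ suc x) ⟨
      + suc x * + 0 ∎) }
    where open ≡-Reasoning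

  poly-eventually-zero : Poly k f → Eventually (λ x → f (+ x) ≡ + 0) → ∀ x → f x ≡ + 0
  poly-eventually-zero (zero e) ev = e
  poly-eventually-zero (step {g = g} c p e) (B , eq) x =
    trans (e x) (trans (cong₂ (λ u v → u + x * v) (constant-term c (g ∘ +_) ev)
        (poly-eventually-zero p (higher-terms c (g ∘ +_) ev) x))
      (trans (ℤ.+-identityˡ _) (ℤ.*-zeroʳ x)))
    where
    ev : Eventually (λ x → c + + x * g (+ x) ≡ + 0)
    ev = B , λ x B≤x → trans (sym (e (+ x))) (eq x B≤x)

  monic-not-eventually-zero : Monic k f → Eventually (λ x → f (+ x) ≡ + 0) → ⊥
  monic-not-eventually-zero (one e) (B , eq) = contradiction (trans (sym (e (+ B))) (eq B ℕ.≤-refl)) λ ()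
  monic-not-eventually-zero (step {g = g} c p e) (B , eq) = monic-not-eventually-zero p
    (higher-terms c (g ∘ +_) (B , λ x B≤x → trans (sym (e (+ x))) (eq x B≤x)))

  private
    divide-step : ∀ c x ν gx gν q → gx ≡ gν + (x - ν) * q →
      c + x * gx ≡ c + ν * gν + (x - ν) * (gν + x * q)
    divide-step c x ν gx gν q refl = lem c x ν gν q
      where
      lem : ∀ c x ν gν q → c + x * (gν + (x - ν) * q) ≡ c + ν * gν + (x - ν) * (gν + x * q)
      lem = solve-∀

  poly-divide : Poly k f → ∀ ν → Σ[ q ∈ (ℤ → ℤ) ] Poly k q × (∀ x → f x ≡ f ν + (x - ν) * q x)
  poly-divide (zero e) ν = (λ _ → + 0) , zero (λ _ → refl) , λ x →
    trans (e x) (sym (trans (cong₂ _+_ (e ν) (ℤ.*-zeroʳ (x - ν))) refl))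
  poly-divide (step {g = g} c p e) ν with poly-divide p ν
  ... | q , pq , eq = (λ x → g ν + x * q x) , step (g ν) pq (λ _ → refl) , λ x →
    trans (e x) (trans (divide-step c x ν (g x) (g ν) (q x) (eq x))
        (cong (λ z → z + (x - ν) * (g ν + x * q x)) (sym (e ν))))

  monic-divide : Monic (suc k) f → ∀ ν → Σ[ q ∈ (ℤ → ℤ) ] Monic k q × (∀ x → f x ≡ f ν + (x - ν) * q x)
  monic-divide (step {g = g} c (one e′) e) ν = (λ _ → + 1) , one (λ _ → refl) , λ x →
    trans (e x) (trans (cong (λ z → c + x * z) (e′ x))
      (trans (lem c x ν) (cong (λ z → z + (x - ν) * + 1) (sym (trans (e ν) (cong (λ z → c + ν * z) (e′ ν)))))))
    where
    lem : ∀ c x ν → c + x * + 1 ≡ c + ν * + 1 + (x - ν) * + 1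
    lem = solve-∀
  monic-divide (step {g = g} c p@(step _ _ _) e) ν with monic-divide p ν
  ... | q , pq , eq = (λ x → g ν + x * q x) , step (g ν) pq (λ _ → refl) , λ x →
    trans (e x) (trans (divide-step c x ν (g x) (g ν) (q x) (eq x))
        (cong (λ z → z + (x - ν) * (g ν + x * q x)) (sym (e ν))))

  splitPoly : List ℤ → ℤ → ℤ
  splitPoly []       x = + 1
  splitPoly (ν ∷ νs) x = (x - ν) * splitPoly νs x

  poly-splitPoly : ∀ νs → ∃[ k ] Poly k (splitPoly νs)
  poly-splitPoly [] = 1 , poly-const (+ 1)
  poly-splitPoly (ν ∷ νs) = _ , poly-ext (poly-* (poly-+ (poly-x {k = 1} (poly-const (+ 1))) (poly-const (- ν)))
      (proj₂ (poly-splitPoly νs)))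
    λ x → cong (λ z → (z - ν) * splitPoly νs x) (sym (ℤ.*-identityʳ x))

  splitPoly-++ : ∀ νs μs x → splitPoly (νs ++ μs) x ≡ splitPoly νs x * splitPoly μs x
  splitPoly-++ [] μs x = sym (ℤ.*-identityˡ _)
  splitPoly-++ (ν ∷ νs) μs x = trans (cong ((x - ν) *_) (splitPoly-++ νs μs x)) (sym (ℤ.*-assoc (x - ν) _ _))

  unit-product⇒abs≡1 : ∀ x y → x * y ≡ + 1 → ℤ.∣ x ∣ ≡ 1
  unit-product⇒abs≡1 x y eq = ℕ.m*n≡1⇒m≡1 ℤ.∣ x ∣ ℤ.∣ y ∣ (trans (sym (ℤ.abs-* x y)) (cong ℤ.∣_∣ eq))

  -- With f = c + x g, both f(x) and c = f(0) have absolute value 1, so x g(x) is at most 2 in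
  -- absolute value. Hence the monic g vanishes from x = 3 on, which is impossible.
  monic-unit⇒degree-0 : Monic (suc k) f → (∀ x → ℤ.∣ f x ∣ ≡ 1) → ⊥
  monic-unit⇒degree-0 {f = f} (step {g = g} c p e) unit = monic-not-eventually-zero p (3 , λ x 3≤x → small x 3≤x)
    where
    lem : ∀ c z → z ≡ c + z - c
    lem = solve-∀
    f0 : f (+ 0) ≡ c
    f0 = trans (e (+ 0)) (ℤ.+-identityʳ c)
    ∣c∣≡1 : ℤ.∣ c ∣ ≡ 1
    ∣c∣≡1 = trans (cong ℤ.∣_∣ (sym f0)) (unit (+ 0))
    bound : ∀ x → x ℕ.* ℤ.∣ g (+ x) ∣ ≤ 2
    bound x = begin
      x ℕ.* ℤ.∣ g (+ x) ∣ ≡⟨ ℤ.abs-* (+ x) (g (+ x)) ⟨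
      ℤ.∣ + x * g (+ x) ∣ ≡⟨ cong ℤ.∣_∣ (lem c _) ⟩
      ℤ.∣ c + + x * g (+ x) - c ∣ ≡⟨ cong (λ z → ℤ.∣ z - c ∣) (e (+ x)) ⟨
      ℤ.∣ f (+ x) - c ∣ ≤⟨ ℤ.∣i-j∣≤∣i∣+∣j∣ (f (+ x)) c ⟩
      ℤ.∣ f (+ x) ∣ ℕ.+ ℤ.∣ c ∣ ≡⟨ cong₂ ℕ._+_ (unit (+ x)) ∣c∣≡1 ⟩
      2 ∎
      where open ℕ.≤-Reasoning
    small : ∀ x → 3 ≤ x → g (+ x) ≡ + 0
    small x 3≤x with ℤ.∣ g (+ x) ∣ in eq | bound x
    ... | zero  | _ = ℤ.∣i∣≡0⇒i≡0 eq
    ... | suc z | b = contradiction (ℕ.≤-trans 3≤x (ℕ.≤-trans (ℕ.m≤m*n x (suc z)) b)) λ { (s≤s (s≤s ())) }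

  -- The factor x - ν is nonzero once x exceeds the absolute value of ν, and polynomial functions
  -- that agree from some point on agree everywhere.
  cancel-root : ∀ ν → Poly k f → Poly l g → (∀ x → (x - ν) * f x ≡ (x - ν) * g x) → ∀ x → f x ≡ g x
  cancel-root {k = k} {f = f} {l} {g} ν p q eq x = ℤ.i-j≡0⇒i≡j (f x) (g x) (poly-eventually-zero
    (poly-ext (poly-+* ℤ.-1ℤ (poly-weaken (ℕ.m≤m+n k l) p) (poly-weaken (ℕ.m≤n+m l k) q))
        (λ x → cong (λ z → f x + z) (sym (ℤ.-1*i≡-i (g x)))))
    (suc ℤ.∣ ν ∣ , λ y ν<y → ℤ.i≡j⇒i-j≡0 (cancel y ν<y)) x)
    where
    cancel : ∀ y → suc ℤ.∣ ν ∣ ≤ y → f (+ y) ≡ g (+ y)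
    cancel y ν<y = ℤ.*-cancelˡ-≡ (+ y - ν) _ _ {{ℤ.≢-nonZero λ e →
        ℕ.<-irrefl (cong ℤ.∣_∣ (sym (ℤ.i-j≡0⇒i≡j (+ y) ν e))) ν<y}} (eq (+ y))

  drop-zero : ∀ {u v w} → v ≡ + 0 → u ≡ v + w → u ≡ w
  drop-zero refl eq = trans eq (ℤ.+-identityˡ _)

  -- A root ν of the product is removed from whichever factor vanishes at it, until the monic factor is a unit.
  monic-factor-splits : ∀ {m} νs → Monic m f → Poly k g → (∀ x → f x * g x ≡ splitPoly νs x) →
    Σ[ ev ∈ (Fin m → ℤ) ] ∀ x → f x ≡ prodF (λ i → x - ev i)
  monic-factor-splits _ (one e) q eq = (λ ()) , e
  monic-factor-splits {f = f} {g = g} [] p@(step _ _ _) q eq =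
    ⊥-elim (monic-unit⇒degree-0 p λ x → unit-product⇒abs≡1 (f x) (g x) (eq x))
  monic-factor-splits {f = f} {g = g} (ν ∷ νs) p@(step _ _ _) q eq
    with ℤ.i*j≡0⇒i≡0∨j≡0 (f ν) (trans (eq ν) (cong (_* splitPoly νs ν) (ℤ.i≡j⇒i-j≡0 {ν} refl)))
  ... | inj₁ fν≡0 with monic-divide p ν
  ...   | h , ph , f≡ with monic-factor-splits νs ph q
      (cancel-root ν (poly-* (monic⇒poly ph) q) (proj₂ (poly-splitPoly νs)) λ x →
            trans (sym (ℤ.*-assoc (x - ν) (h x) (g x))) (trans (cong (_* g x) (sym (drop-zero fν≡0 (f≡ x)))) (eq x)))
  ...     | ev , h≡ = (λ { zero → ν ; (suc i) → ev i }) , λ x → trans (drop-zero fν≡0 (f≡ x)) (cong ((x - ν) *_) (h≡ x))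
  monic-factor-splits {f = f} {g = g} (ν ∷ νs) p@(step _ _ _) q eq | inj₂ gν≡0 with poly-divide q ν
  ...   | h , ph , g≡ = monic-factor-splits νs p ph (cancel-root ν (poly-* (monic⇒poly p) ph)
      (proj₂ (poly-splitPoly νs)) λ x →
            trans (lem (f x) (x - ν) (h x)) (trans (cong (f x *_) (sym (drop-zero gν≡0 (g≡ x)))) (eq x)))
    where
    lem : ∀ f y h → y * (f * h) ≡ f * (y * h)
    lem = solve-∀

  -- Linear operators, Cayley-Hamilton and the criterion for integrality

  Op : Set → Set
  Op I = (I → ℤ) → I → ℤ

  record Linear {I : Set} (P : Op I) : Set where
    field
      ext : ∀ {φ ψ} → (∀ i → φ i ≡ ψ i) → ∀ i → P φ i ≡ P ψ i
      linear : ∀ a φ ψ i → P (λ i → φ i + a * ψ i) i ≡ P φ i + a * P ψ i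

  splitOp : {I : Set} → Op I → List ℤ → Op I
  splitOp P []       φ = φ
  splitOp P (ν ∷ νs) φ i = P (splitOp P νs φ) i - ν * splitOp P νs φ i

  mulVec : Matrix m m → Op (Fin m)
  mulVec A φ i = sumF (λ j → A i j * φ j)

  mulVec-linear : (A : Matrix m m) → Linear (mulVec A)
  mulVec-linear A = record
    { ext = λ eq i → sumF-cong λ j → cong (A i j *_) (eq j)
    ; linear = λ a φ ψ i → trans (sumF-cong λ j → lem (A i j) (φ j) a (ψ j))
        (sumF-linear a (λ j → A i j * φ j) (λ j → A i j * ψ j))
    }
    where
    lem : ∀ x u a v → x * (u + a * v) ≡ x * u + a * (x * v)
    lem = solve-∀

  splitOp-linear : {I : Set} {P : Op I} → Linear P → ∀ νs → Linear (splitOp P νs)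
  splitOp-linear lin [] = record { ext = λ eq → eq ; linear = λ a φ ψ i → refl }
  splitOp-linear {P = P} lin (ν ∷ νs) = record
    { ext = λ eq i → cong₂ (λ x y → x - ν * y) (ext (S.ext eq) i) (S.ext eq i)
    ; linear = λ a φ ψ i → trans (cong₂ (λ x y → x - ν * y) (trans (ext (S.linear a φ ψ) i) (linear a _ _ i))
        (S.linear a φ ψ i))
        (lem (P (splitOp P νs φ) i) a (P (splitOp P νs ψ) i) ν (splitOp P νs φ i) (splitOp P νs ψ i))
    }
    where
    open Linear lin
    module S = Linear (splitOp-linear lin νs)
    lem : ∀ u a v ν x y → u + a * v - ν * (x + a * y) ≡ u - ν * x + a * (v - ν * y)
    lem = solve-∀

  -- F ⇝ v: F is a polynomial with coefficients in ℤ^m, and substituting the matrix A for the variable gives v.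
  module Substitution {m} (A : Matrix m m) where

    open Linear (mulVec-linear A)

    infix 4 _⇝_

    data _⇝_ : (ℤ → Fin m → ℤ) → (Fin m → ℤ) → Set where
      zero : {F : ℤ → Fin m → ℤ} {v : Fin m → ℤ} → (∀ x i → F x i ≡ + 0) → (∀ i → v i ≡ + 0) → F ⇝ v
      step : {F G : ℤ → Fin m → ℤ} {v w : Fin m → ℤ} (c : Fin m → ℤ) → G ⇝ w → (∀ x i → F x i ≡ c i + x * G x i) →
          (∀ i → v i ≡ c i + mulVec A w i) → F ⇝ v

    ⇝-zero : ∀ {F v} → F ⇝ v → Eventually (λ x → ∀ i → F (+ x) i ≡ + 0) → ∀ i → v i ≡ + 0
    ⇝-zero (zero _ e) _ = e
    ⇝-zero (step {G = G} {w = w} c r eF ev) (B , eq) i = begin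
      _ ≡⟨ ev i ⟩
      c i + mulVec A w i ≡⟨ cong₂ _+_ (constant-term (c i) _ (B , λ x B≤x → trans (sym (eF (+ x) i)) (eq x B≤x i)))
          (ext (⇝-zero r higher) i) ⟩
      + 0 + mulVec A (λ _ → + 0) i ≡⟨ ℤ.+-identityˡ _ ⟩
      mulVec A (λ _ → + 0) i ≡⟨ sumF-zero (λ j → ℤ.*-zeroʳ (A i j)) ⟩
      + 0 ∎
      where
      open ≡-Reasoning
      higher : Eventually (λ x → ∀ i → G (+ x) i ≡ + 0)
      higher = suc B , λ { (suc x) (s≤s B≤x) i →
        ℤ.*-cancelˡ-≡ (+ suc x) (G (+ suc x) i) (+ 0) (trans (sym (ℤ.+-identityˡ _))
          (trans (cong (λ z → z + + suc x * G (+ suc x) i) (sym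
              (constant-term (c i) _ (B , λ x B≤x → trans (sym (eF (+ x) i)) (eq x B≤x i)))))
          (trans (sym (eF (+ suc x) i)) (trans (eq (suc x) (ℕ.m≤n⇒m≤1+n B≤x) i) (sym (ℤ.*-zeroʳ (+ suc x))))))) }

    ⇝-ext : ∀ {F G v w} → F ⇝ v → (∀ x i → G x i ≡ F x i) → (∀ i → w i ≡ v i) → G ⇝ w
    ⇝-ext (zero a b) e e′ = zero (λ x i → trans (e x i) (a x i)) (λ i → trans (e′ i) (b i))
    ⇝-ext (step c r a b) e e′ = step c r (λ x i → trans (e x i) (a x i)) (λ i → trans (e′ i) (b i))

    ⇝-+* : ∀ a {F G v w} → F ⇝ v → G ⇝ w → (λ x i → F x i + a * G x i) ⇝ (λ i → v i + a * w i)
    ⇝-+* a {F} {G} {v} {w} p (zero e e′) = ⇝-ext p (λ x i → trans (cong (λ z → F x i + a * z) (e x i)) (lem a (F x i)))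
      (λ i → trans (cong (λ z → v i + a * z) (e′ i)) (lem a (v i)))
      where
      lem : ∀ a u → u + a * + 0 ≡ u
      lem = solve-∀
    ⇝-+* a {F} {G} {v} {w} (zero e e′) (step {G = G′} {w = w′} c r f f′) = step (λ i → a * c i)
      (⇝-+* a (zero {λ _ _ → + 0} {λ _ → + 0} (λ _ _ → refl) (λ _ → refl)) r)
      (λ x i → trans (cong₂ (λ u v → u + a * v) (e x i) (f x i)) (lem a (c i) x (G′ x i)))
      (λ i → trans (cong₂ (λ u v → u + a * v) (e′ i) (f′ i)) (trans (lem′ a (c i) (mulVec A w′ i))
        (cong (λ z → a * c i + z) (sym (trans (linear a (λ _ → + 0) w′ i)
            (cong (λ z → z + a * mulVec A w′ i) (sumF-zero λ j → ℤ.*-zeroʳ (A i j))))))))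
      where
      lem : ∀ a c x u → + 0 + a * (c + x * u) ≡ a * c + x * (+ 0 + a * u)
      lem = solve-∀
      lem′ : ∀ a c u → + 0 + a * (c + u) ≡ a * c + (+ 0 + a * u)
      lem′ = solve-∀
    ⇝-+* a (step {G = F′} {w = v′} c r e e′) (step {G = G′} {w = w′} d s f f′) = step (λ i → c i + a * d i)
      (⇝-+* a r s)
      (λ x i → trans (cong₂ (λ u v → u + a * v) (e x i) (f x i)) (lem a (c i) (d i) x (F′ x i) (G′ x i)))
      (λ i → trans (cong₂ (λ u v → u + a * v) (e′ i) (f′ i)) (trans (lem′ a (c i) (d i) (mulVec A v′ i) (mulVec A w′ i))
        (cong (λ z → c i + a * d i + z) (sym (linear a v′ w′ i)))))
      where
      lem : ∀ a c c′ x u v → c + x * u + a * (c′ + x * v) ≡ c + a * c′ + x * (u + a * v)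
      lem = solve-∀
      lem′ : ∀ a c c′ u v → c + u + a * (c′ + v) ≡ c + a * c′ + (u + a * v)
      lem′ = solve-∀

    -- Makes substitution well defined: vector polynomials with equal values at the integers have
    -- equal coefficients, hence equal images.
    ⇝-unique : ∀ {F G v w} → F ⇝ v → G ⇝ w → (∀ x i → F x i ≡ G x i) → ∀ i → v i ≡ w i
    ⇝-unique {F} {G} {v} {w} p q eq i = ℤ.i-j≡0⇒i≡j (v i) (w i) (trans (cong (λ z → v i + z) (sym (ℤ.-1*i≡-i (w i))))
      (⇝-zero (⇝-+* ℤ.-1ℤ p q) (0 , λ x _ i → trans (cong₂ (λ u v → u + ℤ.-1ℤ * v) (eq (+ x) i) refl) (lem (G (+ x) i))) i))
      where
      lem : ∀ u → u + ℤ.-1ℤ * u ≡ + 0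
      lem = solve-∀

    ⇝-x : ∀ {F v} → F ⇝ v → (λ x i → x * F x i) ⇝ mulVec A v
    ⇝-x r = step (λ _ → + 0) r (λ x i → sym (ℤ.+-identityˡ _)) (λ i → sym (ℤ.+-identityˡ _))

    mulVec-zero : ∀ {φ} → (∀ i → φ i ≡ + 0) → ∀ i → mulVec A φ i ≡ + 0
    mulVec-zero eq i = sumF-zero λ j → trans (cong (A i j *_) (eq j)) (ℤ.*-zeroʳ (A i j))

    mulVec-step : ∀ x (u v w : Fin m → ℤ) → (∀ i → u i ≡ v i + x * w i) → ∀ i →
        mulVec A u i ≡ mulVec A v i + x * mulVec A w i
    mulVec-step x u v w eq i = trans (ext eq i) (linear x v w i)

    -- `A` commutes with its own powers, so it may be applied to the coefficients before or after
    -- substitution.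
    ⇝-mulVec : ∀ {F v} → F ⇝ v → (λ x → mulVec A (F x)) ⇝ mulVec A v
    ⇝-mulVec (zero e e′) = zero (λ x → mulVec-zero (e x)) (mulVec-zero e′)
    ⇝-mulVec {F} {v} (step {G = G} {w = w} c r e e′) = step (mulVec A c) (⇝-mulVec r)
      (λ x → mulVec-step x (F x) c (G x) (e x))
      (λ i → trans (mulVec-step (+ 1) v c (mulVec A w) (λ j → trans (e′ j) (cong (λ z → c j + z) (sym (ℤ.*-identityˡ _))))
          i)
        (cong (λ z → mulVec A c i + z) (ℤ.*-identityˡ _)))

    ⇝-const : ∀ u → (λ _ → u) ⇝ u
    ⇝-const u = step u (zero {λ _ _ → + 0} {λ _ → + 0} (λ _ _ → refl) (λ _ → refl))
      (λ x i → sym (trans (cong (λ z → u i + z) (ℤ.*-zeroʳ x)) (ℤ.+-identityʳ _)))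
      (λ i → sym (trans (cong (λ z → u i + z) (mulVec-zero (λ _ → refl) i)) (ℤ.+-identityʳ _)))

    ⇝-poly : Poly k f → (u : Fin m → ℤ) → ∃[ v ] (λ x i → f x * u i) ⇝ v
    ⇝-poly (zero e) u = (λ _ → + 0) , zero (λ x i → cong (_* u i) (e x)) (λ _ → refl)
    ⇝-poly (step {g = g} c p e) u with ⇝-poly p u
    ... | w , r = _ , step (λ i → c * u i) r (λ x i → trans (cong (_* u i) (e x)) (lem c x (g x) (u i))) (λ i → refl)
      where
      lem : ∀ c x g u → (c + x * g) * u ≡ c * u + x * (g * u)
      lem = solve-∀

    ⇝-sum : ∀ {d} (H : Fin d → ℤ → Fin m → ℤ) → (∀ j → ∃[ v ] H j ⇝ v) → ∃[ v ] (λ x i → sumF (λ j → H j x i)) ⇝ v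
    ⇝-sum {zero} H r = (λ _ → + 0) , zero (λ _ _ → refl) (λ _ → refl)
    ⇝-sum {suc d} H r = _ , ⇝-ext (⇝-+* (+ 1) (proj₂ (r zero)) (proj₂ (⇝-sum (H ∘ suc) (r ∘ suc))))
      (λ x i → cong (λ z → H zero x i + z) (sym (ℤ.*-identityˡ _))) (λ i → refl)

    ⇝-components : (F : ℤ → Fin m → ℤ) → (∀ j → ∃[ k ] Poly k (λ x → F x j)) → ∃[ v ] F ⇝ v
    ⇝-components F p with ⇝-sum (λ j x i → F x j * δ j i) (λ j → ⇝-poly (proj₂ (p j)) (δ j))
    ... | v , r = v , ⇝-ext r (λ x i → sym (sumF-δʳ i (F x))) (λ _ → refl)

    ⇝-splitPoly : ∀ νs u → (λ x i → splitPoly νs x * u i) ⇝ splitOp (mulVec A) νs u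
    ⇝-splitPoly [] u = ⇝-ext (⇝-const u) (λ x i → ℤ.*-identityˡ _) (λ i → refl)
    ⇝-splitPoly (ν ∷ νs) u = ⇝-ext (⇝-+* (- ν) (⇝-x (⇝-splitPoly νs u)) (⇝-splitPoly νs u))
      (λ x i → lem x ν (splitPoly νs x) (u i))
      (λ i → lem′ (mulVec A (splitOp (mulVec A) νs u) i) ν (splitOp (mulVec A) νs u i))
      where
      lem : ∀ x ν s u → (x - ν) * s * u ≡ x * (s * u) + - ν * (s * u)
      lem = solve-∀
      lem′ : ∀ x ν s → x - ν * s ≡ x + - ν * s
      lem′ = solve-∀

  charMatrix-apply : (A : Matrix m m) → ∀ x φ i → mulVec (charMatrix A x) φ i ≡ x * φ i - mulVec A φ i
  charMatrix-apply A x φ i = begin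
    sumF (λ j → charMatrix A x i j * φ j)
      ≡⟨ sumF-cong (λ j → trans (cong (_* φ j) (charMatrix-affine A x i j)) (lem (A i j) (δ i j) x (φ j))) ⟩
    sumF (λ j → δ i j * (x * φ j) + ℤ.-1ℤ * (A i j * φ j))
      ≡⟨ sumF-linear ℤ.-1ℤ (λ j → δ i j * (x * φ j)) (λ j → A i j * φ j) ⟩
    sumF (λ j → δ i j * (x * φ j)) + ℤ.-1ℤ * mulVec A φ i
      ≡⟨ cong₂ _+_ (sumF-δˡ i (λ j → x * φ j)) (ℤ.-1*i≡-i (mulVec A φ i)) ⟩
    x * φ i - mulVec A φ i ∎
    where
    open ≡-Reasoning
    lem : ∀ a d x p → (- a + d * x) * p ≡ d * (x * p) + ℤ.-1ℤ * (a * p)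
    lem = solve-∀

  poly-cofactor : (A : Matrix m m) (k j : Fin m) → Poly (suc m) (λ x → cofactor (charMatrix A x) k j)
  poly-cofactor A k j = poly-ext (poly-det-affine (replaceRow (λ r c → - A r c) k (δ j)) (replaceRow δ k (λ _ → + 0)))
    λ x → det-ext (entry x)
    where
    entry : ∀ x r c → replaceRow (charMatrix A x) k (δ j) r c ≡
      replaceRow (λ r c → - A r c) k (δ j) r c + replaceRow δ k (λ _ → + 0) r c * x
    entry x r c with does (r Fin.≟ k)
    ... | true = sym (ℤ.+-identityʳ _)
    ... | false = charMatrix-affine A x r c

  -- Column k of the adjugate of x - A is a vector polynomial b with x b(x) - A b(x) = χ(x) δ k.
  -- Substituting A for x turns the left side into A v - A v, whatever v is, and the right side into
  -- χ(A) δ k.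
  cayley-hamilton : (A : Matrix m m) (νs : List ℤ) → (∀ x → charPoly A x ≡ splitPoly νs x) →
    ∀ φ i → splitOp (mulVec A) νs φ i ≡ + 0
  cayley-hamilton {m} A νs eq φ i = trans
    (linear-functional (λ φ → splitOp (mulVec A) νs φ i) (λ e → ext e i) (λ a u v → linear a u v i) φ)
    (sumF-zero λ k → trans (cong (φ k *_) (basis k i)) (ℤ.*-zeroʳ (φ k)))
    where
    open Substitution A
    open Linear (splitOp-linear (mulVec-linear A) νs)
    basis : ∀ k i → splitOp (mulVec A) νs (δ k) i ≡ + 0
    basis k i with ⇝-components (λ x j → cofactor (charMatrix A x) k j) (λ j → _ , poly-cofactor A k j)
    ... | v , r = trans (⇝-unique (⇝-splitPoly νs (δ k)) (⇝-+* ℤ.-1ℤ (⇝-x r) (⇝-mulVec r)) same i) (lem (mulVec A v i))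
      where
      lem : ∀ u → u + ℤ.-1ℤ * u ≡ + 0
      lem = solve-∀
      same : ∀ x i → splitPoly νs x * δ k i ≡ x * cofactor (charMatrix A x) k i + ℤ.-1ℤ * mulVec A
          (cofactor (charMatrix A x) k) i
      same x i = begin
        splitPoly νs x * δ k i ≡⟨ ℤ.*-comm (splitPoly νs x) (δ k i) ⟩
        δ k i * splitPoly νs x ≡⟨ cong (δ k i *_) (eq x) ⟨
        δ k i * charPoly A x ≡⟨ cramer (charMatrix A x) i k ⟨
        mulVec (charMatrix A x) (cofactor (charMatrix A x) k) i ≡⟨ charMatrix-apply A x (cofactor (charMatrix A x) k) i ⟩
        x * cofactor (charMatrix A x) k i - mulVec A (cofactor (charMatrix A x) k) i
          ≡⟨ cong (λ z → x * cofactor (charMatrix A x) k i + z) (ℤ.-1*i≡-i _) ⟨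
        x * cofactor (charMatrix A x) k i + ℤ.-1ℤ * mulVec A (cofactor (charMatrix A x) k) i ∎
        where open ≡-Reasoning

  prodF-splitPoly : (ev : Fin m → ℤ) → ∀ x → prodF (λ i → x - ev i) ≡ splitPoly (List.tabulate ev) x
  prodF-splitPoly {zero} ev x = refl
  prodF-splitPoly {suc m} ev x = cong ((x - ev zero) *_) (prodF-splitPoly (ev ∘ suc) x)

  Split : {I : Set} → Op I → Set
  Split P = ∃[ νs ] ∀ φ i → splitOp P νs φ i ≡ + 0

  integral⇒split : (A : Matrix m m) → IntegralMatrix A → Split (mulVec A)
  integral⇒split A (ev , eq) = List.tabulate ev , cayley-hamilton A (List.tabulate ev) λ x →
      trans (eq x) (prodF-splitPoly ev x)

  -- Column k of the matrix B(x) with (x - A) B(x) = ∏ (x - ν) - ∏ (A - ν).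
  cofactorColumn : Matrix m m → List ℤ → Fin m → ℤ → Fin m → ℤ
  cofactorColumn A []       k x j = + 0
  cofactorColumn A (ν ∷ νs) k x j = splitPoly νs x * δ k j +
    (mulVec A (cofactorColumn A νs k x) j - ν * cofactorColumn A νs k x j)

  poly-cofactorColumn : (A : Matrix m m) → ∀ νs k j → ∃[ d ] Poly d (λ x → cofactorColumn A νs k x j)
  poly-cofactorColumn A [] k j = 0 , zero λ _ → refl
  poly-cofactorColumn {m} A (ν ∷ νs) k j = D , poly-ext
    (poly-+ (poly-scale (δ k j) (poly-weaken (ℕ.m≤n+m (proj₁ (poly-splitPoly νs)) _) (proj₂ (poly-splitPoly νs))))
      (poly-+* (- ν) (poly-sum _ λ i → poly-scale (A j i) (lift i)) (lift j)))
    λ x → trans (cong (λ z → splitPoly νs x * δ k j + z)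
        (lem (mulVec A (cofactorColumn A νs k x) j) ν (cofactorColumn A νs k x j)))
       (cong (λ z → z + (mulVec A (cofactorColumn A νs k x) j + - ν * cofactorColumn A νs k x j))
           (ℤ.*-comm (splitPoly νs x) (δ k j)))
    where
    K : Fin m → ℕ
    K i = proj₁ (poly-cofactorColumn A νs k i)
    D = sumFℕ K ℕ.+ proj₁ (poly-splitPoly νs)
    lift : ∀ i → Poly D (λ x → cofactorColumn A νs k x i)
    lift i = poly-weaken (ℕ.≤-trans (≤-sumFℕ K i) (ℕ.m≤m+n (sumFℕ K) _)) (proj₂ (poly-cofactorColumn A νs k i))
    lem : ∀ u ν v → u - ν * v ≡ u + - ν * v
    lem = solve-∀

  -- Induction on the roots through (x - ν) p - (A - ν) Q = (x - A) p + (A - ν)(p - Q), where p is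
  -- the product of the remaining factors at x and Q the same product at A.
  cofactorColumn-spec : (A : Matrix m m) → ∀ νs k x i →
    x * cofactorColumn A νs k x i - mulVec A (cofactorColumn A νs k x) i ≡ splitPoly νs x * δ k i - splitOp (mulVec A) νs
        (δ k) i
  cofactorColumn-spec A [] k x i = trans (cong₂ _-_ (ℤ.*-zeroʳ x) (sumF-zero λ j → ℤ.*-zeroʳ (A i j))) (lem (δ k i))
    where
    lem : ∀ d → + 0 - + 0 ≡ + 1 * d - d
    lem = solve-∀
  cofactorColumn-spec {m} A (ν ∷ νs) k x i = begin
    x * (p * δ k i + (Ab i - ν * b i)) - mulVec A (cofactorColumn A (ν ∷ νs) k x) i ≡⟨ cong
        (λ z → x * (p * δ k i + (Ab i - ν * b i)) - z) apply-b′ ⟩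
    x * (p * δ k i + (Ab i - ν * b i)) - (Ab′ - ν * Ab i + p * Aδ) ≡⟨ lem x p (δ k i) (Ab i) ν (b i) Ab′ Aδ ⟩
    x * p * δ k i + (x * Ab i - Ab′) - ν * (x * b i - Ab i) - p * Aδ
      ≡⟨ cong₂ (λ u v → x * p * δ k i + u - ν * v - p * Aδ) applied (cofactorColumn-spec A νs k x i) ⟩
    x * p * δ k i + (p * Aδ - AQ) - ν * (p * δ k i - Q i) - p * Aδ ≡⟨ lem′ x p (δ k i) Aδ AQ ν (Q i) ⟩
    (x - ν) * p * δ k i - (AQ - ν * Q i) ∎
    where
    open ≡-Reasoning
    open Linear (mulVec-linear A)
    p = splitPoly νs x
    b Ab Q : Fin m → ℤ
    b = cofactorColumn A νs k x
    Ab = mulVec A b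
    Q = splitOp (mulVec A) νs (δ k)
    Ab′ = mulVec A Ab i
    Aδ = mulVec A (δ k) i
    AQ = mulVec A Q i
    apply-b′ : mulVec A (cofactorColumn A (ν ∷ νs) k x) i ≡ Ab′ - ν * Ab i + p * Aδ
    apply-b′ = trans (ext (λ j → e₁ (p) (δ k j) (Ab j) ν (b j)) i) (trans (linear p _ (δ k) i)
      (cong (λ z → z + p * Aδ) (trans (linear (- ν) Ab b i) (e₂ Ab′ ν (Ab i)))))
      where
      e₁ : ∀ p d u ν v → p * d + (u - ν * v) ≡ u + - ν * v + p * d
      e₁ = solve-∀
      e₂ : ∀ u ν v → u + - ν * v ≡ u - ν * v
      e₂ = solve-∀
    applied : x * Ab i - Ab′ ≡ p * Aδ - AQ
    applied = trans (sub x b Ab) (trans (ext (λ j → trans (e₁ x (b j) (Ab j))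
        (trans (cofactorColumn-spec A νs k x j) (sym (e₁ p (δ k j) (Q j))))) i) (sym (sub p (δ k) Q)))
      where
      e₁ : ∀ x u v → - v + x * u ≡ x * u - v
      e₁ = solve-∀
      l0 : ∀ v → - v ≡ + 0 + ℤ.-1ℤ * v
      l0 = solve-∀
      l1 : ∀ x u v → x * u - v ≡ + 0 + ℤ.-1ℤ * v + x * u
      l1 = solve-∀
      sub : ∀ x u v → x * mulVec A u i - mulVec A v i ≡ mulVec A (λ j → - v j + x * u j) i
      sub x u v = sym (trans (linear x (λ j → - v j) u i) (trans (cong (λ z → z + x * mulVec A u i)
        (trans (ext (λ j → l0 (v j)) i) (trans (linear ℤ.-1ℤ (λ _ → + 0) v i)
            (cong (λ z → z + ℤ.-1ℤ * mulVec A v i) (sumF-zero λ j → ℤ.*-zeroʳ (A i j))))))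
        (sym (l1 x (mulVec A u i) (mulVec A v i)))))
    lem : ∀ x p d Ab ν b Ab′ Aδ → x * (p * d + (Ab - ν * b)) - (Ab′ - ν * Ab + p * Aδ) ≡
      x * p * d + (x * Ab - Ab′) - ν * (x * b - Ab) - p * Aδ
    lem = solve-∀
    lem′ : ∀ x p d Aδ AQ ν Q → x * p * d + (p * Aδ - AQ) - ν * (p * d - Q) - p * Aδ ≡ (x - ν) * p * d - (AQ - ν * Q)
    lem′ = solve-∀

  splitPoly-power : ∀ νs m → ∃[ μs ] ∀ x → splitPoly νs x ℤ.^ m ≡ splitPoly μs x
  splitPoly-power νs zero = [] , λ _ → refl
  splitPoly-power νs (suc m) with splitPoly-power νs m
  ... | μs , eq = νs ++ μs , λ x → trans (cong (splitPoly νs x *_) (eq x)) (sym (splitPoly-++ νs μs x))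

  -- Since ∏ (A - ν) = 0, the columns give (x - A) B(x) = ∏ (x - ν) times the identity. Determinants
  -- turn this into a factorisation of ∏ (x - ν)^m in which the characteristic polynomial is a monic
  -- factor.
  split⇒integral : (A : Matrix m m) → Split (mulVec A) → IntegralMatrix A
  split⇒integral {m} A (νs , vanish) with splitPoly-power νs m | poly-det (λ j k x → cofactorColumn A νs k x j)
      (λ j k → poly-cofactorColumn A νs k j)
  ... | μs , pow | _ , p = monic-factor-splits μs (charPoly-monic A) p λ x → begin
    charPoly A x * det (B x) ≡⟨ ℤ.*-comm (charPoly A x) (det (B x)) ⟩
    det (B x) * charPoly A x ≡⟨ det-⊡ (charMatrix A x) (B x) ⟨
    det (charMatrix A x ⊡ B x) ≡⟨ det-ext (λ i k → entries x i k) ⟩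
    det {m} (scalar (splitPoly νs x)) ≡⟨ det-scalar m (splitPoly νs x) ⟩
    splitPoly νs x ℤ.^ m ≡⟨ pow x ⟩
    splitPoly μs x ∎
    where
    open ≡-Reasoning
    B : ℤ → Matrix m m
    B x j k = cofactorColumn A νs k x j
    entries : ∀ x i k → (charMatrix A x ⊡ B x) i k ≡ scalar (splitPoly νs x) i k
    entries x i k = begin
      mulVec (charMatrix A x) (cofactorColumn A νs k x) i ≡⟨ charMatrix-apply A x (cofactorColumn A νs k x) i ⟩
      x * cofactorColumn A νs k x i - mulVec A (cofactorColumn A νs k x) i ≡⟨ cofactorColumn-spec A νs k x i ⟩
      splitPoly νs x * δ k i - splitOp (mulVec A) νs (δ k) i ≡⟨ cong (λ z → splitPoly νs x * δ k i - z) (vanish (δ k) i) ⟩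
      splitPoly νs x * δ k i - + 0 ≡⟨ ℤ.+-identityʳ _ ⟩
      splitPoly νs x * δ k i ≡⟨ entry ⟩
      scalar (splitPoly νs x) i k ∎
      where
      entry : splitPoly νs x * δ k i ≡ scalar (splitPoly νs x) i k
      entry with k Fin.≟ i | i Fin.≟ k
      ... | yes _ | yes _ = ℤ.*-identityʳ _
      ... | yes p | no q = contradiction (sym p) q
      ... | no p | yes q = contradiction (sym q) p
      ... | no _ | no _ = ℤ.*-zeroʳ (splitPoly νs x)

open IntegralMatrices
open import Data.Nat using (_+_; _*_)

-- Binomial coefficients modulo a prime

prime∤! : ∀ {p} → Prime p → ∀ k → k < p → ¬ p ∣ k !
prime∤! pp zero k<p p∣1 with ∣⇒≤ p∣1
... | s≤s z≤n = contradiction (ℕ.nonTrivial⇒n>1 _ {{prime⇒nonTrivial pp}}) (ℕ.<-irrefl ≡.refl)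
prime∤! pp (suc k) k<p p∣ with euclidsLemma (suc k) (k !) pp p∣
... | inj₁ p∣k = contradiction (∣⇒≤ p∣k) (ℕ.<⇒≱ k<p)
... | inj₂ p∣k! = prime∤! pp k (ℕ.<-trans (ℕ.n<1+n k) k<p) p∣k!

n∣n! : ∀ n → .{{NonZero n}} → n ∣ n !
n∣n! (suc n) = m∣m*n (n !)

-- In the factorisation of p! into the binomial coefficient, k! and (p - k)!, the prime p divides
-- the product but neither factorial.
prime∣binomial : ∀ {p} → Prime p → ∀ k → 0 < k → k < p → p ∣ p choose k
prime∣binomial {p} pp k 0<k k<p with euclidsLemma (p choose k) (k ! * (p ∸ k) !) pp
    (≡.subst (p ∣_) (≡.sym eq) (n∣n! p {{prime⇒nonZero pp}}))
  where
  instance _ = k !* (p ∸ k) !≢0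
  eq : (p choose k) * (k ! * (p ∸ k) !) ≡ p !
  eq = ≡.trans (≡.cong (_* (k ! * (p ∸ k) !)) (nCk≡n!/k![n-k]! (ℕ.<⇒≤ k<p))) (m/n*n≡m (k![n∸k]!∣n! (ℕ.<⇒≤ k<p)))
... | inj₁ p∣ = p∣
... | inj₂ p∣ with euclidsLemma (k !) ((p ∸ k) !) pp p∣
...   | inj₁ p∣k! = contradiction p∣k! (prime∤! pp k k<p)
...   | inj₂ p∣j! = contradiction p∣j! (prime∤! pp (p ∸ k) (ℕ.∸-monoʳ-< 0<k (ℕ.<⇒≤ k<p)))

-- Split elements and the Frobenius map in a commutative ring

module IntegerAlgebra (R : CommutativeRing 0ℓ 0ℓ)
  (morphism : ℤ.+-*-rawRing -Raw-AlmostCommutative⟶ fromCommutativeRing R) where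

  open CommutativeRing R using (Carrier; _≈_; 0#; 1#) renaming (_+_ to infixl 6 _⊕_; _*_ to infixl 7 _⊗_; -_ to ⊝_)
  private module R = CommutativeRing R
  open _-Raw-AlmostCommutative⟶_ morphism
  open Relation.Binary.Reasoning.Setoid R.setoid

  open Algebra.Solver.Ring ℤ.+-*-rawRing (fromCommutativeRing R) morphism
    (λ a b → Maybe.map (λ eq → R.reflexive (≡.cong ⟦_⟧ eq)) (dec⇒maybe (a ℤ.≟ b)))
    using (solve; _:=_; _:+_; _:*_; _:-_; :-_; con)

  infixl 6 _⊖_
  _⊖_ : Carrier → ℤ → Carrier
  x ⊖ ν = x ⊕ ⊝ ⟦ ν ⟧

  split : List ℤ → Carrier → Carrier
  split []       x = ⟦ + 1 ⟧
  split (ν ∷ νs) x = (x ⊖ ν) ⊗ split νs x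

  Splits : Carrier → Set
  Splits x = ∃[ νs ] split νs x ≈ 0#

  split-cong : ∀ νs {x y} → x ≈ y → split νs x ≈ split νs y
  split-cong [] eq = R.refl
  split-cong (ν ∷ νs) eq = R.*-cong (R.+-congʳ eq) (split-cong νs eq)

  splits-cong : ∀ {x y} → x ≈ y → Splits x → Splits y
  splits-cong eq (νs , e) = νs , R.trans (split-cong νs (R.sym eq)) e

  split-++ : ∀ νs μs x → split (νs ++ μs) x ≈ split νs x ⊗ split μs x
  split-++ [] μs x = R.sym (R.trans (R.*-congʳ 1-homo) (R.*-identityˡ _))
  split-++ (ν ∷ νs) μs x = R.trans (R.*-congˡ (split-++ νs μs x)) (R.sym (R.*-assoc _ _ _))


  split-shift : ∀ x y l μs → ∃[ r ] split (List.map (λ μ → l ℤ.+ μ) μs) (x ⊕ y) ≈ split μs y ⊕ (x ⊖ l) ⊗ r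
  split-shift x y l [] = ⟦ + 0 ⟧ , solve 2 (λ x l → con (+ 1) := con (+ 1) :+ (x :- l) :* con (+ 0)) R.refl x ⟦ l ⟧
  split-shift x y l (μ ∷ μs) with split-shift x y l μs
  ... | r , eq = _ , (begin
    ((x ⊕ y) ⊖ (l ℤ.+ μ)) ⊗ split (List.map (λ μ → l ℤ.+ μ) μs) (x ⊕ y)
      ≈⟨ R.*-cong (R.+-congˡ (R.-‿cong (+-homo l μ))) eq ⟩
    ((x ⊕ y) ⊕ ⊝ (⟦ l ⟧ ⊕ ⟦ μ ⟧)) ⊗ (split μs y ⊕ (x ⊖ l) ⊗ r)
      ≈⟨ solve 6 (λ x y l μ s r → ((x :+ y) :- (l :+ μ)) :* (s :+ (x :- l) :* r) :=
           (y :- μ) :* s :+ (x :- l) :* (s :+ ((y :- μ) :+ (x :- l)) :* r)) R.refl x y ⟦ l ⟧ ⟦ μ ⟧ (split μs y) r ⟩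
    (y ⊖ μ) ⊗ split μs y ⊕ (x ⊖ l) ⊗ (split μs y ⊕ ((y ⊖ μ) ⊕ (x ⊖ l)) ⊗ r) ∎)

  -- Modulo x - l the product ∏ (x + y - l - μ) over μ is ∏ (y - μ), which vanishes.
  splits-⊕ : ∀ {x y} → Splits x → Splits y → Splits (x ⊕ y)
  splits-⊕ {x} {y} (ls , ex) (μs , ey) = sums ls , R.trans (proj₂ (go ls)) (R.trans (R.*-congʳ ex) (R.zeroˡ _))
    where
    sums : List ℤ → List ℤ
    sums [] = []
    sums (l ∷ ls) = List.map (λ μ → l ℤ.+ μ) μs ++ sums ls
    go : ∀ ls → ∃[ r ] split (sums ls) (x ⊕ y) ≈ split ls x ⊗ r
    go [] = 1# , R.sym (R.*-identityʳ _)
    go (l ∷ ls) with split-shift x y l μs | go ls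
    ... | r , eq | r′ , eq′ = r ⊗ r′ , (begin
      split (List.map (λ μ → l ℤ.+ μ) μs ++ sums ls) (x ⊕ y) ≈⟨ split-++ (List.map (λ μ → l ℤ.+ μ) μs) (sums ls) (x ⊕ y) ⟩
      split (List.map (λ μ → l ℤ.+ μ) μs) (x ⊕ y) ⊗ split (sums ls) (x ⊕ y) ≈⟨ R.*-cong eq eq′ ⟩
      (split μs y ⊕ (x ⊖ l) ⊗ r) ⊗ (split ls x ⊗ r′) ≈⟨ R.*-congʳ (R.trans (R.+-congʳ ey) (R.+-identityˡ _)) ⟩
      ((x ⊖ l) ⊗ r) ⊗ (split ls x ⊗ r′)
        ≈⟨ solve 4 (λ a r s t → (a :* r) :* (s :* t) := (a :* s) :* (r :* t)) R.refl (x ⊖ l) r (split ls x) r′ ⟩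
      ((x ⊖ l) ⊗ split ls x) ⊗ (r ⊗ r′) ∎)

  splits-scale : ∀ c {x} → Splits x → Splits (⟦ c ⟧ ⊗ x)
  splits-scale c {x} (νs , ex) = List.map (λ ν → c ℤ.* ν) νs , R.trans (proj₂ (go νs)) (R.trans (R.*-congʳ ex) (R.zeroˡ _))
    where
    go : ∀ νs → ∃[ r ] split (List.map (λ ν → c ℤ.* ν) νs) (⟦ c ⟧ ⊗ x) ≈ split νs x ⊗ r
    go [] = 1# , R.sym (R.*-identityʳ _)
    go (ν ∷ νs) with go νs
    ... | r , eq = _ , (begin
      (⟦ c ⟧ ⊗ x ⊖ (c ℤ.* ν)) ⊗ split (List.map (λ ν → c ℤ.* ν) νs) (⟦ c ⟧ ⊗ x) ≈⟨ R.*-cong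
          (R.+-congˡ (R.-‿cong (*-homo c ν))) eq ⟩
      (⟦ c ⟧ ⊗ x ⊕ ⊝ (⟦ c ⟧ ⊗ ⟦ ν ⟧)) ⊗ (split νs x ⊗ r)
        ≈⟨ solve 5 (λ c x ν s r → (c :* x :- c :* ν) :* (s :* r) := ((x :- ν) :* s) :* (c :* r)) R.refl ⟦ c ⟧ x ⟦ ν ⟧
            (split νs x) r ⟩
      ((x ⊖ ν) ⊗ split νs x) ⊗ (⟦ c ⟧ ⊗ r) ∎)

  -- From x² - ν² = (x - ν)(x + ν). The list of roots is explicit because `square-eigenvalue` must
  -- know that every root for the square of an element is itself a square.
  split-square : ∀ νs {x} → split νs x ≈ 0# → split (List.map (λ ν → ν ℤ.* ν) νs) (x ⊗ x) ≈ 0#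
  split-square νs {x} ex = R.trans (proj₂ (go νs)) (R.trans (R.*-congʳ ex) (R.zeroˡ _))
    where
    go : ∀ νs → ∃[ r ] split (List.map (λ ν → ν ℤ.* ν) νs) (x ⊗ x) ≈ split νs x ⊗ r
    go [] = 1# , R.sym (R.*-identityʳ _)
    go (ν ∷ νs) with go νs
    ... | r , eq = _ , (begin
      (x ⊗ x ⊖ (ν ℤ.* ν)) ⊗ split (List.map (λ ν → ν ℤ.* ν) νs) (x ⊗ x) ≈⟨ R.*-cong (R.+-congˡ (R.-‿cong (*-homo ν ν))) eq ⟩
      (x ⊗ x ⊕ ⊝ (⟦ ν ⟧ ⊗ ⟦ ν ⟧)) ⊗ (split νs x ⊗ r)
        ≈⟨ solve 4 (λ x ν s r → (x :* x :- ν :* ν) :* (s :* r) := ((x :- ν) :* s) :* ((x :+ ν) :* r)) R.refl x ⟦ ν ⟧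
            (split νs x) r ⟩
      ((x ⊖ ν) ⊗ split νs x) ⊗ ((x ⊕ ⟦ ν ⟧) ⊗ r) ∎)

  -- The roots ν and -ν are both offered to y: (y - ν)(y + ν) = y² - ν² = x² - ν², a multiple of x -
  -- ν.
  splits-sqrt : ∀ {x y} → y ⊗ y ≈ x ⊗ x → Splits x → Splits y
  splits-sqrt {x} {y} y²≈x² (νs , ex) = signed νs , R.trans (proj₂ (go νs)) (R.trans (R.*-congʳ ex) (R.zeroˡ _))
    where
    signed : List ℤ → List ℤ
    signed [] = []
    signed (ν ∷ νs) = ν ∷ - ν ∷ signed νs
    go : ∀ νs → ∃[ r ] split (signed νs) y ≈ split νs x ⊗ r
    go [] = 1# , R.sym (R.*-identityʳ _)
    go (ν ∷ νs) with go νs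
    ... | r , eq = _ , (begin
      (y ⊖ ν) ⊗ ((y ⊖ (- ν)) ⊗ split (signed νs) y) ≈⟨ R.*-congˡ (R.*-cong (R.+-congˡ (R.-‿cong (-‿homo ν))) eq) ⟩
      (y ⊖ ν) ⊗ ((y ⊕ ⊝ (⊝ ⟦ ν ⟧)) ⊗ (split νs x ⊗ r))
        ≈⟨ solve 4 (λ y ν s r → (y :- ν) :* ((y :+ :- (:- ν)) :* (s :* r)) := (y :* y :- ν :* ν) :* (s :* r)) R.refl y ⟦ ν
            ⟧ (split νs x) r ⟩
      (y ⊗ y ⊕ ⊝ (⟦ ν ⟧ ⊗ ⟦ ν ⟧)) ⊗ (split νs x ⊗ r) ≈⟨ R.*-congʳ (R.+-congʳ y²≈x²) ⟩
      (x ⊗ x ⊕ ⊝ (⟦ ν ⟧ ⊗ ⟦ ν ⟧)) ⊗ (split νs x ⊗ r)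
        ≈⟨ solve 4 (λ x ν s r → (x :* x :- ν :* ν) :* (s :* r) := ((x :- ν) :* s) :* ((x :+ ν) :* r)) R.refl x ⟦ ν ⟧
            (split νs x) r ⟩
      ((x ⊖ ν) ⊗ split νs x) ⊗ ((x ⊕ ⟦ ν ⟧) ⊗ r) ∎)

  module Exp = Algebra.Properties.CommutativeSemiring.Exp R.commutativeSemiring
  module Sum = Algebra.Properties.Semiring.Sum R.semiring
  open Exp using (_^_)

  sum-zero : ∀ {n} (f : Fin n → Carrier) → (∀ i → f i ≈ 0#) → Sum.sum f ≈ 0#
  sum-zero {zero} f eq = R.refl
  sum-zero {suc n} f eq = R.trans (R.+-cong (eq zero) (sum-zero (f ∘ suc) (eq ∘ suc))) (R.+-identityˡ 0#)

  module Frobenius (p : ℕ) (pp : Prime p) (char : ⟦ + p ⟧ ≈ 0#) where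

    private
      module Mult = Algebra.Properties.Semiring.Mult R.semiring
      module Binomial = Algebra.Properties.CommutativeSemiring.Binomial R.commutativeSemiring
      module G = Algebra.Properties.Group R.+-group
      q : ℕ
      q = ℕ.pred p
      p≡1+q : p ≡ suc q
      p≡1+q = ≡.sym (ℕ.suc-pred p {{prime⇒nonZero pp}})

    multiple : ∀ m x → m Mult.× x ≈ ⟦ + m ⟧ ⊗ x
    multiple zero x = R.sym (R.trans (R.*-congʳ 0-homo) (R.zeroˡ x))
    multiple (suc m) x = begin
      x ⊕ m Mult.× x ≈⟨ R.+-congˡ (multiple m x) ⟩
      x ⊕ ⟦ + m ⟧ ⊗ x ≈⟨ solve 2 (λ x m → x :+ m :* x := (con (+ 1) :+ m) :* x) R.refl x ⟦ + m ⟧ ⟩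
      (⟦ + 1 ⟧ ⊕ ⟦ + m ⟧) ⊗ x ≈⟨ R.*-congʳ (+-homo (+ 1) (+ m)) ⟨
      ⟦ + suc m ⟧ ⊗ x ∎

    multiple-of-p : ∀ {m} x → p ∣ m → m Mult.× x ≈ 0#
    multiple-of-p x (divides c ≡.refl) = begin
      (c * p) Mult.× x ≈⟨ multiple (c * p) x ⟩
      ⟦ + (c * p) ⟧ ⊗ x ≈⟨ R.*-congʳ (R.trans (R.reflexive (≡.cong ⟦_⟧ (ℤ.pos-* c p))) (*-homo (+ c) (+ p))) ⟩
      (⟦ + c ⟧ ⊗ ⟦ + p ⟧) ⊗ x ≈⟨ R.*-congʳ (R.trans (R.*-congˡ char) (R.zeroʳ _)) ⟩
      0# ⊗ x ≈⟨ R.zeroˡ x ⟩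
      0# ∎

    freshman : ∀ x y → (x ⊕ y) ^ p ≈ x ^ p ⊕ y ^ p
    -- `p` is replaced by `suc q` so that the binomial sum visibly has a first and a last term;
    -- every term between them carries a multiple of p.
    freshman x y = ≡.subst (λ p → Prime p → (∀ {m} z → p ∣ m → m Mult.× z ≈ 0#) → (x ⊕ y) ^ p ≈ x ^ p ⊕ y ^ p)
      (≡.sym p≡1+q) expand pp multiple-of-p
      where
      expand : Prime (suc q) → (∀ {m} z → suc q ∣ m → m Mult.× z ≈ 0#) → (x ⊕ y) ^ suc q ≈ x ^ suc q ⊕ y ^ suc q
      expand pp kill = begin
        (x ⊕ y) ^ suc q ≈⟨ Binomial.theorem (suc q) x y ⟩
        Sum.sum T ≈⟨ R.+-cong first (Sum.sum-init-last (T ∘ suc)) ⟩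
        y ^ suc q ⊕ (Sum.sum (λ i → T (suc (inject₁ i))) ⊕ T (suc (fromℕ q)))
          ≈⟨ R.+-congˡ (R.+-cong (sum-zero _ middle) last) ⟩
        y ^ suc q ⊕ (0# ⊕ x ^ suc q) ≈⟨ R.trans (R.+-congˡ (R.+-identityˡ _)) (R.+-comm _ _) ⟩
        x ^ suc q ⊕ y ^ suc q ∎
        where
        T : Fin (suc (suc q)) → Carrier
        T = Binomial.binomialTerm x y (suc q)
        first : T zero ≈ y ^ suc q
        first = R.trans (R.+-identityʳ _) (R.*-identityˡ _)
        middle : ∀ i → T (suc (inject₁ i)) ≈ 0#
        middle i = kill _ (prime∣binomial pp _ (s≤s z≤n) (s≤s (≡.subst (ℕ._< q) (≡.sym (Fin.toℕ-inject₁ i)) (Fin.toℕ<n i))))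
        last : T (suc (fromℕ q)) ≈ x ^ suc q
        last = begin
          T (suc (fromℕ q)) ≡⟨ ≡.cong (λ k → (suc q choose suc k) Mult.× (x ^ suc k ⊗ y ^ (q ∸ k))) (Fin.toℕ-fromℕ q) ⟩
          (suc q choose suc q) Mult.× (x ^ suc q ⊗ y ^ (q ∸ q)) ≡⟨ ≡.cong₂ (λ c k → c Mult.× (x ^ suc q ⊗ y ^ k))
              (nCn≡1 (suc q)) (ℕ.n∸n≡0 q) ⟩
          1 Mult.× (x ^ suc q ⊗ 1#) ≈⟨ R.+-identityʳ _ ⟩
          x ^ suc q ⊗ 1# ≈⟨ R.*-identityʳ _ ⟩
          x ^ suc q ∎

    0^ : ∀ n → .{{NonZero n}} → 0# ^ n ≈ 0#
    0^ (suc n) = R.zeroˡ _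

    0^p : 0# ^ p ≈ 0#
    0^p = 0^ p {{prime⇒nonZero pp}}

    ^p-⊝ : ∀ x → (⊝ x) ^ p ≈ ⊝ (x ^ p)
    ^p-⊝ x = G.inverseˡ-unique _ _ (begin
      (⊝ x) ^ p ⊕ x ^ p ≈⟨ freshman (⊝ x) x ⟨
      (⊝ x ⊕ x) ^ p ≈⟨ Exp.^-congˡ p (R.-‿inverseˡ x) ⟩
      0# ^ p ≈⟨ 0^p ⟩
      0# ∎)

    1^ : ∀ n → 1# ^ n ≈ 1#
    1^ zero = R.refl
    1^ (suc n) = R.trans (R.*-identityˡ _) (1^ n)

    fermat-ℕ : ∀ n → ⟦ + n ⟧ ^ p ≈ ⟦ + n ⟧
    fermat-ℕ zero = R.trans (Exp.^-congˡ p 0-homo) (R.trans 0^p (R.sym 0-homo))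
    fermat-ℕ (suc n) = begin
      ⟦ + suc n ⟧ ^ p ≈⟨ Exp.^-congˡ p (+-homo (+ 1) (+ n)) ⟩
      (⟦ + 1 ⟧ ⊕ ⟦ + n ⟧) ^ p ≈⟨ freshman _ _ ⟩
      ⟦ + 1 ⟧ ^ p ⊕ ⟦ + n ⟧ ^ p ≈⟨ R.+-cong (R.trans (Exp.^-congˡ p 1-homo) (R.trans (1^ p) (R.sym 1-homo))) (fermat-ℕ n) ⟩
      ⟦ + 1 ⟧ ⊕ ⟦ + n ⟧ ≈⟨ +-homo (+ 1) (+ n) ⟨
      ⟦ + suc n ⟧ ∎

    fermat : ∀ ν → ⟦ ν ⟧ ^ p ≈ ⟦ ν ⟧
    fermat (+ n) = fermat-ℕ n
    fermat -[1+ n ] = begin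
      ⟦ -[1+ n ] ⟧ ^ p ≈⟨ Exp.^-congˡ p (-‿homo (+ suc n)) ⟩
      (⊝ ⟦ + suc n ⟧) ^ p ≈⟨ ^p-⊝ _ ⟩
      ⊝ (⟦ + suc n ⟧ ^ p) ≈⟨ R.-‿cong (fermat-ℕ (suc n)) ⟩
      ⊝ ⟦ + suc n ⟧ ≈⟨ -‿homo (+ suc n) ⟨
      ⟦ -[1+ n ] ⟧ ∎

    frob : ℕ → Carrier → Carrier
    frob k x = x ^ (p ℕ.^ k)

    frob-suc : ∀ k x → frob (suc k) x ≈ frob k (x ^ p)
    frob-suc k x = R.sym (Exp.^-assocʳ x p (p ℕ.^ k))

    frob-cong : ∀ k {x y} → x ≈ y → frob k x ≈ frob k y
    frob-cong k = Exp.^-congˡ (p ℕ.^ k)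

    frob-⊕ : ∀ k x y → frob k (x ⊕ y) ≈ frob k x ⊕ frob k y
    frob-⊕ zero x y = R.trans (R.*-identityʳ _) (R.sym (R.+-cong (R.*-identityʳ x) (R.*-identityʳ y)))
    frob-⊕ (suc k) x y = begin
      frob (suc k) (x ⊕ y) ≈⟨ frob-suc k (x ⊕ y) ⟩
      frob k ((x ⊕ y) ^ p) ≈⟨ frob-cong k (freshman x y) ⟩
      frob k (x ^ p ⊕ y ^ p) ≈⟨ frob-⊕ k (x ^ p) (y ^ p) ⟩
      frob k (x ^ p) ⊕ frob k (y ^ p) ≈⟨ R.+-cong (frob-suc k x) (frob-suc k y) ⟨
      frob (suc k) x ⊕ frob (suc k) y ∎

    frob-0 : ∀ k → frob k 0# ≈ 0#
    frob-0 k = 0^ (p ℕ.^ k) {{ℕ.m^n≢0 p k {{prime⇒nonZero pp}}}}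

    frob-⊝ : ∀ k x → frob k (⊝ x) ≈ ⊝ frob k x
    frob-⊝ k x = G.inverseˡ-unique _ _
      (R.trans (R.sym (frob-⊕ k (⊝ x) x)) (R.trans (frob-cong k (R.-‿inverseˡ x)) (frob-0 k)))

    frob-⟦⟧ : ∀ k ν → frob k ⟦ ν ⟧ ≈ ⟦ ν ⟧
    frob-⟦⟧ zero ν = R.*-identityʳ _
    frob-⟦⟧ (suc k) ν = R.trans (frob-suc k _) (R.trans (frob-cong k (fermat ν)) (frob-⟦⟧ k ν))

    frob-sum : ∀ k {n} (f : Fin n → Carrier) → frob k (Sum.sum f) ≈ Sum.sum (λ i → frob k (f i))
    frob-sum k {zero} f = frob-0 k
    frob-sum k {suc n} f = R.trans (frob-⊕ k _ _) (R.+-congˡ (frob-sum k (f ∘ suc)))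

    -- Every x - ν divides x ^ p - x, so x ^ p - x is nilpotent and some power of the Frobenius map kills it.
    frob-stabilises : ∀ {x} → Splits x → ∃[ k ] frob (suc k) x ≈ frob k x
    frob-stabilises {x} (νs , ex) = length νs , G.x∙y⁻¹≈ε⇒x≈y _ _ (begin
      frob (suc L) x ⊕ ⊝ frob L x ≈⟨ R.+-cong (frob-suc L x) (R.sym (frob-⊝ L x)) ⟩
      frob L (x ^ p) ⊕ frob L (⊝ x) ≈⟨ frob-⊕ L (x ^ p) (⊝ x) ⟨
      d ^ (p ℕ.^ L) ≡⟨ ≡.cong (d ^_) (ℕ.m+[n∸m]≡n L≤) ⟨
      d ^ (L + (p ℕ.^ L ∸ L)) ≈⟨ Exp.^-homo-* d L _ ⟩
      d ^ L ⊗ d ^ (p ℕ.^ L ∸ L) ≈⟨ R.*-congʳ (R.trans (proj₂ (power νs)) (R.trans (R.*-congʳ ex) (R.zeroˡ _))) ⟩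
      0# ⊗ d ^ (p ℕ.^ L ∸ L) ≈⟨ R.zeroˡ _ ⟩
      0# ∎)
      where
      L = length νs
      d = x ^ p ⊕ ⊝ x
      L≤ : L ≤ p ℕ.^ L
      L≤ = ℕ.<⇒≤ (n<p^n L)
        where
        n<p^n : ∀ n → n < p ℕ.^ n
        n<p^n zero = s≤s z≤n
        n<p^n (suc n) = ℕ.≤-trans (ℕ.+-mono-≤ (ℕ.≤-trans (s≤s z≤n) (n<p^n n)) (n<p^n n))
          (ℕ.≤-trans (ℕ.≤-reflexive (≡.cong (λ z → p ℕ.^ n + z) (≡.sym (ℕ.+-identityʳ _))))
            (ℕ.*-monoˡ-≤ (p ℕ.^ n) (ℕ.nonTrivial⇒n>1 p {{prime⇒nonTrivial pp}})))
      factor : ∀ ν → ∃[ r ] d ≈ (x ⊖ ν) ⊗ r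
      factor ν = _ , (begin
        x ^ p ⊕ ⊝ x ≈⟨ solve 3 (λ a x ν → a :- x := (a :- ν) :- (x :- ν)) R.refl (x ^ p) x ⟦ ν ⟧ ⟩
        (x ^ p ⊖ ν) ⊕ ⊝ (x ⊖ ν) ≈⟨ R.+-congʳ (R.+-congˡ (R.trans (^p-⊝ _) (R.-‿cong (fermat ν)))) ⟨
        (x ^ p ⊕ (⊝ ⟦ ν ⟧) ^ p) ⊕ ⊝ (x ⊖ ν) ≈⟨ R.+-congʳ (freshman x _) ⟨
        (x ⊖ ν) ^ p ⊕ ⊝ (x ⊖ ν) ≡⟨ ≡.cong (λ k → (x ⊖ ν) ^ k ⊕ ⊝ (x ⊖ ν)) p≡1+q ⟩
        (x ⊖ ν) ⊗ (x ⊖ ν) ^ q ⊕ ⊝ (x ⊖ ν) ≈⟨ solve 2 (λ y z → y :* z :- y := y :* (z :- con (+ 1))) R.refl (x ⊖ ν)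
            ((x ⊖ ν) ^ q) ⟩
        (x ⊖ ν) ⊗ ((x ⊖ ν) ^ q ⊖ (+ 1)) ∎)
      power : ∀ νs → ∃[ r ] d ^ length νs ≈ split νs x ⊗ r
      power [] = 1# , R.sym (R.trans (R.*-identityʳ _) 1-homo)
      power (ν ∷ νs) = proj₁ (factor ν) ⊗ proj₁ (power νs) , R.trans (R.*-cong (proj₂ (factor ν)) (proj₂ (power νs)))
        (solve 4 (λ a r s t → (a :* r) :* (s :* t) := (a :* s) :* (r :* t)) R.refl (x ⊖ ν) (proj₁ (factor ν)) (split νs x)
            (proj₁ (power νs)))

-- Rings of commuting linear operators

module _ {I : Set} {P : Op I} (lin : Linear P) where
  open Linear lin

  linear-0 : ∀ i → P (λ _ → + 0) i ≡ + 0
  linear-0 i = lem (P (λ _ → + 0) i) (linear (+ 1) (λ _ → + 0) (λ _ → + 0) i)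
    where
    lem : ∀ x → x ≡ x ℤ.+ + 1 ℤ.* x → x ≡ + 0
    lem x eq = trans (e₁ x) (trans (cong (λ z → z ℤ.- x) (sym eq)) (ℤ.+-inverseʳ x))
      where
      e₁ : ∀ x → x ≡ (x ℤ.+ + 1 ℤ.* x) ℤ.- x
      e₁ = solve-∀

  linear-scale : ∀ a φ i → P (λ i → a ℤ.* φ i) i ≡ a ℤ.* P φ i
  linear-scale a φ i = trans (ext (λ j → sym (ℤ.+-identityˡ (a ℤ.* φ j))) i)
    (trans (linear a (λ _ → + 0) φ i) (trans (cong (λ z → z ℤ.+ a ℤ.* P φ i) (linear-0 i)) (ℤ.+-identityˡ _)))

  linear-+ : ∀ φ ψ i → P (λ i → φ i ℤ.+ ψ i) i ≡ P φ i ℤ.+ P ψ i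
  linear-+ φ ψ i = trans (ext (λ j → cong (λ z → φ j ℤ.+ z) (sym (ℤ.*-identityˡ (ψ j)))) i)
    (trans (linear (+ 1) φ ψ i) (cong (λ z → P φ i ℤ.+ z) (ℤ.*-identityˡ _)))

  linear-neg : ∀ φ i → P (λ i → - φ i) i ≡ - P φ i
  linear-neg φ i = trans (ext (λ j → sym (ℤ.-1*i≡-i (φ j))) i) (trans (linear-scale ℤ.-1ℤ φ i) (ℤ.-1*i≡-i _))

-- Polynomial expressions in commuting operators, identified when they act in the same way modulo N
-- (N = 0 gives operator equality, N = p a ring of characteristic p).
module OperatorRing {I G : Set} (op : G → Op I) (op-linear : ∀ g → Linear (op g))
  (op-comm : ∀ g h φ i → op g (op h φ) i ≡ op h (op g φ) i) (N : ℤ) where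

  infixl 6 _⊹_
  infixl 7 _⊛_

  data Expr : Set where
    gen : G → Expr
    con : ℤ → Expr
    _⊹_ _⊛_ : Expr → Expr → Expr
    neg : Expr → Expr

  act : Expr → Op I
  act (gen g) φ = op g φ
  act (con c) φ i = c ℤ.* φ i
  act (e ⊹ f) φ i = act e φ i ℤ.+ act f φ i
  act (e ⊛ f) φ = act e (act f φ)
  act (neg e) φ i = - act e φ i

  act-linear : ∀ e → Linear (act e)
  act-linear (gen g) = op-linear g
  act-linear (con c) = record { ext = λ eq i → cong (c ℤ.*_) (eq i) ; linear = λ a φ ψ i → lem c (φ i) a (ψ i) }
    where
    lem : ∀ c u a v → c ℤ.* (u ℤ.+ a ℤ.* v) ≡ c ℤ.* u ℤ.+ a ℤ.* (c ℤ.* v)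
    lem = solve-∀
  act-linear (e ⊹ f) = record
    { ext = λ eq i → cong₂ ℤ._+_ (E.ext eq i) (F.ext eq i)
    ; linear = λ a φ ψ i → trans (cong₂ ℤ._+_ (E.linear a φ ψ i) (F.linear a φ ψ i))
        (lem (act e φ i) (act f φ i) a (act e ψ i) (act f ψ i))
    }
    where
    module E = Linear (act-linear e)
    module F = Linear (act-linear f)
    lem : ∀ u v a w x → u ℤ.+ a ℤ.* w ℤ.+ (v ℤ.+ a ℤ.* x) ≡ u ℤ.+ v ℤ.+ a ℤ.* (w ℤ.+ x)
    lem = solve-∀
  act-linear (e ⊛ f) = record
    { ext = λ eq i → E.ext (F.ext eq) i
    ; linear = λ a φ ψ i → trans (E.ext (F.linear a φ ψ) i) (E.linear a (act f φ) (act f ψ) i)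
    }
    where
    module E = Linear (act-linear e)
    module F = Linear (act-linear f)
  act-linear (neg e) = record
    { ext = λ eq i → cong -_ (ext eq i)
    ; linear = λ a φ ψ i → trans (cong -_ (linear a φ ψ i)) (lem (act e φ i) a (act e ψ i))
    }
    where
    open Linear (act-linear e)
    lem : ∀ u a v → - (u ℤ.+ a ℤ.* v) ≡ - u ℤ.+ a ℤ.* - v
    lem = solve-∀

  act-ext : ∀ e {φ ψ} → (∀ i → φ i ≡ ψ i) → ∀ i → act e φ i ≡ act e ψ i
  act-ext e = Linear.ext (act-linear e)

  -- Induction on `e`, and on `f` once `e` is a generator; constants commute with everything by
  -- linearity.
  act-comm : ∀ e f φ i → act e (act f φ) i ≡ act f (act e φ) i
  act-comm (gen g) (gen h) φ i = op-comm g h φ i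
  act-comm (con c) f φ i = sym (linear-scale (act-linear f) c φ i)
  act-comm (e ⊹ e′) f φ i = trans (cong₂ ℤ._+_ (act-comm e f φ i) (act-comm e′ f φ i))
      (sym (linear-+ (act-linear f) (act e φ) (act e′ φ) i))
  act-comm (e ⊛ e′) f φ i = trans (act-ext e (act-comm e′ f φ) i) (act-comm e f (act e′ φ) i)
  act-comm (neg e) f φ i = trans (cong -_ (act-comm e f φ i)) (sym (linear-neg (act-linear f) (act e φ) i))
  act-comm e@(gen _) (con c) φ i = linear-scale (act-linear e) c φ i
  act-comm e@(gen _) (f ⊹ f′) φ i = trans (linear-+ (act-linear e) (act f φ) (act f′ φ) i)
      (cong₂ ℤ._+_ (act-comm e f φ i) (act-comm e f′ φ i))
  act-comm e@(gen _) (f ⊛ f′) φ i = trans (act-comm e f (act f′ φ) i) (act-ext f (act-comm e f′ φ) i)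
  act-comm e@(gen _) (neg f) φ i = trans (linear-neg (act-linear e) (act f φ) i) (cong -_ (act-comm e f φ i))

  infix 4 _≈_
  -- The error χ may depend on φ in any way: linearity of the actions is what carries the multiple
  -- of N through a product.
  record _≈_ (e f : Expr) : Set where
    constructor congruent
    field differ : ∀ φ → Σ[ χ ∈ (I → ℤ) ] ∀ i → act e φ i ≡ act f φ i ℤ.+ N ℤ.* χ i
  open _≈_ public

  exact : ∀ {e f} → (∀ φ i → act e φ i ≡ act f φ i) → e ≈ f
  exact {e} {f} eq = congruent λ φ → (λ _ → + 0) , λ i →
      trans (eq φ i) (sym (trans (cong (λ z → act f φ i ℤ.+ z) (ℤ.*-zeroʳ N)) (ℤ.+-identityʳ _)))

  ≈-sym : ∀ {e f} → e ≈ f → f ≈ e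
  ≈-sym {e} {f} eq = congruent λ φ → let χ , d = differ eq φ in (λ i → - χ i) , λ i →
    trans (lem (act f φ i) N (χ i)) (cong (λ z → z ℤ.+ N ℤ.* - χ i) (sym (d i)))
    where
    lem : ∀ u n x → u ≡ u ℤ.+ n ℤ.* x ℤ.+ n ℤ.* - x
    lem = solve-∀

  ≈-trans : ∀ {e f g} → e ≈ f → f ≈ g → e ≈ g
  ≈-trans {e} {f} {g} p q = congruent λ φ → let χ , d = differ p φ ; χ′ , d′ = differ q φ in (λ i → χ′ i ℤ.+ χ i) , λ i →
    trans (d i) (trans (cong (λ z → z ℤ.+ N ℤ.* χ i) (d′ i)) (lem (act g φ i) N (χ′ i) (χ i)))
    where
    lem : ∀ u n x y → u ℤ.+ n ℤ.* x ℤ.+ n ℤ.* y ≡ u ℤ.+ n ℤ.* (x ℤ.+ y)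
    lem = solve-∀

  ⊹-cong : ∀ {e e′ f f′} → e ≈ e′ → f ≈ f′ → e ⊹ f ≈ e′ ⊹ f′
  ⊹-cong {e} {e′} {f} {f′} p q = congruent λ φ → let χ , d = differ p φ ; χ′ , d′ = differ q φ in (λ i → χ i ℤ.+ χ′ i) , λ i →
    trans (cong₂ ℤ._+_ (d i) (d′ i)) (lem (act e′ φ i) (act f′ φ i) N (χ i) (χ′ i))
    where
    lem : ∀ u v n x y → u ℤ.+ n ℤ.* x ℤ.+ (v ℤ.+ n ℤ.* y) ≡ u ℤ.+ v ℤ.+ n ℤ.* (x ℤ.+ y)
    lem = solve-∀

  ⊛-cong : ∀ {e e′ f f′} → e ≈ e′ → f ≈ f′ → e ⊛ f ≈ e′ ⊛ f′
  ⊛-cong {e} {e′} {f} {f′} p q = congruent λ φ → let χ , d = differ q φ ; χ′ , d′ = differ p (act f′ φ) in (λ i → χ′ i ℤ.+ act e χ i) , λ i →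
    trans (act-ext e d i) (trans (Linear.linear (act-linear e) N (act f′ φ) χ i)
      (trans (cong (λ z → z ℤ.+ N ℤ.* act e χ i) (d′ i)) (lem (act e′ (act f′ φ) i) N (χ′ i) (act e χ i))))
    where
    lem : ∀ u n x y → u ℤ.+ n ℤ.* x ℤ.+ n ℤ.* y ≡ u ℤ.+ n ℤ.* (x ℤ.+ y)
    lem = solve-∀

  neg-cong : ∀ {e e′} → e ≈ e′ → neg e ≈ neg e′
  neg-cong {e} {e′} p = congruent λ φ → let χ , d = differ p φ in (λ i → - χ i) , λ i →
    trans (cong -_ (d i)) (lem (act e′ φ i) N (χ i))
    where
    lem : ∀ u n x → - (u ℤ.+ n ℤ.* x) ≡ - u ℤ.+ n ℤ.* - x
    lem = solve-∀

  ring : CommutativeRing 0ℓ 0ℓ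
  ring = record
    { Carrier = Expr ; _≈_ = _≈_ ; _+_ = _⊹_ ; _*_ = _⊛_ ; -_ = neg ; 0# = con (+ 0) ; 1# = con (+ 1)
    ; isCommutativeRing = record
      { isRing = record
        { +-isAbelianGroup = record
          { isGroup = record
            { isMonoid = record
              { isSemigroup = record
                { isMagma = record
                  { isEquivalence = record { refl = exact (λ _ _ → refl) ; sym = ≈-sym ; trans = ≈-trans }
                  ; ∙-cong = ⊹-cong }
                ; assoc = λ e f g → exact λ φ i → ℤ.+-assoc (act e φ i) (act f φ i) (act g φ i) }
              ; identity = (λ e → exact λ φ i → ℤ.+-identityˡ _) , (λ e → exact λ φ i → ℤ.+-identityʳ _) }
            ; inverse = (λ e → exact λ φ i → ℤ.+-inverseˡ (act e φ i)) , (λ e → exact λ φ i → ℤ.+-inverseʳ (act e φ i))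
            ; ⁻¹-cong = neg-cong }
          ; comm = λ e f → exact λ φ i → ℤ.+-comm (act e φ i) (act f φ i) }
        ; *-cong = ⊛-cong
        ; *-assoc = λ e f g → exact λ φ i → refl
        ; *-identity = (λ e → exact λ φ i → ℤ.*-identityˡ _) ,
            (λ e → exact λ φ i → act-ext e (λ j → ℤ.*-identityˡ (φ j)) i)
        ; distrib = (λ e f g → exact λ φ i → linear-+ (act-linear e) (act f φ) (act g φ) i) ,
            (λ e f g → exact λ φ i → refl) }
      ; *-comm = λ e f → exact λ φ i → act-comm e f φ i } }

  morphism : ℤ.+-*-rawRing -Raw-AlmostCommutative⟶ fromCommutativeRing ring
  morphism = record
    { ⟦_⟧ = con
    ; +-homo = λ a b → exact λ φ i → ℤ.*-distribʳ-+ (φ i) a b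
    ; *-homo = λ a b → exact λ φ i → ℤ.*-assoc a b (φ i)
    ; -‿homo = λ a → exact λ φ i → sym (ℤ.neg-distribˡ-* a (φ i))
    ; 0-homo = exact λ φ i → refl
    ; 1-homo = exact λ φ i → refl
    }

  open IntegerAlgebra ring morphism public

  act-split : ∀ νs e φ i → act (split νs e) φ i ≡ splitOp (act e) νs φ i
  act-split [] e φ i = ℤ.*-identityˡ (φ i)
  act-split (ν ∷ νs) e φ i = cong₂ (λ u v → u ℤ.- ν ℤ.* v) (act-ext e (act-split νs e φ) i) (act-split νs e φ i)

module ExactOperatorRing {I G : Set} (op : G → Op I) (op-linear : ∀ g → Linear (op g))
  (op-comm : ∀ g h φ i → op g (op h φ) i ≡ op h (op g φ) i) where

  open OperatorRing op op-linear op-comm (+ 0) public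

  ≈⇒≡ : ∀ {e f} → e ≈ f → ∀ φ i → act e φ i ≡ act f φ i
  ≈⇒≡ eq φ i = trans (proj₂ (differ eq φ) i) (ℤ.+-identityʳ _)

  splits⇒ : ∀ {e} → Splits e → Split (act e)
  splits⇒ {e} (νs , eq) = νs , λ φ i → trans (sym (act-split νs e φ i)) (≈⇒≡ eq φ i)

  splits⇐ : ∀ {e} → Split (act e) → Splits e
  splits⇐ {e} (νs , eq) = νs , exact λ φ i → trans (act-split νs e φ i) (eq φ i)

splitOp-cong : {I : Set} {P Q : Op I} → Linear Q → (∀ φ i → P φ i ≡ Q φ i) → ∀ νs φ i → splitOp P νs φ i ≡ splitOp Q νs φ i
splitOp-cong lin eq [] φ i = refl
splitOp-cong {P = P} lin eq (ν ∷ νs) φ i = cong₂ (λ u v → u ℤ.- ν ℤ.* v)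
  (trans (eq _ i) (Linear.ext lin (splitOp-cong lin eq νs φ) i)) (splitOp-cong lin eq νs φ i)

split-ext : {I : Set} {P Q : Op I} → Linear P → (∀ φ i → P φ i ≡ Q φ i) → Split P → Split Q
split-ext lin eq (νs , vanish) = νs , λ φ i → trans (splitOp-cong lin (λ φ i → sym (eq φ i)) νs φ i) (vanish φ i)

-- Right translations of functions on the dihedral group

sumF-bijection : ∀ {m} (f g : Fin m → Fin m) → (∀ i → f (g i) ≡ i) → (∀ i → g (f i) ≡ i) →
  (h : Fin m → ℤ) → sumF (h ∘ f) ≡ sumF h
sumF-bijection f g fg gf h = sym (trans (sumF≡sum h)
  (trans (ℤSum.sum-permute h (permutation f g fg gf)) (sym (sumF≡sum (h ∘ f)))))

sumF-++ : ∀ m {n} (f : Fin (m + n) → ℤ) → sumF f ≡ sumF (λ i → f (i ↑ˡ n)) ℤ.+ sumF (λ j → f (m ↑ʳ j))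
sumF-++ zero f = sym (ℤ.+-identityˡ (sumF f))
sumF-++ (suc m) f = trans (cong (λ z → f zero ℤ.+ z) (sumF-++ m (f ∘ suc))) (sym (ℤ.+-assoc (f zero) _ _))

module CyclicGroup (n : ℕ) .{{nz : NonZero n}} where

  open Dihedral n

  toℕ-mod : ∀ a → toℕ (a mod n) ≡ a % n
  toℕ-mod a = Fin.toℕ-fromℕ< (m%n<n a n)

  mod-cong : ∀ {a b} → a % n ≡ b % n → a mod n ≡ b mod n
  mod-cong {a} {b} eq = Fin.toℕ-injective (trans (toℕ-mod a) (trans eq (sym (toℕ-mod b))))

  mod-injective : ∀ {a b} → a mod n ≡ b mod n → a % n ≡ b % n
  mod-injective {a} {b} eq = trans (sym (toℕ-mod a)) (trans (cong toℕ eq) (toℕ-mod b))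

  mod-toℕ : ∀ k → toℕ k mod n ≡ k
  mod-toℕ k = Fin.toℕ-injective (trans (toℕ-mod (toℕ k)) (m<n⇒m%n≡m (Fin.toℕ<n k)))

  mod-⊕ : ∀ a b → (a mod n) ⊕ (b mod n) ≡ (a + b) mod n
  mod-⊕ a b = mod-cong (trans (cong₂ (λ x y → (x + y) % n) (toℕ-mod a) (toℕ-mod b)) (sym (%-distribˡ-+ a b n)))

  mod-⊕ˡ : ∀ a k → (a mod n) ⊕ k ≡ (a + toℕ k) mod n
  mod-⊕ˡ a k = trans (cong ((a mod n) ⊕_) (sym (mod-toℕ k))) (mod-⊕ a (toℕ k))

  mod-⊕ʳ : ∀ k a → k ⊕ (a mod n) ≡ (toℕ k + a) mod n
  mod-⊕ʳ k a = trans (cong (_⊕ (a mod n)) (sym (mod-toℕ k))) (mod-⊕ (toℕ k) a)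

  ⊕-assoc : ∀ k l m → (k ⊕ l) ⊕ m ≡ k ⊕ (l ⊕ m)
  ⊕-assoc k l m = trans (mod-⊕ˡ _ m) (trans (cong (_mod n) (ℕ.+-assoc (toℕ k) (toℕ l) (toℕ m))) (sym (mod-⊕ʳ k _)))

  ⊕-comm : ∀ k l → k ⊕ l ≡ l ⊕ k
  ⊕-comm k l = cong (_mod n) (ℕ.+-comm (toℕ k) (toℕ l))

  ⊕-identityˡ : ∀ k → e ⊕ k ≡ k
  ⊕-identityˡ k = trans (mod-⊕ˡ 0 k) (mod-toℕ k)

  ⊕-inverseʳ : ∀ k → k ⊕ (⊖ k) ≡ e
  ⊕-inverseʳ k = trans (mod-⊕ʳ k (n ∸ toℕ k)) (mod-cong
      (trans (cong (_% n) (ℕ.m+[n∸m]≡n (ℕ.<⇒≤ (Fin.toℕ<n k)))) (trans (n%n≡0 n) (sym (m<n⇒m%n≡m (ℕ.>-nonZero⁻¹ n))))))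

  group : AbelianGroup 0ℓ 0ℓ
  group = record
    { Carrier = Fin n ; _≈_ = _≡_ ; _∙_ = _⊕_ ; ε = e ; _⁻¹ = ⊖_
    ; isAbelianGroup = record
      { isGroup = record
        { isMonoid = record
          { isSemigroup = record
            { isMagma = record { isEquivalence = ≡.isEquivalence ; ∙-cong = cong₂ _⊕_ }
            ; assoc = ⊕-assoc }
          ; identity = ⊕-identityˡ , λ k → trans (⊕-comm k e) (⊕-identityˡ k) }
        ; inverse = (λ k → trans (⊕-comm (⊖ k) k) (⊕-inverseʳ k)) , ⊕-inverseʳ
        ; ⁻¹-cong = cong ⊖_ }
      ; comm = ⊕-comm } }

  open Algebra.Properties.AbelianGroup group public
    using () renaming (⁻¹-involutive to ⊖-involutive; ⁻¹-∙-comm to ⊖-⊕-comm; ε⁻¹≈ε to ⊖-e; ∙-cancelˡ to ⊕-cancelˡ;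
        ∙-cancelʳ to ⊕-cancelʳ;
      x≈z//y to ⊕≡⇒≡⊖)

  ⊕-identityʳ : ∀ k → k ⊕ e ≡ k
  ⊕-identityʳ k = trans (⊕-comm k e) (⊕-identityˡ k)

  ⊕-⊖-cancel : ∀ k l → (k ⊕ l) ⊕ (⊖ l) ≡ k
  ⊕-⊖-cancel k l = trans (⊕-assoc k l (⊖ l)) (trans (cong (k ⊕_) (⊕-inverseʳ l)) (⊕-identityʳ k))

  ⊖-⊕-cancel : ∀ k l → (k ⊕ (⊖ l)) ⊕ l ≡ k
  ⊖-⊕-cancel k l = trans (⊕-assoc k (⊖ l) l) (trans (cong (k ⊕_) (trans (⊕-comm (⊖ l) l) (⊕-inverseʳ l))) (⊕-identityʳ k))

  sumF-translate : ∀ (f : Fin n → ℤ) c → sumF (λ k → f (k ⊕ c)) ≡ sumF f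
  sumF-translate f c = sumF-bijection (_⊕ c) (_⊕ (⊖ c)) (λ k → ⊖-⊕-cancel k c) (λ k → ⊕-⊖-cancel k c) f

  sumF-⊖ : ∀ (f : Fin n → ℤ) → sumF (λ k → f (⊖ k)) ≡ sumF f
  sumF-⊖ f = sumF-bijection ⊖_ ⊖_ ⊖-involutive ⊖-involutive f

  -- Right translation of functions on D_n by Σ f(l) a^l and by b.
  convolve : (Fin n → ℤ) → Op D
  convolve f φ (c , k) = sumF (λ l → f l ℤ.* φ (c , k ⊕ l))

  reflect : Op D
  reflect φ (c , k) = φ (not c , ⊖ k)

  convolve-linear : ∀ f → Linear (convolve f)
  convolve-linear f = record
    { ext = λ { eq (c , k) → sumF-cong λ l → cong (f l ℤ.*_) (eq (c , k ⊕ l)) }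
    ; linear = λ { a φ ψ (c , k) → trans (sumF-cong λ l → lem (f l) (φ (c , k ⊕ l)) a (ψ (c , k ⊕ l)))
        (sumF-linear a (λ l → f l ℤ.* φ (c , k ⊕ l)) (λ l → f l ℤ.* ψ (c , k ⊕ l))) }
    }
    where
    lem : ∀ x u a v → x ℤ.* (u ℤ.+ a ℤ.* v) ≡ x ℤ.* u ℤ.+ a ℤ.* (x ℤ.* v)
    lem = solve-∀

  convolve-cong : ∀ {f g} → (∀ l → f l ≡ g l) → ∀ φ x → convolve f φ x ≡ convolve g φ x
  convolve-cong eq φ (c , k) = sumF-cong λ l → cong (ℤ._* φ (c , k ⊕ l)) (eq l)

  private
    sum-sum : (f g : Fin n → ℤ) (h : Fin n → Fin n → ℤ) →
      sumF (λ l → f l ℤ.* sumF (λ m → g m ℤ.* h l m)) ≡ sumF (λ l → sumF (λ m → f l ℤ.* (g m ℤ.* h l m)))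
    sum-sum f g h = sumF-cong λ l → sym (sumF-* (f l) (λ m → g m ℤ.* h l m))

  convolve-comm : ∀ f g φ x → convolve f (convolve g φ) x ≡ convolve g (convolve f φ) x
  convolve-comm f g φ (c , k) = begin
    sumF (λ l → f l ℤ.* sumF (λ m → g m ℤ.* φ (c , (k ⊕ l) ⊕ m))) ≡⟨ sum-sum f g (λ l m → φ (c , (k ⊕ l) ⊕ m)) ⟩
    sumF (λ l → sumF (λ m → f l ℤ.* (g m ℤ.* φ (c , (k ⊕ l) ⊕ m)))) ≡⟨ sumF-comm
        (λ l m → f l ℤ.* (g m ℤ.* φ (c , (k ⊕ l) ⊕ m))) ⟩
    sumF (λ m → sumF (λ l → f l ℤ.* (g m ℤ.* φ (c , (k ⊕ l) ⊕ m)))) ≡⟨ sumF-cong (λ m → sumF-cong λ l → trans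
        (cong (λ z → f l ℤ.* (g m ℤ.* φ (c , z))) (trans (⊕-assoc k l m)
            (trans (cong (k ⊕_) (⊕-comm l m)) (sym (⊕-assoc k m l)))))
        (lem (f l) (g m) _)) ⟩
    sumF (λ m → sumF (λ l → g m ℤ.* (f l ℤ.* φ (c , (k ⊕ m) ⊕ l)))) ≡⟨ sum-sum g f (λ m l → φ (c , (k ⊕ m) ⊕ l)) ⟨
    sumF (λ m → g m ℤ.* sumF (λ l → f l ℤ.* φ (c , (k ⊕ m) ⊕ l))) ∎
    where
    open ≡-Reasoning
    lem : ∀ x y z → x ℤ.* (y ℤ.* z) ≡ y ℤ.* (x ℤ.* z)
    lem = solve-∀

  Symmetric : (Fin n → ℤ) → Set
  Symmetric f = ∀ k → f (⊖ k) ≡ f k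

  -- The relation a^l b = b a^(-l), read on right translations.
  convolve-reflect : ∀ f φ x → convolve f (reflect φ) x ≡ reflect (convolve (λ l → f (⊖ l)) φ) x
  convolve-reflect f φ (c , k) = begin
    sumF (λ l → f l ℤ.* φ (not c , ⊖ (k ⊕ l))) ≡⟨ sumF-⊖ (λ l → f l ℤ.* φ (not c , ⊖ (k ⊕ l))) ⟨
    sumF (λ l → f (⊖ l) ℤ.* φ (not c , ⊖ (k ⊕ (⊖ l)))) ≡⟨ sumF-cong (λ l → cong (λ z → f (⊖ l) ℤ.* φ (not c , z))
        (trans (sym (⊖-⊕-comm k (⊖ l))) (cong ((⊖ k) ⊕_) (⊖-involutive l)))) ⟩
    sumF (λ l → f (⊖ l) ℤ.* φ (not c , (⊖ k) ⊕ l)) ∎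
    where open ≡-Reasoning

  not-involutive : ∀ c → not (not c) ≡ c
  not-involutive true = refl
  not-involutive false = refl

  reflect-involutive : ∀ φ x → reflect (reflect φ) x ≡ φ x
  reflect-involutive φ (c , k) = cong₂ (λ a b → φ (a , b)) (not-involutive c) (⊖-involutive k)

  reflected : (Fin n → ℤ) → Op D
  reflected g φ = reflect (convolve g φ)

  reflected-linear : ∀ g → Linear (reflected g)
  reflected-linear g = record
    { ext = λ { eq (c , k) → ext eq (not c , ⊖ k) }
    ; linear = λ { a φ ψ (c , k) → linear a φ ψ (not c , ⊖ k) } }
    where open Linear (convolve-linear g)

  reflected-comm : ∀ {f} g → Symmetric f → ∀ φ x → convolve f (reflected g φ) x ≡ reflected g (convolve f φ) x
  reflected-comm {f} g f-sym φ x@(c , k) = begin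
    convolve f (reflect (convolve g φ)) x ≡⟨ convolve-reflect f (convolve g φ) x ⟩
    reflect (convolve (λ l → f (⊖ l)) (convolve g φ)) x ≡⟨ convolve-cong f-sym (convolve g φ) (not c , ⊖ k) ⟩
    reflect (convolve f (convolve g φ)) x ≡⟨ convolve-comm f g φ (not c , ⊖ k) ⟩
    reflect (convolve g (convolve f φ)) x ∎
    where open ≡-Reasoning

  -- One reflection is moved past g, which inverts the argument of g, and then cancels against the
  -- other; the square therefore lies in the group ring of ⟨a⟩.
  reflected-square : ∀ g φ x → reflected g (reflected g φ) x ≡ convolve (λ l → g (⊖ l)) (convolve g φ) x
  reflected-square g φ (c , k) = trans (convolve-reflect g (convolve g φ) (not c , ⊖ k))
    (reflect-involutive (convolve (λ l → g (⊖ l)) (convolve g φ)) (c , k))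

  indicator : Subset n → Fin n → ℤ
  indicator S l = if lookup S l then + 1 else + 0

  +sumFℕ : ∀ {m} (f : Fin m → ℕ) → + sumFℕ f ≡ sumF (λ i → + f i)
  +sumFℕ {zero} f = refl
  +sumFℕ {suc m} f = trans (ℤ.pos-+ (f zero) _) (cong (λ z → + f zero ℤ.+ z) (+sumFℕ (f ∘ suc)))

  mult-sum : ∀ S m → + mult S m ≡ sumF (λ k → sumF (λ l → indicator S k ℤ.* (indicator S l ℤ.* δ (l ⊕ (⊖ k)) m)))
  mult-sum S m = trans (+sumFℕ (λ k → sumFℕ (W k))) (sumF-cong λ k → trans (+sumFℕ (W k)) (sumF-cong λ l →
      lem (lookup S k) (lookup S l) (does ((l ⊕ (⊖ k)) Fin.≟ m))))
    where
    W : Fin n → Fin n → ℕ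
    W k l = if lookup S k ∧ lookup S l ∧ does ((l ⊕ (⊖ k)) Fin.≟ m) then 1 else 0
    lem : ∀ a b c → + (if a ∧ b ∧ c then 1 else 0) ≡
      (if a then + 1 else + 0) ℤ.* ((if b then + 1 else + 0) ℤ.* (if c then + 1 else + 0))
    lem true true true = refl
    lem true true false = refl
    lem true false c = refl
    lem false true true = refl
    lem false true false = refl
    lem false false c = refl

  -- The square of b Σ g(l) a^l is the sum of g(i) g(j) a^(j - i) over all pairs; grouping the pairs
  -- by their difference produces the multiplicities.
  convolve-mult : ∀ S φ x → reflected (indicator S) (reflected (indicator S) φ) x ≡ convolve (λ m → + mult S m) φ x
  convolve-mult S φ (c , k) = trans (reflected-square g φ (c , k)) (sym (begin
    sumF (λ m → + mult S m ℤ.* φ′ m) ≡⟨ sumF-cong (λ m →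
        trans (cong (ℤ._* φ′ m) (mult-sum S m)) (trans (ℤ.*-comm (sumF (λ a → sumF (W m a))) (φ′ m))
        (trans (sym (sumF-* (φ′ m) (λ a → sumF (W m a)))) (sumF-cong λ a → sym (sumF-* (φ′ m) (W m a)))))) ⟩
    sumF (λ m → sumF (λ a → sumF (λ b → φ′ m ℤ.* (g a ℤ.* (g b ℤ.* δ (b ⊕ (⊖ a)) m)))))
      ≡⟨ sumF-comm (λ m a → sumF (λ b → φ′ m ℤ.* (g a ℤ.* (g b ℤ.* δ (b ⊕ (⊖ a)) m)))) ⟩
    sumF (λ a → sumF (λ m → sumF (λ b → φ′ m ℤ.* (g a ℤ.* (g b ℤ.* δ (b ⊕ (⊖ a)) m)))))
      ≡⟨ sumF-cong (λ a → sumF-comm (λ m b → φ′ m ℤ.* (g a ℤ.* (g b ℤ.* δ (b ⊕ (⊖ a)) m)))) ⟩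
    sumF (λ a → sumF (λ b → sumF (λ m → φ′ m ℤ.* (g a ℤ.* (g b ℤ.* δ (b ⊕ (⊖ a)) m)))))
      ≡⟨ sumF-cong (λ a → sumF-cong λ b → trans (sumF-cong λ m → lem (φ′ m) (g a) (g b) (δ (b ⊕ (⊖ a)) m))
           (trans (sumF-δˡ (b ⊕ (⊖ a)) (λ m → g a ℤ.* (g b ℤ.* φ′ m)))
               (cong (λ z → g a ℤ.* (g b ℤ.* φ (c , z))) (shuffle a b)))) ⟩
    sumF (λ a → sumF (λ b → g a ℤ.* (g b ℤ.* φ (c , (k ⊕ (⊖ a)) ⊕ b)))) ≡⟨ sum-sum g g (λ a b → φ (c , (k ⊕ (⊖ a)) ⊕ b)) ⟨
    sumF (λ a → g a ℤ.* sumF (λ b → g b ℤ.* φ (c , (k ⊕ (⊖ a)) ⊕ b))) ≡⟨ sumF-cong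
        (λ a → cong (λ z → g z ℤ.* sumF (λ b → g b ℤ.* φ (c , (k ⊕ (⊖ a)) ⊕ b))) (⊖-involutive a)) ⟨
    sumF (λ a → g (⊖ ⊖ a) ℤ.* sumF (λ b → g b ℤ.* φ (c , (k ⊕ (⊖ a)) ⊕ b))) ≡⟨ sumF-⊖
        (λ a → g (⊖ a) ℤ.* sumF (λ b → g b ℤ.* φ (c , (k ⊕ a) ⊕ b))) ⟩
    sumF (λ a → g (⊖ a) ℤ.* sumF (λ b → g b ℤ.* φ (c , (k ⊕ a) ⊕ b))) ∎))
    where
    open ≡-Reasoning
    g = indicator S
    φ′ : Fin n → ℤ
    φ′ m = φ (c , k ⊕ m)
    W : Fin n → Fin n → Fin n → ℤ
    W m a b = g a ℤ.* (g b ℤ.* δ (b ⊕ (⊖ a)) m)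
    lem : ∀ p a b d → p ℤ.* (a ℤ.* (b ℤ.* d)) ≡ d ℤ.* (a ℤ.* (b ℤ.* p))
    lem = solve-∀
    shuffle : ∀ a b → k ⊕ (b ⊕ (⊖ a)) ≡ (k ⊕ (⊖ a)) ⊕ b
    shuffle a b = trans (cong (k ⊕_) (⊕-comm b (⊖ a))) (sym (⊕-assoc k (⊖ a) b))

  adjacency : Subset n → Subset n → Op D
  adjacency S1 S2 φ x = convolve (indicator S1) φ x ℤ.+ reflected (indicator S2) φ x

  vertex-↑ˡ : ∀ l → vertex (l ↑ˡ n) ≡ (false , l)
  vertex-↑ˡ l = cong [ (λ k → false , k) , (λ k → true , k) ] (Fin.splitAt-↑ˡ n l n)

  vertex-↑ʳ : ∀ l → vertex (n ↑ʳ l) ≡ (true , l)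
  vertex-↑ʳ l = cong [ (λ k → false , k) , (λ k → true , k) ] (Fin.splitAt-↑ʳ n n l)

  index : D → Fin (n + n)
  index (false , k) = k ↑ˡ n
  index (true  , k) = n ↑ʳ k

  vertex-index : ∀ x → vertex (index x) ≡ x
  vertex-index (false , k) = vertex-↑ˡ k
  vertex-index (true  , k) = vertex-↑ʳ k

  index-vertex : ∀ i → index (vertex i) ≡ i
  index-vertex i = trans (lem (splitAt n i)) (Fin.join-splitAt n n i)
    where
    lem : ∀ s → index ([ (λ k → false , k) , (λ k → true , k) ] s) ≡ Fin.join n n s
    lem (inj₁ k) = refl
    lem (inj₂ k) = refl

  module _ (S1 S2 : Subset n) where

    private
      A = adj S1 S2
      P = adjacency S1 S2
      entry : D → D → ℤ
      entry x y = if memberS S1 S2 (inv x · y) then + 1 else + 0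

      -- Adjacency sums over y with x⁻¹ y in the connection set; a translation of the summation
      -- index turns this into a sum over s with y = x s.
      row : ∀ φ x → sumF (λ l → entry x (false , l) ℤ.* φ (false , l)) ℤ.+ sumF
          (λ l → entry x (true , l) ℤ.* φ (true , l)) ≡ P φ x
      row φ (false , k) = cong₂ ℤ._+_
        (begin
          sumF (λ l → indicator S1 ((⊖ k) ⊕ l) ℤ.* φ (false , l)) ≡⟨ sumF-translate
              (λ l → indicator S1 ((⊖ k) ⊕ l) ℤ.* φ (false , l)) k ⟨
          sumF (λ l → indicator S1 ((⊖ k) ⊕ (l ⊕ k)) ℤ.* φ (false , l ⊕ k)) ≡⟨ sumF-cong
              (λ l → cong₂ (λ a b → indicator S1 a ℤ.* φ (false , b))
              (trans (⊕-comm (⊖ k) (l ⊕ k)) (⊕-⊖-cancel l k)) (⊕-comm l k)) ⟩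
          sumF (λ l → indicator S1 l ℤ.* φ (false , k ⊕ l)) ∎)
        (begin
          sumF (λ l → indicator S2 (l ⊕ (⊖ ⊖ k)) ℤ.* φ (true , l)) ≡⟨ sumF-translate
              (λ l → indicator S2 (l ⊕ (⊖ ⊖ k)) ℤ.* φ (true , l)) (⊖ k) ⟨
          sumF (λ l → indicator S2 ((l ⊕ (⊖ k)) ⊕ (⊖ ⊖ k)) ℤ.* φ (true , l ⊕ (⊖ k))) ≡⟨ sumF-cong
              (λ l → cong₂ (λ a b → indicator S2 a ℤ.* φ (true , b))
              (⊕-⊖-cancel l (⊖ k)) (⊕-comm l (⊖ k))) ⟩
          sumF (λ l → indicator S2 l ℤ.* φ (true , (⊖ k) ⊕ l)) ∎)
        where open ≡-Reasoning
      -- At a vertex ba^k the neighbours through `S1` lie in the second half of the vertices, so the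
      -- two sums arrive in the opposite order.
      row φ (true , k) = trans (ℤ.+-comm (sumF (λ l → entry (true , k) (false , l) ℤ.* φ (false , l)))
          (sumF (λ l → entry (true , k) (true , l) ℤ.* φ (true , l)))) (cong₂ ℤ._+_
        (begin
          sumF (λ l → indicator S1 (l ⊕ (⊖ k)) ℤ.* φ (true , l)) ≡⟨ sumF-translate
              (λ l → indicator S1 (l ⊕ (⊖ k)) ℤ.* φ (true , l)) k ⟨
          sumF (λ l → indicator S1 ((l ⊕ k) ⊕ (⊖ k)) ℤ.* φ (true , l ⊕ k)) ≡⟨ sumF-cong
              (λ l → cong₂ (λ a b → indicator S1 a ℤ.* φ (true , b))
              (⊕-⊖-cancel l k) (⊕-comm l k)) ⟩
          sumF (λ l → indicator S1 l ℤ.* φ (true , k ⊕ l)) ∎)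
        (begin
          sumF (λ l → indicator S2 (k ⊕ l) ℤ.* φ (false , l)) ≡⟨ sumF-translate
              (λ l → indicator S2 (k ⊕ l) ℤ.* φ (false , l)) (⊖ k) ⟨
          sumF (λ l → indicator S2 (k ⊕ (l ⊕ (⊖ k))) ℤ.* φ (false , l ⊕ (⊖ k))) ≡⟨ sumF-cong
              (λ l → cong₂ (λ a b → indicator S2 a ℤ.* φ (false , b))
              (trans (⊕-comm k (l ⊕ (⊖ k))) (⊖-⊕-cancel l k)) (⊕-comm l (⊖ k))) ⟩
          sumF (λ l → indicator S2 l ℤ.* φ (false , (⊖ k) ⊕ l)) ∎))
        where open ≡-Reasoning

    mulVec-adj : ∀ φ i → mulVec A (φ ∘ vertex) i ≡ P φ (vertex i)
    mulVec-adj φ i = trans (sumF-++ n (λ j → entry (vertex i) (vertex j) ℤ.* φ (vertex j)))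
      (trans (cong₂ ℤ._+_ (sumF-cong λ l → cong (λ y → entry (vertex i) y ℤ.* φ y) (vertex-↑ˡ l))
        (sumF-cong λ l → cong (λ y → entry (vertex i) y ℤ.* φ y) (vertex-↑ʳ l))) (row φ (vertex i)))

    splitOp-adj : ∀ νs φ i → splitOp (mulVec A) νs (φ ∘ vertex) i ≡ splitOp P νs φ (vertex i)
    splitOp-adj [] φ i = refl
    splitOp-adj (ν ∷ νs) φ i = cong₂ (λ u v → u ℤ.- ν ℤ.* v)
      (trans (Linear.ext (mulVec-linear A) (splitOp-adj νs φ) i) (mulVec-adj (splitOp P νs φ) i)) (splitOp-adj νs φ i)

    integral⇒split-adjacency : IntegralCayley S1 S2 → Split P
    integral⇒split-adjacency int = proj₁ vanish , λ φ x → trans (cong (splitOp P (proj₁ vanish) φ) (sym (vertex-index x)))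
      (trans (sym (splitOp-adj (proj₁ vanish) φ (index x))) (proj₂ vanish (φ ∘ vertex) (index x)))
      where
      vanish : Split (mulVec A)
      vanish = integral⇒split A int

    split-adjacency⇒integral : Split P → IntegralCayley S1 S2
    split-adjacency⇒integral (νs , vanish) = split⇒integral A (νs , λ φ i →
      trans (Linear.ext (splitOp-linear (mulVec-linear A) νs) (λ j → cong φ (sym (index-vertex j))) i)
        (trans (splitOp-adj νs (φ ∘ index) i) (vanish (φ ∘ index) (vertex i))))

-- Conjugation by signs and eigenvalues of squares

split-conjugate : {I : Set} {P P′ : Op I} → Linear P → Linear P′ → (ε : I → ℤ) → (∀ i → ε i ℤ.* ε i ≡ + 1) →
  (∀ φ i → P′ φ i ≡ ε i ℤ.* P (λ j → ε j ℤ.* φ j) i) → Split P → Split P′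
split-conjugate {I} {P} {P′} lin lin′ ε ε² conj (νs , vanish) = νs , λ φ i →
  trans (go νs φ i) (trans (cong (ε i ℤ.*_) (vanish (λ j → ε j ℤ.* φ j) i)) (ℤ.*-zeroʳ (ε i)))
  where
  open ≡-Reasoning
  cancel : ∀ j x → ε j ℤ.* (ε j ℤ.* x) ≡ x
  cancel j x = trans (sym (ℤ.*-assoc (ε j) (ε j) x)) (trans (cong (ℤ._* x) (ε² j)) (ℤ.*-identityˡ x))
  go : ∀ νs φ i → splitOp P′ νs φ i ≡ ε i ℤ.* splitOp P νs (λ j → ε j ℤ.* φ j) i
  go [] φ i = sym (cancel i (φ i))
  go (ν ∷ νs) φ i = begin
    P′ (splitOp P′ νs φ) i ℤ.- ν ℤ.* splitOp P′ νs φ i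
      ≡⟨ cong₂ (λ u v → u ℤ.- ν ℤ.* v) (trans (Linear.ext lin′ (go νs φ) i) (conj _ i)) (go νs φ i) ⟩
    ε i ℤ.* P (λ j → ε j ℤ.* (ε j ℤ.* S j)) i ℤ.- ν ℤ.* (ε i ℤ.* S i)
      ≡⟨ cong (λ z → ε i ℤ.* z ℤ.- ν ℤ.* (ε i ℤ.* S i)) (Linear.ext lin (λ j → cancel j (S j)) i) ⟩
    ε i ℤ.* P S i ℤ.- ν ℤ.* (ε i ℤ.* S i) ≡⟨ lem (ε i) (P S i) ν (S i) ⟩
    ε i ℤ.* (P S i ℤ.- ν ℤ.* S i) ∎
    where
    S : I → ℤ
    S = splitOp P νs (λ j → ε j ℤ.* φ j)
    lem : ∀ e p n s → e ℤ.* p ℤ.- n ℤ.* (e ℤ.* s) ≡ e ℤ.* (p ℤ.- n ℤ.* s)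
    lem = solve-∀

-- As 2 divides ν², it divides ν, and half of ν is the root.
square-root-of-4c : ∀ c ν → + (4 * c) ≡ ν ℤ.* ν → ∃[ r ] r * r ≡ c
square-root-of-4c c ν eq = root ([ (λ d → d) , (λ d → d) ]′ (euclidsLemma ℤ.∣ ν ∣ ℤ.∣ ν ∣ prime[2]
    (divides (2 * c) (trans abs (trans (ℕ.*-assoc 2 2 c) (ℕ.*-comm 2 (2 * c)))))))
  where
  abs : ℤ.∣ ν ∣ * ℤ.∣ ν ∣ ≡ 4 * c
  abs = trans (sym (ℤ.abs-* ν ν)) (cong ℤ.∣_∣ (sym eq))
  lem : ∀ r → 4 * (r * r) ≡ r * 2 * (r * 2)
  lem = solveℕ-∀
  root : 2 ∣ ℤ.∣ ν ∣ → ∃[ r ] r * r ≡ c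
  root (divides r e) = r , ℕ.*-cancelˡ-≡ (r * r) c 4 (trans (lem r) (trans (cong₂ _*_ (sym e) (sym e)) abs))

eigenvalue-root : {I : Set} {P : Op I} → Linear P → ∀ νs {v : I → ℤ} {a} → (∀ i → P v i ≡ a ℤ.* v i) →
  ∀ i → splitOp P νs v i ≡ splitPoly νs a ℤ.* v i
eigenvalue-root lin [] eig i = sym (ℤ.*-identityˡ _)
eigenvalue-root {P = P} lin (ν ∷ νs) {v} {a} eig i = trans
  (cong₂ (λ x y → x ℤ.- ν ℤ.* y)
    (trans (Linear.ext lin (eigenvalue-root lin νs eig) i)
        (trans (linear-scale lin (splitPoly νs a) v i) (cong (splitPoly νs a ℤ.*_) (eig i))))
    (eigenvalue-root lin νs eig i))
  (lem (splitPoly νs a) a (v i) ν)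
  where
  lem : ∀ s a v ν → s ℤ.* (a ℤ.* v) ℤ.- ν ℤ.* (s ℤ.* v) ≡ (a ℤ.- ν) ℤ.* s ℤ.* v
  lem = solve-∀

module _ {I : Set} {P : Op I} (lin : Linear P) where

  private module O = ExactOperatorRing {I} {Bool} (λ _ → P) (λ _ → lin) (λ _ _ _ _ → refl)

  -- The eigenvalues of 2P are integers, so an eigenvalue c of P² satisfies 4c = ν² for one of them.
  square-eigenvalue : Split (λ φ i → + 2 ℤ.* P φ i) → ∀ {v} {c : ℕ} → (∀ i → P (P v) i ≡ + c ℤ.* v i) →
    ∀ i → v i ≢ + 0 → ∃[ r ] r * r ≡ c
  square-eigenvalue (νs , vanish) {v} {c} eig i v≢0 = from-root root
    where
    open ≡-Reasoning
    twice : O.Expr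
    twice = O.con (+ 2) O.⊛ O.gen true
    squares : List ℤ
    squares = List.map (λ ν → ν ℤ.* ν) νs
    killed : O.split squares (twice O.⊛ twice) O.≈ O.con (+ 0)
    killed = O.split-square νs {twice} (proj₂ (O.splits⇐ {twice} (νs , vanish)))
    eig′ : ∀ j → O.act (twice O.⊛ twice) v j ≡ + (4 * c) ℤ.* v j
    eig′ j = begin
      + 2 ℤ.* P (λ k → + 2 ℤ.* P v k) j ≡⟨ cong (+ 2 ℤ.*_) (linear-scale lin (+ 2) (P v) j) ⟩
      + 2 ℤ.* (+ 2 ℤ.* P (P v) j) ≡⟨ cong (λ z → + 2 ℤ.* (+ 2 ℤ.* z)) (eig j) ⟩
      + 2 ℤ.* (+ 2 ℤ.* (+ c ℤ.* v j)) ≡⟨ lem (+ c) (v j) ⟩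
      + 4 ℤ.* + c ℤ.* v j ≡⟨ cong (ℤ._* v j) (ℤ.pos-* 4 c) ⟨
      + (4 * c) ℤ.* v j ∎
      where
      lem : ∀ c v → + 2 ℤ.* (+ 2 ℤ.* (c ℤ.* v)) ≡ + 4 ℤ.* c ℤ.* v
      lem = solve-∀
    root : splitPoly squares (+ (4 * c)) ≡ + 0
    root = [ (λ eq → eq) , (λ eq → contradiction eq v≢0) ]′ (ℤ.i*j≡0⇒i≡0∨j≡0 (splitPoly squares (+ (4 * c)))
      (trans (sym (eigenvalue-root (O.act-linear (twice O.⊛ twice)) squares eig′ i))
        (trans (sym (O.act-split squares (twice O.⊛ twice) v i)) (O.≈⇒≡ killed v i))))
    from-root : splitPoly squares (+ (4 * c)) ≡ + 0 → ∃[ r ] r * r ≡ c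
    from-root = search νs
      where
      search : ∀ νs → splitPoly (List.map (λ ν → ν ℤ.* ν) νs) (+ (4 * c)) ≡ + 0 → ∃[ r ] r * r ≡ c
      search (ν ∷ νs) eq with ℤ.i*j≡0⇒i≡0∨j≡0 (+ (4 * c) ℤ.- ν ℤ.* ν) eq
      ... | inj₁ e = square-root-of-4c c ν (ℤ.i-j≡0⇒i≡j (+ (4 * c)) (ν ℤ.* ν) e)
      ... | inj₂ e = search νs e

-- Separating the two summands; prime multipliers of S₁

module CyclicGroupOperators (n : ℕ) .{{nz : NonZero n}} where

  open Dihedral n
  open CyclicGroup n

  module _ (f g : Fin n → ℤ) (f-sym : Symmetric f) where

    private
      op : Bool → Op D
      op true  = convolve f
      op false = reflected g
      op-linear : ∀ b → Linear (op b)
      op-linear true = convolve-linear f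
      op-linear false = reflected-linear g
      op-comm : ∀ a b φ x → op a (op b φ) x ≡ op b (op a φ) x
      op-comm true true φ x = refl
      op-comm true false φ x = reflected-comm g f-sym φ x
      op-comm false true φ x = sym (reflected-comm g f-sym φ x)
      op-comm false false φ x = refl
      module O = ExactOperatorRing op op-linear op-comm
      s β : O.Expr
      s = O.gen true
      β = O.gen false

    split-sum : Split (convolve f) → Split (reflected g) → Split (λ φ x → convolve f φ x ℤ.+ reflected g φ x)
    split-sum a b = O.splits⇒ {s O.⊹ β} (O.splits-⊕ (O.splits⇐ {s} a) (O.splits⇐ {β} b))

    -- The automorphism b ↦ -b of the group ring takes s + β to s - β, so both have integer eigenvalues.
    split-summands : Split (λ φ x → convolve f φ x ℤ.+ reflected g φ x) →
      Split (λ φ x → + 2 ℤ.* convolve f φ x) × Split (λ φ x → + 2 ℤ.* reflected g φ x)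
    split-summands sp =
      O.splits⇒ {O.con (+ 2) O.⊛ s} (O.splits-cong {sum O.⊹ difference} {O.con (+ 2) O.⊛ s}
        (O.exact λ φ x → lem₁ (convolve f φ x) (reflected g φ x))
            (O.splits-⊕ (O.splits⇐ {sum} sp) (O.splits⇐ {difference} sp′))) ,
      O.splits⇒ {O.con (+ 2) O.⊛ β} (O.splits-cong {sum O.⊹ O.con (- + 1) O.⊛ difference} {O.con (+ 2) O.⊛ β}
        (O.exact λ φ x → lem₂ (convolve f φ x) (reflected g φ x))
            (O.splits-⊕ (O.splits⇐ {sum} sp) (O.splits-scale (- + 1) (O.splits⇐ {difference} sp′))))
      where
      sum difference : O.Expr
      sum = s O.⊹ β
      difference = s O.⊹ O.neg β
      ε : D → ℤ
      ε (c , k) = if c then - + 1 else + 1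
      ε² : ∀ x → ε x ℤ.* ε x ≡ + 1
      ε² (true , _) = refl
      ε² (false , _) = refl
      lem₁ : ∀ u v → u ℤ.+ v ℤ.+ (u ℤ.+ - v) ≡ + 2 ℤ.* u
      lem₁ = solve-∀
      lem₂ : ∀ u v → u ℤ.+ v ℤ.+ - + 1 ℤ.* (u ℤ.+ - v) ≡ + 2 ℤ.* v
      lem₂ = solve-∀
      sumF-scaled : ∀ (w : Fin n → ℤ) a (u : Fin n → ℤ) → sumF (λ l → w l ℤ.* (a ℤ.* u l)) ≡ a ℤ.* sumF (λ l → w l ℤ.* u l)
      sumF-scaled w a u = trans (sumF-cong λ l → lem (w l) a (u l)) (sumF-* a (λ l → w l ℤ.* u l))
        where
        lem : ∀ w a u → w ℤ.* (a ℤ.* u) ≡ a ℤ.* (w ℤ.* u)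
        lem = solve-∀
      conj : ∀ φ x → convolve f φ x ℤ.+ - reflected g φ x ≡
        ε x ℤ.* (convolve f (λ y → ε y ℤ.* φ y) x ℤ.+ reflected g (λ y → ε y ℤ.* φ y) x)
      conj φ (true , k) = sym (trans
        (cong₂ (λ u v → - + 1 ℤ.* (u ℤ.+ v)) (sumF-scaled (λ l → f l) (- + 1) (λ l → φ (true , k ⊕ l)))
          (sumF-scaled (λ l → g l) (+ 1) (λ l → φ (false , (⊖ k) ⊕ l))))
        (lem (convolve f φ (true , k)) (reflected g φ (true , k))))
        where
        lem : ∀ u v → - + 1 ℤ.* (- + 1 ℤ.* u ℤ.+ + 1 ℤ.* v) ≡ u ℤ.+ - v
        lem = solve-∀
      conj φ (false , k) = sym (trans
        (cong₂ (λ u v → + 1 ℤ.* (u ℤ.+ v)) (sumF-scaled (λ l → f l) (+ 1) (λ l → φ (false , k ⊕ l)))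
          (sumF-scaled (λ l → g l) (- + 1) (λ l → φ (true , (⊖ k) ⊕ l))))
        (lem (convolve f φ (false , k)) (reflected g φ (false , k))))
        where
        lem : ∀ u v → + 1 ℤ.* (+ 1 ℤ.* u ℤ.+ - + 1 ℤ.* v) ≡ u ℤ.+ - v
        lem = solve-∀
      sp′ : Split (λ φ x → convolve f φ x ℤ.+ - reflected g φ x)
      sp′ = split-conjugate (O.act-linear sum) (O.act-linear difference) ε ε² conj sp

  infixr 21 _⊙_
  _⊙_ : ℕ → Fin n → Fin n
  u ⊙ k = (u * toℕ k) mod n

  %-absorbʳ : ∀ u a → (u * (a % n)) % n ≡ (u * a) % n
  %-absorbʳ u a = trans (%-distribˡ-* u (a % n) n) (trans
      (cong (λ z → ((u % n) * z) % n) (m%n%n≡m%n a n)) (sym (%-distribˡ-* u a n)))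

  ⊙-mod : ∀ u a → u ⊙ (a mod n) ≡ (u * a) mod n
  ⊙-mod u a = mod-cong (trans (cong (λ z → (u * z) % n) (toℕ-mod a)) (%-absorbʳ u a))

  ⊙-⊕ : ∀ u k l → u ⊙ (k ⊕ l) ≡ u ⊙ k ⊕ u ⊙ l
  ⊙-⊕ u k l = trans (⊙-mod u (toℕ k + toℕ l)) (trans (cong (_mod n) (ℕ.*-distribˡ-+ u (toℕ k) (toℕ l)))
      (sym (mod-⊕ (u * toℕ k) (u * toℕ l))))

  ⊙-assoc : ∀ u v k → u ⊙ v ⊙ k ≡ (u * v) ⊙ k
  ⊙-assoc u v k = trans (⊙-mod u (v * toℕ k)) (cong (_mod n) (sym (ℕ.*-assoc u v (toℕ k))))

  ⊙-suc : ∀ u k → suc u ⊙ k ≡ k ⊕ u ⊙ k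
  ⊙-suc u k = sym (mod-⊕ʳ k (u * toℕ k))

  ⊙-identity : ∀ k → 1 ⊙ k ≡ k
  ⊙-identity k = trans (cong (_mod n) (ℕ.*-identityˡ (toℕ k))) (mod-toℕ k)

  toℕ-e : toℕ e ≡ 0
  toℕ-e = trans (toℕ-mod 0) (m<n⇒m%n≡m (ℕ.>-nonZero⁻¹ n))

  ⊙-injective : ∀ {u} → Coprime u n → ∀ {k l} → u ⊙ k ≡ u ⊙ l → k ≡ l
  ⊙-injective {u} cop {k} {l} eq = trans (sym (⊖-⊕-cancel k l)) (trans (cong (_⊕ l) d≡e) (⊕-identityˡ l))
    where
    d : Fin n
    d = k ⊕ (⊖ l)
    u⊙d : u ⊙ d ≡ e
    u⊙d = ⊕-cancelʳ (u ⊙ l) (u ⊙ d) e (trans (sym (⊙-⊕ u d l))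
        (trans (cong (u ⊙_) (⊖-⊕-cancel k l)) (trans eq (sym (⊕-identityˡ _)))))
    n∣ud : n ∣ u * toℕ d
    n∣ud = m%n≡0⇒n∣m _ n (trans (sym (toℕ-mod (u * toℕ d))) (trans (cong toℕ u⊙d) toℕ-e))
    d≡e : d ≡ e
    d≡e = Fin.toℕ-injective (trans (zero-of (toℕ d) (Fin.toℕ<n d) (coprime-divisor (Coprimality.sym cop) n∣ud)) (sym toℕ-e))
      where
      zero-of : ∀ z → z < n → n ∣ z → z ≡ 0
      zero-of zero _ _ = refl
      zero-of (suc z) z<n n∣z = contradiction (∣⇒≤ n∣z) (ℕ.<⇒≱ z<n)

  coprime-^ : ∀ {u} → Coprime u n → ∀ k → Coprime (u ℕ.^ k) n
  coprime-^ cop zero (d∣1 , _) = ∣1⇒≡1 d∣1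
  coprime-^ {u} cop (suc k) {d} (d∣ , d∣n) = coprime-^ cop k
    (coprime-divisor (λ { (c∣d , c∣u) → cop (c∣u , ∣-trans c∣d d∣n) }) d∣ , d∣n)

  module _ (p : ℕ) (pp : Prime p) where

    private
      shift : Fin n → Op D
      shift l φ (c , k) = φ (c , k ⊕ l)
      shift-linear : ∀ l → Linear (shift l)
      shift-linear l = record { ext = λ { eq (c , k) → eq (c , k ⊕ l) } ; linear = λ { a φ ψ (c , k) → refl } }
      shift-comm : ∀ l m φ x → shift l (shift m φ) x ≡ shift m (shift l φ) x
      shift-comm l m φ (c , k) = cong (λ z → φ (c , z)) (trans
          (⊕-assoc k l m) (trans (cong (k ⊕_) (⊕-comm l m)) (sym (⊕-assoc k m l))))
      -- With N = p the expressions act as elements of the group ring of ⟨a⟩ modulo p.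
      module O = OperatorRing shift shift-linear shift-comm (+ p)
      char : O.con (+ p) O.≈ O.con (+ 0)
      char = O.congruent λ φ → φ , λ i → sym (ℤ.+-identityˡ _)
      module Fr = O.Frobenius p pp char
      open O.Exp using (_^_)

      act-sum : ∀ {m} (F : Fin m → O.Expr) φ x → O.act (O.Sum.sum F) φ x ≡ sumF (λ l → O.act (F l) φ x)
      act-sum {zero} F φ x = refl
      act-sum {suc m} F φ x = cong (λ z → O.act (F zero) φ x ℤ.+ z) (act-sum (F ∘ suc) φ x)

      act-power : ∀ l u φ c k → O.act (O.gen l ^ u) φ (c , k) ≡ φ (c , k ⊕ u ⊙ l)
      act-power l zero φ c k = trans (ℤ.*-identityˡ _) (cong (λ z → φ (c , z)) (sym (⊕-identityʳ k)))
      act-power l (suc u) φ c k = trans (act-power l u φ c (k ⊕ l))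
        (cong (λ z → φ (c , z)) (trans (⊕-assoc k l (u ⊙ l)) (cong (k ⊕_) (sym (⊙-suc u l)))))

    module _ (f : Fin n → ℤ) where
      private
        element : ℕ → O.Expr
        element u = O.Sum.sum (λ l → O.con (f l) O.⊛ O.gen l ^ u)

        act-element : ∀ u φ c k → O.act (element u) φ (c , k) ≡ sumF (λ l → f l ℤ.* φ (c , k ⊕ u ⊙ l))
        act-element u φ c k = trans (act-sum (λ l → O.con (f l) O.⊛ O.gen l ^ u) φ (c , k))
          (sumF-cong λ l → cong (f l ℤ.*_) (act-power l u φ c k))

        -- Modulo p the Frobenius map is additive and fixes integers, including the factor 2, so it
        -- only raises the group elements to the power p^j.
        frob-element : ∀ j → Fr.frob j (O.con (+ 2) O.⊛ element 1) O.≈ O.con (+ 2) O.⊛ element (p ℕ.^ j)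
        frob-element j = begin
          Fr.frob j (O.con (+ 2) O.⊛ element 1) ≈⟨ O.Exp.^-distrib-* (O.con (+ 2)) (element 1) (p ℕ.^ j) ⟩
          Fr.frob j (O.con (+ 2)) O.⊛ Fr.frob j (element 1) ≈⟨ R.*-cong (Fr.frob-⟦⟧ j (+ 2))
              (R.trans (Fr.frob-sum j (λ l → O.con (f l) O.⊛ O.gen l ^ 1)) (O.Sum.sum-cong-≋ term)) ⟩
          O.con (+ 2) O.⊛ element (p ℕ.^ j) ∎
          where
          module R = CommutativeRing O.ring
          open import Relation.Binary.Reasoning.Setoid R.setoid
          term : ∀ l → Fr.frob j (O.con (f l) O.⊛ O.gen l ^ 1) O.≈ O.con (f l) O.⊛ O.gen l ^ (p ℕ.^ j)
          term l = begin
            Fr.frob j (O.con (f l) O.⊛ O.gen l ^ 1) ≈⟨ O.Exp.^-distrib-* (O.con (f l)) (O.gen l ^ 1) (p ℕ.^ j) ⟩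
            Fr.frob j (O.con (f l)) O.⊛ Fr.frob j (O.gen l ^ 1) ≈⟨ R.*-cong (Fr.frob-⟦⟧ j (f l))
                (Fr.frob-cong j (R.*-identityʳ (O.gen l))) ⟩
            O.con (f l) O.⊛ O.gen l ^ (p ℕ.^ j) ∎

      -- Comparison of coefficients in 2 s^(p^(j+1)) ≡ 2 s^(p^j) mod p, where s^(p^j) ≡ Σ f(l) a^(l p^j).
      frobenius-coefficients : Split (λ φ x → + 2 ℤ.* convolve f φ x) → ∃[ j ] ∀ m → ∃[ z ]
        + 2 ℤ.* sumF (λ l → f l ℤ.* δ ((p ℕ.^ suc j) ⊙ l) m) ≡ + 2 ℤ.* sumF
            (λ l → f l ℤ.* δ ((p ℕ.^ j) ⊙ l) m) ℤ.+ + p ℤ.* z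
      frobenius-coefficients (νs , vanish) = j , λ m → proj₁ (differ m) (false , e) ,
          trans (sym (coefficient (suc j) m)) (trans (proj₂ (differ m) (false , e))
              (cong (λ z → z ℤ.+ + p ℤ.* proj₁ (differ m) (false , e)) (coefficient j m)))
        where
        module R = CommutativeRing O.ring
        twice : O.Expr
        twice = O.con (+ 2) O.⊛ element 1
        act-twice : ∀ φ x → O.act twice φ x ≡ + 2 ℤ.* convolve f φ x
        act-twice φ (c , k) = cong (+ 2 ℤ.*_) (trans (act-element 1 φ c k)
          (sumF-cong λ l → cong (λ z → f l ℤ.* φ (c , k ⊕ z)) (⊙-identity l)))
        splits : O.Splits twice
        splits = νs , O.exact λ φ x → trans (O.act-split νs twice φ x)
          (trans (sym (splitOp-cong (O.act-linear twice) (λ φ x → sym (act-twice φ x)) νs φ x)) (vanish φ x))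
        stable = Fr.frob-stabilises splits
        j = proj₁ stable
        compare : O.con (+ 2) O.⊛ element (p ℕ.^ suc j) O.≈ O.con (+ 2) O.⊛ element (p ℕ.^ j)
        compare = R.trans (R.sym (frob-element (suc j))) (R.trans (proj₂ stable) (frob-element j))
        -- Applied to this point mass and evaluated at the identity, an element of the group ring
        -- returns its coefficient at a^m.
        probe : Fin n → D → ℤ
        probe m (_ , k) = δ k m
        differ : ∀ m → Σ[ χ ∈ (D → ℤ) ] ∀ x → O.act (O.con (+ 2) O.⊛ element (p ℕ.^ suc j)) (probe m) x ≡
          O.act (O.con (+ 2) O.⊛ element (p ℕ.^ j)) (probe m) x ℤ.+ + p ℤ.* χ x
        differ m = O.differ compare (probe m)
        coefficient : ∀ i m → O.act (O.con (+ 2) O.⊛ element (p ℕ.^ i)) (probe m) (false , e) ≡ + 2 ℤ.* sumF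
            (λ l → f l ℤ.* δ ((p ℕ.^ i) ⊙ l) m)
        coefficient i m = cong (+ 2 ℤ.*_) (trans (act-element (p ℕ.^ i) (probe m) false e)
          (sumF-cong λ l → cong (λ z → f l ℤ.* δ z m) (⊕-identityˡ _)))

    -- Suppose p l is outside S and compare coefficients at p^(j+1) l. On the left only l
    -- contributes, giving 2. On the right the only index sent there by p^j is p l, giving 0. Hence
    -- p divides 2.
    prime-multiplier : 3 ≤ p → Coprime p n → ∀ S → Split (λ φ x → + 2 ℤ.* convolve (indicator S) φ x) →
      ∀ l → l ∈ S → p ⊙ l ∈ S
    prime-multiplier 3≤p cop S sp l l∈S with lookup S (p ⊙ l) in S-pl
    ... | true = lookup⇒[]= (p ⊙ l) S S-pl
    ... | false = contradiction p≤2 (ℕ.<⇒≱ 3≤p)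
      where
      f = indicator S
      coefficients = frobenius-coefficients f sp
      j = proj₁ coefficients
      m : Fin n
      m = (p ℕ.^ suc j) ⊙ l
      z = proj₁ (proj₂ coefficients m)
      f-l : f l ≡ + 1
      f-l = cong (if_then + 1 else + 0) ([]=⇒lookup l∈S)
      left : sumF (λ k → f k ℤ.* δ ((p ℕ.^ suc j) ⊙ k) m) ≡ + 1
      left = trans (sumF-only l _ λ k l≢k → trans (cong (f k ℤ.*_)
          (δ-≢ (λ eq → l≢k (⊙-injective (coprime-^ cop (suc j)) (sym eq))))) (ℤ.*-zeroʳ (f k)))
        (cong₂ ℤ._*_ f-l (δ-refl m))
      right : sumF (λ k → f k ℤ.* δ ((p ℕ.^ j) ⊙ k) m) ≡ + 0
      right = sumF-zero λ k → term k
        where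
        term : ∀ k → f k ℤ.* δ ((p ℕ.^ j) ⊙ k) m ≡ + 0
        term k with (p ℕ.^ j) ⊙ k Fin.≟ m
        ... | no _ = ℤ.*-zeroʳ (f k)
        ... | yes eq = cong (ℤ._* + 1) (trans (cong f (⊙-injective (coprime-^ cop j) (trans eq
                (trans (cong (_⊙ l) (ℕ.*-comm p (p ℕ.^ j))) (sym (⊙-assoc (p ℕ.^ j) p l))))))
                    (cong (if_then + 1 else + 0) S-pl))
      p≤2 : p ≤ 2
      p≤2 = ∣⇒≤ (divides ℤ.∣ z ∣ (trans (cong ℤ.∣_∣ (trans
          (trans (sym (cong (+ 2 ℤ.*_) left)) (proj₂ (proj₂ coefficients m)))
        (trans (cong (λ w → + 2 ℤ.* w ℤ.+ + p ℤ.* z) right) (ℤ.+-identityˡ (+ p ℤ.* z)))))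
            (trans (ℤ.abs-* (+ p) z) (ℕ.*-comm p ℤ.∣ z ∣))))

-- The Boolean algebra of subgroups and the split elements it provides

bool-ext : ∀ {a b : Bool} → (a ≡ true → b ≡ true) → (b ≡ true → a ≡ true) → a ≡ b
bool-ext {true} {b} f g = sym (f refl)
bool-ext {false} {true} f g = g refl
bool-ext {false} {false} f g = refl

does⇒ : {P : Set} (d : Dec P) → does d ≡ true → P
does⇒ (yes p) _ = p

lookup-⁅⁆ : ∀ {n} (x l : Fin n) → lookup ⁅ x ⁆ l ≡ does (x Fin.≟ l)
lookup-⁅⁆ zero zero = refl
lookup-⁅⁆ zero (suc l) = lookup-replicate l false
lookup-⁅⁆ (suc x) zero = refl
lookup-⁅⁆ (suc x) (suc l) = lookup-⁅⁆ x l

ind : Bool → ℤ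
ind b = if b then + 1 else + 0

module BooleanAlgebra (n : ℕ) .{{nz : NonZero n}} where

  open Dihedral n
  open CyclicGroup n
  open CyclicGroupOperators n

  ⊙-⊖ : ∀ u k → u ⊙ (⊖ k) ≡ ⊖ (u ⊙ k)
  ⊙-⊖ u k = ⊕-cancelʳ (u ⊙ k) _ _ (trans (sym (⊙-⊕ u (⊖ k) k)) (trans (cong (u ⊙_) (trans (⊕-comm (⊖ k) k) (⊕-inverseʳ k)))
    (trans (trans (⊙-mod u 0) (cong (_mod n) (ℕ.*-zeroʳ u))) (sym (trans (⊕-comm _ (u ⊙ k)) (⊕-inverseʳ (u ⊙ k)))))))

  ⊙-e : ∀ u → u ⊙ e ≡ e
  ⊙-e u = trans (⊙-mod u 0) (cong (_mod n) (ℕ.*-zeroʳ u))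

  module _ (d : ℕ) where
    private
      step? : ∀ m → Dec (∃ λ j → ((toℕ j * d) mod n) ≡ m)
      step? m = any? {n = n} {P = λ j → ((toℕ j * d) mod n) ≡ m} (λ j → ((toℕ j * d) mod n) Fin.≟ m)

    cyc⇒ : ∀ {m} → lookup (cyc d) m ≡ true → ∃[ j ] d ⊙ j ≡ m
    cyc⇒ {m} eq with does⇒ (step? m) (trans (sym (lookup∘tabulate _ m)) eq)
    ... | j , e = j , trans (cong (_mod n) (ℕ.*-comm d (toℕ j))) e

    cyc⇐ : ∀ {m} → ∃[ j ] d ⊙ j ≡ m → lookup (cyc d) m ≡ true
    cyc⇐ {m} (j , eq) = trans (lookup∘tabulate _ m) (dec-true (step? m) (j , trans (cong (_mod n) (ℕ.*-comm (toℕ j) d)) eq))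

  coset⇒ : ∀ j q {l} → lookup (coset j q) l ≡ true → ∃[ i ] (j mod n) ⊕ q ⊙ i ≡ l
  coset⇒ j q {l} eq with does⇒ (any? {n = n} (λ i → ((j + toℕ i * q) mod n) Fin.≟ l)) (trans (sym (lookup∘tabulate _ l)) eq)
  ... | i , e = i , trans (mod-⊕ j (q * toℕ i)) (trans (cong (λ z → (j + z) mod n) (ℕ.*-comm q (toℕ i))) e)

  coset⇐ : ∀ j q {l} → ∃[ i ] (j mod n) ⊕ q ⊙ i ≡ l → lookup (coset j q) l ≡ true
  coset⇐ j q {l} (i , eq) = trans (lookup∘tabulate _ l) (dec-true (any? {n = n} (λ i → ((j + toℕ i * q) mod n) Fin.≟ l))
    (i , trans (cong (λ z → (j + z) mod n) (ℕ.*-comm (toℕ i) q)) (trans (sym (mod-⊕ j (q * toℕ i))) eq)))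

  record IsSubgroup (χ : Fin n → Bool) : Set where
    field
      has-e : χ e ≡ true
      has-⊕ : ∀ {k l} → χ k ≡ true → χ l ≡ true → χ (k ⊕ l) ≡ true
      has-⊖ : ∀ {k} → χ k ≡ true → χ (⊖ k) ≡ true

    symmetric : ∀ k → χ (⊖ k) ≡ χ k
    symmetric k = bool-ext (λ p → trans (cong χ (sym (⊖-involutive k))) (has-⊖ p)) has-⊖

    translate : ∀ {l} → χ l ≡ true → ∀ k → χ (k ⊕ (⊖ l)) ≡ χ k
    translate {l} χl k = bool-ext (λ p → trans (cong χ (sym (⊖-⊕-cancel k l))) (has-⊕ p χl)) (λ p → has-⊕ p (has-⊖ χl))

  cyc-subgroup : ∀ d → IsSubgroup (lookup (cyc d))
  cyc-subgroup d = record
    { has-e = cyc⇐ d (e , ⊙-e d)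
    ; has-⊕ = λ p q → let j , eq = cyc⇒ d p ; j′ , eq′ = cyc⇒ d q in cyc⇐ d (j ⊕ j′ , trans (⊙-⊕ d j j′) (cong₂ _⊕_ eq eq′))
    ; has-⊖ = λ p → let j , eq = cyc⇒ d p in cyc⇐ d (⊖ j , trans (⊙-⊖ d j) (cong ⊖_ eq)) }

  full-subgroup : IsSubgroup (λ _ → true)
  full-subgroup = record { has-e = refl ; has-⊕ = λ _ _ → refl ; has-⊖ = λ _ → refl }

  trivial-subgroup : IsSubgroup (λ k → does (e Fin.≟ k))
  trivial-subgroup = record
    { has-e = dec-true (e Fin.≟ e) refl
    ; has-⊕ = λ {k} {l} p q → dec-true (e Fin.≟ _) (trans
        (sym (⊕-identityˡ e)) (cong₂ _⊕_ (does⇒ (e Fin.≟ k) p) (does⇒ (e Fin.≟ l) q)))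
    ; has-⊖ = λ {k} p → dec-true (e Fin.≟ _) (trans (sym ⊖-e) (cong ⊖_ (does⇒ (e Fin.≟ k) p))) }

  private
    ∧-true : ∀ {a b} → a ∧ b ≡ true → a ≡ true × b ≡ true
    ∧-true {true} {true} _ = refl , refl

  intersection : ∀ {χ ψ} → IsSubgroup χ → IsSubgroup ψ → IsSubgroup (λ k → χ k ∧ ψ k)
  intersection S T = record
    { has-e = cong₂ _∧_ S.has-e T.has-e
    ; has-⊕ = λ p q → let p₁ , p₂ = ∧-true p ; q₁ , q₂ = ∧-true q in cong₂ _∧_ (S.has-⊕ p₁ q₁) (T.has-⊕ p₂ q₂)
    ; has-⊖ = λ p → let p₁ , p₂ = ∧-true p in cong₂ _∧_ (S.has-⊖ p₁) (T.has-⊖ p₂) }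
    where
    module S = IsSubgroup S
    module T = IsSubgroup T

  data Span : (Fin n → ℤ) → Set where
    subgroup : ∀ {χ f} → IsSubgroup χ → (∀ k → f k ≡ ind (χ k)) → Span f
    combine : ∀ {f g h} a → Span f → Span g → (∀ k → h k ≡ f k ℤ.+ a ℤ.* g k) → Span h

  -- Subgroups are closed under intersection, so the span of their indicators is closed under
  -- pointwise products; this is what lets the Boolean operations be written as polynomials in
  -- indicators.
  span-* : ∀ {f g} → Span f → Span g → Span (λ k → f k ℤ.* g k)
  span-* (subgroup {χ} S eq) (subgroup {ψ} T eq′) = subgroup (intersection S T) λ k →
    trans (cong₂ ℤ._*_ (eq k) (eq′ k)) (lem (χ k) (ψ k))
    where
    lem : ∀ a b → ind a ℤ.* ind b ≡ ind (a ∧ b)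
    lem true true = refl
    lem true false = refl
    lem false b = refl
  span-* {g = g} (combine {f₁} {f₂} a P Q eq) T = combine a (span-* P T) (span-* Q T) λ k →
    trans (cong (ℤ._* g k) (eq k)) (lem (f₁ k) a (f₂ k) (g k))
    where
    lem : ∀ u a v w → (u ℤ.+ a ℤ.* v) ℤ.* w ≡ u ℤ.* w ℤ.+ a ℤ.* (v ℤ.* w)
    lem = solve-∀
  span-* {f = f} S@(subgroup _ _) (combine {g₁} {g₂} a P Q eq) = combine a (span-* S P) (span-* S Q) λ k →
    trans (cong (f k ℤ.*_) (eq k)) (lem (f k) a (g₁ k) (g₂ k))
    where
    lem : ∀ w a u v → w ℤ.* (u ℤ.+ a ℤ.* v) ≡ w ℤ.* u ℤ.+ a ℤ.* (w ℤ.* v)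
    lem = solve-∀

  span-indicator : ∀ {S} → InB S → Span (indicator S)
  span-indicator (subgrp d) = subgroup (cyc-subgroup d) λ k → refl
  span-indicator (compl {s} p) = combine (- + 1) (subgroup full-subgroup (λ k → refl)) (span-indicator p) λ k →
    trans (cong ind (lookup-map k not s)) (lem (lookup s k))
    where
    lem : ∀ a → ind (not a) ≡ + 1 ℤ.+ - + 1 ℤ.* ind a
    lem true = refl
    lem false = refl
  -- Adding a zero multiple only serves to transport the product along a pointwise equality.
  span-indicator (inter {s} {t} p q) = combine (+ 0) (span-* (span-indicator p) (span-indicator q)) (span-indicator p) λ k →
    trans (cong ind (lookup-zipWith _∧_ k s t)) (lem (lookup s k) (lookup t k))
    where
    lem : ∀ a b → ind (a ∧ b) ≡ ind a ℤ.* ind b ℤ.+ + 0 ℤ.* ind a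
    lem true true = refl
    lem true false = refl
    lem false b = refl
  span-indicator (union {s} {t} p q) = combine (- + 1)
    (combine (+ 1) (span-indicator p) (span-indicator q) (λ k → refl)) (span-* (span-indicator p) (span-indicator q)) λ k →
    trans (cong ind (lookup-zipWith _∨_ k s t)) (lem (lookup s k) (lookup t k))
    where
    lem : ∀ a b → ind (a ∨ b) ≡ ind a ℤ.+ + 1 ℤ.* ind b ℤ.+ - + 1 ℤ.* (ind a ℤ.* ind b)
    lem true true = refl
    lem true false = refl
    lem false true = refl
    lem false false = refl

  -- Translation by a member permutes the subgroup, so all members l give the same inner sum and the
  -- outer sum merely counts them.
  convolve-subgroup : ∀ {χ} → IsSubgroup χ → ∀ φ x →
    convolve (ind ∘ χ) (convolve (ind ∘ χ) φ) x ≡ sumF (ind ∘ χ) ℤ.* convolve (ind ∘ χ) φ x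
  convolve-subgroup {χ} S φ (c , k) = begin
    sumF (λ l → κ l ℤ.* convolve κ φ (c , k ⊕ l)) ≡⟨ sumF-cong (λ l → term l (χ l) refl) ⟩
    sumF (λ l → convolve κ φ (c , k) ℤ.* κ l) ≡⟨ sumF-* (convolve κ φ (c , k)) κ ⟩
    convolve κ φ (c , k) ℤ.* sumF κ ≡⟨ ℤ.*-comm (convolve κ φ (c , k)) (sumF κ) ⟩
    sumF κ ℤ.* convolve κ φ (c , k) ∎
    where
    open ≡-Reasoning
    open IsSubgroup S
    κ : Fin n → ℤ
    κ = ind ∘ χ
    term : ∀ l b → χ l ≡ b → κ l ℤ.* convolve κ φ (c , k ⊕ l) ≡ convolve κ φ (c , k) ℤ.* κ l
    term l false χl = trans (cong (λ b → ind b ℤ.* convolve κ φ (c , k ⊕ l)) χl)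
        (sym (trans (cong (λ b → convolve κ φ (c , k) ℤ.* ind b) χl) (ℤ.*-zeroʳ (convolve κ φ (c , k)))))
    term l true χl = trans (ℤ.*-comm (κ l) _) (cong (ℤ._* κ l) (begin
      sumF (λ m → κ m ℤ.* φ (c , (k ⊕ l) ⊕ m)) ≡⟨ sumF-translate (λ m → κ m ℤ.* φ (c , (k ⊕ l) ⊕ m)) (⊖ l) ⟨
      sumF (λ m → κ (m ⊕ (⊖ l)) ℤ.* φ (c , (k ⊕ l) ⊕ (m ⊕ (⊖ l)))) ≡⟨ sumF-cong
          (λ m → cong₂ (λ b z → ind b ℤ.* φ (c , z)) (translate χl m) (shuffle m)) ⟩
      sumF (λ m → κ m ℤ.* φ (c , k ⊕ m)) ∎))
      where
      shuffle : ∀ m → (k ⊕ l) ⊕ (m ⊕ (⊖ l)) ≡ k ⊕ m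
      shuffle m = trans (⊕-assoc k l _) (cong (k ⊕_) (trans (⊕-comm l _) (⊖-⊕-cancel m l)))

  split-convolve : ∀ {f} → Span f → Split (convolve f)
  split-convolve (subgroup {χ} {f} S eq) = split-ext (convolve-linear (ind ∘ χ)) (convolve-cong (λ k → sym (eq k)))
    -- The roots 0 and c come from H² = c H, where c is the order of the subgroup H.
    (+ 0 ∷ c ∷ [] , λ φ x → vanish φ x)
    where
    κ = ind ∘ χ
    c = sumF κ
    open Linear (convolve-linear κ)
    vanish : ∀ φ x → convolve κ (λ y → convolve κ φ y ℤ.- c ℤ.* φ y) x ℤ.- + 0 ℤ.* (convolve κ φ x ℤ.- c ℤ.* φ x) ≡ + 0
    vanish φ x = begin
      convolve κ (λ y → convolve κ φ y ℤ.- c ℤ.* φ y) x ℤ.- + 0 ℤ.* (convolve κ φ x ℤ.- c ℤ.* φ x)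
        ≡⟨ cong (λ z → z ℤ.- + 0 ℤ.* (convolve κ φ x ℤ.- c ℤ.* φ x))
            (trans (ext (λ y → lem₁ (convolve κ φ y) c (φ y)) x) (linear (- c) (convolve κ φ) φ x)) ⟩
      convolve κ (convolve κ φ) x ℤ.+ - c ℤ.* convolve κ φ x ℤ.- + 0 ℤ.* (convolve κ φ x ℤ.- c ℤ.* φ x)
        ≡⟨ cong (λ z → z ℤ.+ - c ℤ.* convolve κ φ x ℤ.- + 0 ℤ.* (convolve κ φ x ℤ.- c ℤ.* φ x)) (convolve-subgroup S φ x) ⟩
      c ℤ.* convolve κ φ x ℤ.+ - c ℤ.* convolve κ φ x ℤ.- + 0 ℤ.* (convolve κ φ x ℤ.- c ℤ.* φ x) ≡⟨ lem₂ c (convolve κ φ x)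
          (φ x) ⟩
      + 0 ∎
      where
      open ≡-Reasoning
      lem₁ : ∀ u c v → u ℤ.- c ℤ.* v ≡ u ℤ.+ - c ℤ.* v
      lem₁ = solve-∀
      lem₂ : ∀ c u v → c ℤ.* u ℤ.+ - c ℤ.* u ℤ.- + 0 ℤ.* (u ℤ.- c ℤ.* v) ≡ + 0
      lem₂ = solve-∀
  split-convolve (combine {f} {g} {h} a P Q eq) = split-ext (O.act-linear expr) agree
    (O.splits⇒ {expr} (O.splits-⊕ (O.splits⇐ {O.gen f} (split-convolve P))
        (O.splits-scale a (O.splits⇐ {O.gen g} (split-convolve Q)))))
    where
    module O = ExactOperatorRing convolve convolve-linear convolve-comm
    expr = O.gen f O.⊹ O.con a O.⊛ O.gen g
    agree : ∀ φ x → convolve f φ x ℤ.+ a ℤ.* convolve g φ x ≡ convolve h φ x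
    agree φ (c , k) = sym (trans (sumF-cong λ l → trans (cong (ℤ._* φ (c , k ⊕ l)) (eq l))
        (lem (f l) a (g l) (φ (c , k ⊕ l))))
      (sumF-linear a (λ l → f l ℤ.* φ (c , k ⊕ l)) (λ l → g l ℤ.* φ (c , k ⊕ l))))
      where
      lem : ∀ u a v w → (u ℤ.+ a ℤ.* v) ℤ.* w ≡ u ℤ.* w ℤ.+ a ℤ.* (v ℤ.* w)
      lem = solve-∀

  -- (b a^x κ)² = κ² for symmetric κ, so the eigenvalues of b a^x κ are those of κ up to sign.
  split-translate : ∀ {κ} → Symmetric κ → Split (convolve κ) → ∀ x {g} → (∀ l → g l ≡ κ (l ⊕ (⊖ x))) → Split (reflected g)
  split-translate {κ} κ-sym sp x {g} g≡ = O.splits⇒ {O.gen false}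
      (O.splits-sqrt (O.exact square) (O.splits⇐ {O.gen true} sp))
    where
    op : Bool → Op D
    op true  = convolve κ
    op false = reflected g
    op-linear : ∀ b → Linear (op b)
    op-linear true = convolve-linear κ
    op-linear false = reflected-linear g
    op-comm : ∀ a b φ x → op a (op b φ) x ≡ op b (op a φ) x
    op-comm true true φ x = refl
    op-comm true false φ x = reflected-comm g κ-sym φ x
    op-comm false true φ x = sym (reflected-comm g κ-sym φ x)
    op-comm false false φ x = refl
    module O = ExactOperatorRing op op-linear op-comm
    square : ∀ φ y → reflected g (reflected g φ) y ≡ convolve κ (convolve κ φ) y
    square φ (c , k) = begin
      reflected g (reflected g φ) (c , k) ≡⟨ reflected-square g φ (c , k) ⟩
      sumF (λ l → g (⊖ l) ℤ.* convolve g φ (c , k ⊕ l)) ≡⟨ sumF-translate (λ l → g (⊖ l) ℤ.* convolve g φ (c , k ⊕ l))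
          (⊖ x) ⟨
      sumF (λ l → g (⊖ (l ⊕ (⊖ x))) ℤ.* convolve g φ (c , k ⊕ (l ⊕ (⊖ x)))) ≡⟨ sumF-cong
          (λ l → cong₂ ℤ._*_ (left l) (right l)) ⟩
      sumF (λ l → κ l ℤ.* convolve κ φ (c , k ⊕ l)) ∎
      where
      open ≡-Reasoning
      left : ∀ l → g (⊖ (l ⊕ (⊖ x))) ≡ κ l
      left l = trans (g≡ _) (trans (cong κ (trans (cong (_⊕ (⊖ x))
          (trans (sym (⊖-⊕-comm l (⊖ x))) (cong ((⊖ l) ⊕_) (⊖-involutive x))))
        (⊕-⊖-cancel (⊖ l) x))) (κ-sym l))
      right : ∀ l → convolve g φ (c , k ⊕ (l ⊕ (⊖ x))) ≡ convolve κ φ (c , k ⊕ l)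
      right l = trans (sym (sumF-translate (λ m → g m ℤ.* φ (c , (k ⊕ (l ⊕ (⊖ x))) ⊕ m)) x)) (sumF-cong λ m →
        cong₂ (λ u z → u ℤ.* φ (c , z)) (trans (g≡ (m ⊕ x)) (cong κ (⊕-⊖-cancel m x)))
          (trans (⊕-assoc k _ _) (trans (cong (k ⊕_) (trans (cong ((l ⊕ (⊖ x)) ⊕_) (⊕-comm m x))
              (trans (sym (⊕-assoc _ x m)) (cong (_⊕ m) (⊖-⊕-cancel l x))))) (sym (⊕-assoc k l m)))))

  symmetric-subgroup : ∀ {χ} → IsSubgroup χ → Symmetric (ind ∘ χ)
  symmetric-subgroup S k = cong ind (IsSubgroup.symmetric S k)

  -- Any member x can serve as base point. For a punctured coset the base point will be the missing
  -- element: the hole then sits at the identity, and what remains is symmetric, as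
  -- `split-translate` requires.
  coset-translate : ∀ j q {x} → lookup (coset j q) x ≡ true → ∀ l → lookup (coset j q) l ≡ lookup (cyc q) (l ⊕ (⊖ x))
  coset-translate j q {x} x∈ l = bool-ext
    (λ p → let i , eq = coset⇒ j q x∈ ; i′ , eq′ = coset⇒ j q p in
      cyc⇐ q (i′ ⊕ (⊖ i) , (begin
        q ⊙ (i′ ⊕ (⊖ i)) ≡⟨ trans (⊙-⊕ q i′ (⊖ i)) (cong (q ⊙ i′ ⊕_) (⊙-⊖ q i)) ⟩
        q ⊙ i′ ⊕ (⊖ (q ⊙ i)) ≡⟨ lem (j mod n) (q ⊙ i′) (q ⊙ i) ⟨
        ((j mod n) ⊕ q ⊙ i′) ⊕ (⊖ ((j mod n) ⊕ q ⊙ i)) ≡⟨ cong₂ (λ a b → a ⊕ (⊖ b)) eq′ eq ⟩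
        l ⊕ (⊖ x) ∎)))
    (λ p → let i , eq = coset⇒ j q x∈ ; i′ , eq′ = cyc⇒ q p in
      coset⇐ j q (i′ ⊕ i , (begin
        (j mod n) ⊕ q ⊙ (i′ ⊕ i) ≡⟨ cong ((j mod n) ⊕_) (trans (⊙-⊕ q i′ i) (⊕-comm (q ⊙ i′) (q ⊙ i))) ⟩
        (j mod n) ⊕ (q ⊙ i ⊕ q ⊙ i′) ≡⟨ ⊕-assoc _ _ _ ⟨
        ((j mod n) ⊕ q ⊙ i) ⊕ q ⊙ i′ ≡⟨ cong₂ _⊕_ eq eq′ ⟩
        x ⊕ (l ⊕ (⊖ x)) ≡⟨ trans (⊕-comm x _) (⊖-⊕-cancel l x) ⟩
        l ∎)))
    where
    open ≡-Reasoning
    lem : ∀ a b c → (a ⊕ b) ⊕ (⊖ (a ⊕ c)) ≡ b ⊕ (⊖ c)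
    lem a b c = trans (cong₂ _⊕_ (⊕-comm a b) (sym (⊖-⊕-comm a c))) (trans (⊕-assoc b a _)
      (cong (b ⊕_) (trans (sym (⊕-assoc a (⊖ a) (⊖ c))) (trans (cong (_⊕ (⊖ c)) (⊕-inverseʳ a)) (⊕-identityˡ (⊖ c))))))

  split-coset : ∀ j q → Split (reflected (indicator (coset j q)))
  split-coset j q = split-translate (symmetric-subgroup (cyc-subgroup q))
      (split-convolve (subgroup (cyc-subgroup q) λ _ → refl)) (j mod n)
    λ l → cong ind (coset-translate j q (coset⇐ j q (e , trans (cong ((j mod n) ⊕_) (⊙-e q)) (⊕-identityʳ _))) l)

  split-punctured-coset : ∀ j q {x} → lookup (coset j q) x ≡ true → Split (reflected (indicator (coset j q ∩ ∁ ⁅ x ⁆)))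
  split-punctured-coset j q {x} x∈ = split-translate {κ} κ-sym
    (split-convolve (combine (- + 1) (subgroup (cyc-subgroup q) λ _ → refl) (subgroup trivial-subgroup λ _ → refl) λ _ →
        refl)) x punctured
    where
    κ : Fin n → ℤ
    κ l = ind (lookup (cyc q) l) ℤ.+ - + 1 ℤ.* ind (does (e Fin.≟ l))
    κ-sym : Symmetric κ
    κ-sym k = cong₂ (λ u v → u ℤ.+ - + 1 ℤ.* v) (symmetric-subgroup (cyc-subgroup q) k)
        (symmetric-subgroup trivial-subgroup k)
    lem : ∀ a b → (b ≡ true → a ≡ true) → ind (a ∧ not b) ≡ ind a ℤ.+ - + 1 ℤ.* ind b
    lem true true _ = refl
    lem true false _ = refl
    lem false true f = contradiction (f refl) λ ()
    lem false false _ = refl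
    punctured : ∀ l → indicator (coset j q ∩ ∁ ⁅ x ⁆) l ≡ κ (l ⊕ (⊖ x))
    punctured l = trans (cong ind (trans (lookup-zipWith _∧_ l (coset j q) (∁ ⁅ x ⁆)) (cong (lookup (coset j q) l ∧_)
        (trans (lookup-map l not ⁅ x ⁆) (cong not (lookup-⁅⁆ x l))))))
      (trans (lem (lookup (coset j q) l) (does (x Fin.≟ l))
          (λ p → trans (cong (lookup (coset j q)) (sym (does⇒ (x Fin.≟ l) p))) x∈))
        (cong₂ (λ a b → ind a ℤ.+ - + 1 ℤ.* ind b) (coset-translate j q x∈ l)
          (bool-ext (λ p → dec-true (e Fin.≟ _) (sym (trans (cong (l ⊕_) (cong ⊖_ (does⇒ (x Fin.≟ l) p))) (⊕-inverseʳ l))))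
            (λ p → dec-true (x Fin.≟ l) (trans (sym (⊕-identityˡ x))
                (trans (cong (_⊕ x) (does⇒ (e Fin.≟ _) p)) (⊖-⊕-cancel l x)))))))

-- Lifting units to a larger modulus

prime-divisor-of-prime : ∀ {p d} → Prime p → d ∣ p → d ≢ 1 → d ≡ p
prime-divisor-of-prime pp d∣p d≢1 with prime⇒irreducible pp d∣p
... | inj₁ d≡1 = contradiction d≡1 d≢1
... | inj₂ d≡p = d≡p

prime≢1 : ∀ {p} → Prime p → p ≢ 1
prime≢1 pp refl = contradiction (ℕ.nonTrivial⇒n>1 1 {{prime⇒nonTrivial pp}}) λ { (s≤s ()) }

prime∤⇒coprime : ∀ {p a} → Prime p → ¬ p ∣ a → Coprime a p
prime∤⇒coprime pp p∤a {d} (d∣a , d∣p) with prime⇒irreducible pp d∣p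
... | inj₁ d≡1 = d≡1
... | inj₂ refl = contradiction d∣a p∤a

coprime-* : ∀ {a b c} → Coprime a b → Coprime a c → Coprime a (b * c)
coprime-* cb cc (d∣a , d∣bc) = cc (d∣a , coprime-divisor (λ { (e∣d , e∣b) → cb (∣-trans e∣d d∣a , e∣b) }) d∣bc)

-- The primes are treated one at a time. If the new prime p divides x + N k, adding N times the
-- product of the earlier primes keeps coprimality to those and destroys divisibility by p: p does
-- not divide N, since x is coprime to N, nor that product, since x + N k is coprime to it.
coprime-+-*product : ∀ N ps → All Prime ps → ∀ x → Coprime x N → ∃[ k ] Coprime (x + N * k) (product ps)
coprime-+-*product N [] [] x cop = 0 , λ { (_ , d∣1) → ∣1⇒≡1 d∣1 }
coprime-+-*product N (p ∷ ps) (pp ∷ pps) x cop with coprime-+-*product N ps pps x cop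
... | k , ih with p ∣? (x + N * k)
...   | no p∤ = k , coprime-* (prime∤⇒coprime pp p∤) ih
...   | yes p∣ = k + product ps , subst (λ z → Coprime z (p * product ps)) (lem x N k (product ps))
          (coprime-* (prime∤⇒coprime pp p∤′) (λ { {d} (d∣ , d∣M) →
              ih (∣m+n∣m⇒∣n (subst (d ∣_) (ℕ.+-comm (x + N * k) (N * product ps)) d∣) (∣n⇒∣m*n N d∣M) , d∣M) }))
  where
  lem : ∀ x N k M → x + N * k + N * M ≡ x + N * (k + M)
  lem = solveℕ-∀
  p∤N : ¬ p ∣ N
  p∤N p∣N = prime≢1 pp (cop (∣m+n∣m⇒∣n (subst (p ∣_) (ℕ.+-comm x (N * k)) p∣) (∣m⇒∣m*n k p∣N) , p∣N))
  p∤′ : ¬ p ∣ x + N * k + N * product ps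
  p∤′ p∣′ = [ p∤N , (λ p∣M → prime≢1 pp (ih (p∣ , p∣M))) ]′ (euclidsLemma N (product ps) pp (∣m+n∣m⇒∣n p∣′ p∣))

unit-lift : ∀ N M .{{_ : NonZero M}} x → Coprime x N → ∃[ k ] Coprime (x + N * k) M
unit-lift N M x cop with factorise M
... | record { factors = ps ; isFactorisation = refl ; factorsPrime = pps } = coprime-+-*product N ps pps x cop

-- Atoms, and sets closed under units

module Atoms (n : ℕ) .{{nz : NonZero n}} where

  open Dihedral n
  open CyclicGroup n
  open CyclicGroupOperators n
  open BooleanAlgebra n

  private
    empty : ∃[ U ] InB U × (∀ k → lookup U k ≢ true)
    empty = _ , inter (subgrp 1) (compl (subgrp 1)) , λ k eq → lem (lookup (cyc 1) k) (trans (sym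
      (trans (lookup-zipWith _∧_ k (cyc 1) (∁ (cyc 1))) (cong (lookup (cyc 1) k ∧_) (lookup-map k not (cyc 1))))) eq)
      where
      lem : ∀ b → b ∧ not b ≢ true
      lem true ()
      lem false ()

  bigUnion : ∀ {m} (F : Fin m → Subset n) → (∀ i → InB (F i)) →
    ∃[ U ] InB U × (∀ k → lookup U k ≡ true → ∃[ i ] lookup (F i) k ≡ true) ×
        (∀ k i → lookup (F i) k ≡ true → lookup U k ≡ true)
  bigUnion {zero} F b = proj₁ empty , proj₁ (proj₂ empty) , (λ k eq → contradiction eq (proj₂ (proj₂ empty) k)) , λ k ()
  bigUnion {suc m} F b with bigUnion (F ∘ suc) (b ∘ suc)
  ... | U , bU , f , g = F zero ∪ U , union (b zero) bU ,
    (λ k eq → choose k (lookup (F zero) k) refl (trans (sym (lookup-zipWith _∨_ k (F zero) U)) eq)) ,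
    λ { k zero eq → trans (lookup-zipWith _∨_ k (F zero) U) (cong (_∨ lookup U k) eq)
      ; k (suc i) eq → trans (lookup-zipWith _∨_ k (F zero) U)
          (trans (cong (lookup (F zero) k ∨_) (g k i eq)) (∨-true (lookup (F zero) k))) }
    where
    ∨-true : ∀ b → b ∨ true ≡ true
    ∨-true true = refl
    ∨-true false = refl
    choose : ∀ k b → lookup (F zero) k ≡ b → lookup (F zero) k ∨ lookup U k ≡ true → ∃[ i ] lookup (F i) k ≡ true
    choose k true eq _ = zero , eq
    choose k false eq u = let i , p = f k (trans (cong (_∨ lookup U k) (sym eq)) u) in suc i , p

  private
    guarded : Bool → Subset n → Subset n
    guarded b S = if b then S else proj₁ empty

    guarded-InB : ∀ b {S} → InB S → InB (guarded b S)
    guarded-InB true p = p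
    guarded-InB false p = proj₁ (proj₂ empty)

    guarded⇒ : ∀ b {S k} → lookup (guarded b S) k ≡ true → b ≡ true × lookup S k ≡ true
    guarded⇒ true eq = refl , eq
    guarded⇒ false {k = k} eq = contradiction eq (proj₂ (proj₂ empty) k)

    guarded⇐ : ∀ {b S k} → b ≡ true → lookup S k ≡ true → lookup (guarded b S) k ≡ true
    guarded⇐ refl eq = eq

    excluded : Fin n → Fin n → Subset n
    excluded m k = guarded (not (lookup (cyc (toℕ k)) m)) (cyc (toℕ k))

    excluded-InB : ∀ m k → InB (excluded m k)
    excluded-InB m k = guarded-InB (not (lookup (cyc (toℕ k)) m)) (subgrp (toℕ k))

    ∈cyc-self : ∀ l → lookup (cyc (toℕ l)) l ≡ true
    ∈cyc-self l = cyc⇐ (toℕ l) (1 mod n , trans (⊙-mod (toℕ l) 1)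
        (trans (cong (_mod n) (ℕ.*-identityʳ (toℕ l))) (mod-toℕ l)))

  -- An element of ⟨a^m⟩ generates it exactly when it lies in no cyclic subgroup that misses a^m.
  -- Written this way, the atom is visibly in the Boolean algebra.
  atom : Fin n → Subset n
  atom m = cyc (toℕ m) ∩ ∁ (proj₁ (bigUnion (excluded m) (excluded-InB m)))

  atom-InB : ∀ m → InB (atom m)
  atom-InB m = inter (subgrp (toℕ m)) (compl (proj₁ (proj₂ (bigUnion (excluded m) (excluded-InB m)))))

  private
    atom-lookup : ∀ m l → lookup (atom m) l ≡ lookup (cyc (toℕ m)) l ∧ not
        (lookup (proj₁ (bigUnion (excluded m) (excluded-InB m))) l)
    atom-lookup m l = trans (lookup-zipWith _∧_ l (cyc (toℕ m)) _)
        (cong (lookup (cyc (toℕ m)) l ∧_) (lookup-map l not (proj₁ (bigUnion (excluded m) (excluded-InB m)))))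

    split-∧ : ∀ a b → a ∧ not b ≡ true → a ≡ true × b ≢ true
    split-∧ true false _ = refl , λ ()

    join-∧ : ∀ {a b} → a ≡ true → b ≢ true → a ∧ not b ≡ true
    join-∧ {b = true} refl b≢ = contradiction refl b≢
    join-∧ {b = false} refl b≢ = refl

  atom⇒ : ∀ {m l} → lookup (atom m) l ≡ true → lookup (cyc (toℕ m)) l ≡ true × lookup (cyc (toℕ l)) m ≡ true
  atom⇒ {m} {l} eq = let a , b = split-∧ (lookup (cyc (toℕ m)) l) (lookup U l) (trans (sym (atom-lookup m l)) eq) in
      a , recover (lookup (cyc (toℕ l)) m) refl b
    where
    U : Subset n
    U = proj₁ (bigUnion (excluded m) (excluded-InB m))
    recover : ∀ c → lookup (cyc (toℕ l)) m ≡ c → lookup U l ≢ true → c ≡ true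
    recover true _ _ = refl
    -- If ⟨a^l⟩ misses a^m, it is itself one of the excluded subgroups, and it contains a^l.
    recover false eq ne = contradiction (proj₂ (proj₂ (proj₂ (bigUnion (excluded m) (excluded-InB m)))) l l
      (guarded⇐ {not (lookup (cyc (toℕ l)) m)} {cyc (toℕ l)} (cong not eq) (∈cyc-self l))) ne

  atom-self : ∀ m → lookup (atom m) m ≡ true
  atom-self m = trans (atom-lookup m m) (join-∧ (∈cyc-self m) λ eq →
    let k , p = proj₁ (proj₂ (proj₂ (bigUnion (excluded m) (excluded-InB m)))) m eq
        a , b = guarded⇒ (not (lookup (cyc (toℕ k)) m)) {cyc (toℕ k)} p
    in not-both (lookup (cyc (toℕ k)) m) a b)
    where
    not-both : ∀ c → not c ≡ true → c ≡ true → ⊥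
    not-both true () _
    not-both false _ ()

  atomic⇒InB : ∀ S → (∀ {m l} → lookup S m ≡ true → lookup (cyc (toℕ m)) l ≡ true → lookup (cyc (toℕ l)) m ≡ true →
      lookup S l ≡ true) → InB S
  atomic⇒InB S closed = subst InB U≡S (proj₁ (proj₂ big))
    where
    F : Fin n → Subset n
    F m = guarded (lookup S m) (atom m)
    big : ∃[ U ] InB U × (∀ k → lookup U k ≡ true → ∃[ i ] lookup (F i) k ≡ true) ×
        (∀ k i → lookup (F i) k ≡ true → lookup U k ≡ true)
    big = bigUnion F (λ m → guarded-InB (lookup S m) (atom-InB m))
    agree : ∀ k → lookup (proj₁ big) k ≡ lookup S k
    agree k = bool-ext
      (λ eq → let m , p = proj₁ (proj₂ (proj₂ big)) k eq
                  a , b = guarded⇒ (lookup S m) {atom m} p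
                  c , d = atom⇒ b
              in closed a c d)
      (λ eq → proj₂ (proj₂ (proj₂ big)) k k (guarded⇐ {lookup S k} {atom k} eq (atom-self k)))
    U≡S : proj₁ big ≡ S
    U≡S = trans (sym (tabulate∘lookup (proj₁ big))) (trans (tabulate-cong agree) (tabulate∘lookup S))

  -- l = x m with x a unit modulo the order of m, and x lifts to a unit modulo 2n.
  unit-multiple : ∀ {m l} → lookup (cyc (toℕ m)) l ≡ true → lookup (cyc (toℕ l)) m ≡ true →
      ∃[ u ] Coprime u (2 * n) × u ⊙ m ≡ l
  unit-multiple {m} {l} l∈ m∈ with cyc⇒ (toℕ m) l∈ | cyc⇒ (toℕ l) m∈
  ... | i , mi≡l | j , lj≡m = x + N * k , cop , mod-eq
    where
    g = gcd (toℕ m) n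
    x = toℕ i
    y = toℕ j
    g∣m = gcd[m,n]∣m (toℕ m) n
    g∣n = gcd[m,n]∣n (toℕ m) n
    m′ = quotient g∣m
    N = quotient g∣n
    xm≡l : x ⊙ m ≡ l
    xm≡l = trans (cong (_mod n) (ℕ.*-comm x (toℕ m))) mi≡l
    yl≡m : y ⊙ l ≡ m
    yl≡m = trans (cong (_mod n) (ℕ.*-comm y (toℕ l))) lj≡m
    yxm≡m : (y * x) ⊙ m ≡ m
    yxm≡m = trans (sym (⊙-assoc y x m)) (trans (cong (y ⊙_) xm≡l) yl≡m)
    g≢0 : NonZero g
    g≢0 = ℕ.≢-nonZero (gcd[m,n]≢0 (toℕ m) n (inj₂ (ℕ.≢-nonZero⁻¹ n)))
    c = ((y * x) * toℕ m) / n
    yxm : (y * x) * toℕ m ≡ toℕ m + c * n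
    yxm = trans (m≡m%n+[m/n]*n ((y * x) * toℕ m) n) (cong (_+ c * n) (trans (sym (toℕ-mod _)) (cong toℕ yxm≡m)))
    m≡ : toℕ m ≡ m′ * g
    m≡ = m∣n⇒n≡quotient*m g∣m
    n≡ : n ≡ N * g
    n≡ = m∣n⇒n≡quotient*m g∣n
    lem₁ : ∀ y x m g → y * x * m * g ≡ y * x * (m * g)
    lem₁ = solveℕ-∀
    lem₂ : ∀ m c N g → m * g + c * (N * g) ≡ (c * N + m) * g
    lem₂ = solveℕ-∀
    reduced : y * x * m′ ≡ c * N + m′
    reduced = ℕ.*-cancelʳ-≡ (y * x * m′) (c * N + m′) g {{g≢0}}
        (trans (lem₁ y x m′ g) (trans (cong (λ z → (y * x) * z) (sym m≡))
      (trans yxm (trans (cong₂ (λ a b → a + c * b) m≡ n≡) (lem₂ m′ c N g)))))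
    -- A common divisor d of x and N divides m′ by `reduced`, so d g divides both m and n, hence
    -- their gcd g, and d = 1.
    x-cop : Coprime x N
    x-cop {d} (d∣x , d∣N) = ∣1⇒≡1 (*-cancelʳ-∣ g {{g≢0}} (subst (d * g ∣_) (sym (ℕ.*-identityˡ g))
      (gcd-greatest (subst (d * g ∣_) (sym m≡) (*-monoˡ-∣ g d∣m′)) (subst (d * g ∣_) (sym n≡) (*-monoˡ-∣ g d∣N)))))
      where
      d∣m′ : d ∣ m′
      d∣m′ = ∣m+n∣m⇒∣n (subst (d ∣_) reduced (∣m⇒∣m*n m′ (∣n⇒∣m*n y d∣x))) (∣n⇒∣m*n c d∣N)
    instance 2n≢0 = ℕ.m*n≢0 2 n
    lifted = unit-lift N (2 * n) x x-cop
    k = proj₁ lifted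
    cop : Coprime (x + N * k) (2 * n)
    cop = proj₂ lifted
    lem₃ : ∀ x N k m g → (x + N * k) * (m * g) ≡ x * (m * g) + (k * m) * (N * g)
    lem₃ = solveℕ-∀
    mod-eq : (x + N * k) ⊙ m ≡ l
    mod-eq = trans (cong (λ z → ((x + N * k) * z) mod n) m≡)
        (trans (cong (_mod n) (trans (lem₃ x N k m′ g) (cong (λ z → x * (m′ * g) + (k * m′) * z) (sym n≡))))
      (trans (mod-cong ([m+kn]%n≡m%n (x * (m′ * g)) (k * m′) n)) (trans (cong (λ z → (x * z) mod n) (sym m≡)) xm≡l)))

  module _ (S : Subset n) (closed : ∀ p → Prime p → 3 ≤ p → Coprime p n → ∀ l → l ∈ S → p ⊙ l ∈ S) where

    private
      -- Coprimality to 2n makes every prime factor odd and coprime to n, so the closure hypothesis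
      -- applies factor by factor.
      unit-closed : ∀ ps → All Prime ps → Coprime (product ps) (2 * n) → ∀ l → l ∈ S → product ps ⊙ l ∈ S
      unit-closed [] [] _ l l∈S = subst (_∈ S) (sym (⊙-identity l)) l∈S
      unit-closed (p ∷ ps) (pp ∷ pps) cop l l∈S = subst (_∈ S) (⊙-assoc p (product ps) l)
        (closed p pp 3≤p (λ { (d∣p , d∣n) → cop (∣m⇒∣m*n (product ps) d∣p , ∣n⇒∣m*n 2 d∣n) }) (product ps ⊙ l)
          (unit-closed ps pps (λ { (d∣ , d∣2n) → cop (∣n⇒∣m*n p d∣ , d∣2n) }) l l∈S))
        where
        p≢2 : 2 ≢ p
        p≢2 refl = contradiction (cop (m∣m*n {2} (product ps) , m∣m*n {2} n)) λ ()
        3≤p : 3 ≤ p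
        3≤p = ℕ.≤∧≢⇒< (ℕ.nonTrivial⇒n>1 p {{prime⇒nonTrivial pp}}) p≢2

    multiplier-closed⇒InB : InB S
    multiplier-closed⇒InB = atomic⇒InB S λ {m} {l} Sm l∈ m∈ →
      let u , cop , um≡l = unit-multiple l∈ m∈ in
      []=⇒lookup (subst (_∈ S) um≡l (by-units u cop m (lookup⇒[]= m S Sm)))
      where
      by-units : ∀ u → Coprime u (2 * n) → ∀ l → l ∈ S → u ⊙ l ∈ S
      -- Zero is coprime to 2n only if 2n = 1, which parity forbids.
      by-units zero cop = contradiction (cop {2 * n} (divides 0 refl , ∣-refl)) (λ eq → even≢1 n eq)
        where
        even≢1 : ∀ n → 2 * n ≢ 1
        even≢1 (suc zero) ()
        even≢1 (suc (suc n)) ()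
      by-units u@(suc _) cop with factorise u
      ... | record { factors = ps ; isFactorisation = eq ; factorsPrime = pps } =
        subst (λ u → ∀ l → l ∈ S → u ⊙ l ∈ S) (sym eq) (unit-closed ps pps (subst (λ u → Coprime u (2 * n)) eq cop))

-- Counting and elementary arithmetic

count : ∀ {m} → (Fin m → Bool) → ℕ
count P = sumFℕ (λ i → if P i then 1 else 0)

sumFℕ-cong : ∀ {m} {f g : Fin m → ℕ} → (∀ i → f i ≡ g i) → sumFℕ f ≡ sumFℕ g
sumFℕ-cong {zero} eq = refl
sumFℕ-cong {suc m} eq = cong₂ _+_ (eq zero) (sumFℕ-cong (eq ∘ suc))

count-cong : ∀ {m} {P Q : Fin m → Bool} → (∀ i → P i ≡ Q i) → count P ≡ count Q
count-cong eq = sumFℕ-cong λ i → cong (if_then 1 else 0) (eq i)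

remove : ∀ {m} → (Fin m → Bool) → Fin m → Fin m → Bool
remove Q x y = Q y ∧ not (does (x Fin.≟ y))

count-remove : ∀ {m} (Q : Fin m → Bool) x → Q x ≡ true → count Q ≡ suc (count (remove Q x))
count-remove Q zero eq = cong₂ _+_
  (cong (if_then 1 else 0) eq)
  (trans (count-cong (λ i → sym (∧-true (Q (suc i)))))
      (cong (_+ count (remove Q zero ∘ suc)) (cong (if_then 1 else 0) (sym (∧-false (Q zero))))))
  where
  ∧-true : ∀ b → b ∧ true ≡ b
  ∧-true true = refl
  ∧-true false = refl
  ∧-false : ∀ b → b ∧ false ≡ false
  ∧-false true = refl
  ∧-false false = refl
count-remove Q (suc x) eq = trans (cong₂ _+_ (cong (if_then 1 else 0) (sym (∧-true (Q zero))))
    (count-remove (Q ∘ suc) x eq)) (ℕ.+-suc _ _)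
  where
  ∧-true : ∀ b → b ∧ true ≡ b
  ∧-true true = refl
  ∧-true false = refl

-- Pigeonhole by removing the image of the first member. The map is defined on members only, so that
-- its values can be chosen from proofs of membership.
count-injection : ∀ {a b} (P : Fin a → Bool) (Q : Fin b → Bool) (f : ∀ i → P i ≡ true → Fin b) →
  (∀ i p → Q (f i p) ≡ true) → (∀ i j p q → f i p ≡ f j q → i ≡ j) → count P ≤ count Q
count-injection {zero} P Q f hit inj = z≤n
count-injection {suc a} P Q f hit inj with P zero in eq
... | false = count-injection (P ∘ suc) Q (f ∘ suc) (hit ∘ suc)
    (λ i j p q e → Fin.suc-injective (inj (suc i) (suc j) p q e))
... | true = subst (suc (count (P ∘ suc)) ≤_) (sym (count-remove Q x (hit zero eq))) (s≤s
    (count-injection (P ∘ suc) (remove Q x) (f ∘ suc)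
      (λ i p → cong₂ (λ a b → a ∧ not b) (hit (suc i) p) (dec-false (x Fin.≟ f (suc i) p)
          (λ e → contradiction (inj zero (suc i) eq p e) λ ())))
      (λ i j p q e → Fin.suc-injective (inj (suc i) (suc j) p q e))))
  where
  x = f zero eq

count-⊆ : ∀ {m} {P Q : Fin m → Bool} → (∀ i → P i ≡ true → Q i ≡ true) → count P ≤ count Q
count-⊆ sub = count-injection _ _ (λ i _ → i) sub (λ _ _ _ _ e → e)

count-complement : ∀ {m} (P : Fin m → Bool) → count P + count (not ∘ P) ≡ m
count-complement {zero} P = refl
count-complement {suc m} P with P zero
... | true = cong suc (count-complement (P ∘ suc))
... | false = trans (ℕ.+-suc _ _) (cong suc (count-complement (P ∘ suc)))

count-true : ∀ m → count {m} (λ _ → true) ≡ m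
count-true zero = refl
count-true (suc m) = cong suc (count-true m)

card≡count : ∀ {m} (S : Subset m) → card S ≡ count (lookup S)
card≡count [] = refl
card≡count (true ∷ S) = cong suc (card≡count S)
card≡count (false ∷ S) = card≡count S

sumFℕ-positive : ∀ {m} (f : Fin m → ℕ) → 1 ≤ sumFℕ f → ∃[ i ] 1 ≤ f i
sumFℕ-positive {suc m} f pos with f zero in eq
... | suc x = zero , subst (1 ≤_) (sym eq) (s≤s z≤n)
... | zero = let i , p = sumFℕ-positive (f ∘ suc) pos in suc i , p

prime-factor : ∀ c → .{{NonZero c}} → c ≢ 1 → ∃[ p ] Prime p × p ∣ c
prime-factor c c≢1 with factorise c
... | record { factors = [] ; isFactorisation = eq } = contradiction eq c≢1
... | record { factors = p ∷ ps ; isFactorisation = eq ; factorsPrime = pp ∷ _ } = p , pp ,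
    subst (p ∣_) (sym eq) (m∣m*n (product ps))

prime-not-square : ∀ {p} → Prime p → ∀ r → r * r ≢ p
prime-not-square {p} pp r eq with prime⇒irreducible pp (divides r (sym eq))
... | inj₁ refl = prime≢1 pp (sym eq)
... | inj₂ refl = prime≢1 pp (ℕ.*-cancelˡ-≡ r 1 r {{prime⇒nonZero pp}} (trans eq (sym (ℕ.*-identityʳ r))))

odd-primes-not-adjacent : ∀ {p q} → Prime p → Prime q → 3 ≤ p → 3 ≤ q → suc p ≢ q
odd-primes-not-adjacent {p} {q} pp pq 3≤p 3≤q eq = [ (λ 2∣p → even-prime pp 3≤p 2∣p) ,
    (λ 2∣q → even-prime pq 3≤q (subst (2 ∣_) eq 2∣q)) ]′ (parity p)
  where
  even-prime : ∀ {p} → Prime p → 3 ≤ p → ¬ 2 ∣ p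
  even-prime pp 3≤p 2∣p with prime⇒irreducible pp 2∣p
  ... | inj₂ refl = contradiction 3≤p λ { (s≤s (s≤s ())) }
  parity : ∀ m → 2 ∣ m ⊎ 2 ∣ suc m
  parity zero = inj₁ (divides 0 refl)
  parity (suc m) with parity m
  ... | inj₁ (divides c e) = inj₂ (divides (suc c) (cong (λ z → suc (suc z)) e))
  ... | inj₂ d = inj₁ d

-- With t = r + s the equation reads s (2 r + s) = m q, and q divides neither factor unless t ≥ q - 1.
nearly-full : ∀ {q t m r} → Prime q → 1 ≤ m → t ≤ q → t ≡ m + r * r → t * t + m ≡ t + m * q → q ≤ suc t
nearly-full {q} {t} {m} {r} pq 1≤m t≤q t≡ t²≡ = go (ℕ.m≤n⇒∃[o]m+o≡n (ℕ.<⇒≤ r<t))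
  where
  r≤r² : ∀ r → r ≤ r * r
  r≤r² zero = z≤n
  r≤r² (suc r) = ℕ.m≤m*n (suc r) (suc r)
  r<t : r < t
  r<t = subst (r <_) (sym t≡) (ℕ.≤-trans (s≤s (r≤r² r)) (ℕ.+-monoˡ-≤ (r * r) 1≤m))
  t²≡′ : t * t ≡ r * r + m * q
  t²≡′ = ℕ.+-cancelʳ-≡ m (t * t) (r * r + m * q) (trans t²≡ (trans (cong (_+ m * q) t≡) (lem m (r * r) (m * q))))
    where
    lem : ∀ a b c → a + b + c ≡ b + c + a
    lem = solveℕ-∀
  go : ∃[ s ] r + s ≡ t → q ≤ suc t
  go (s , r+s≡t) = [ (λ q∣s → ℕ.≤-trans (∣⇒≤ {{s≢0}} q∣s) (ℕ.≤-trans s≤t (ℕ.n≤1+n t))) ,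
      second ]′ (euclidsLemma s (r + t) pq (divides m s[r+t]≡))
    where
    s≢0 : NonZero s
    s≢0 = ℕ.≢-nonZero λ { refl → ℕ.<-irrefl (trans (sym (ℕ.+-identityʳ r)) r+s≡t) r<t }
    s≤t : s ≤ t
    s≤t = subst (s ≤_) r+s≡t (ℕ.m≤n+m s r)
    s[r+t]≡ : s * (r + t) ≡ m * q
    s[r+t]≡ = ℕ.+-cancelˡ-≡ (r * r) _ _ (trans (trans (cong (λ t → r * r + s * (r + t)) (sym r+s≡t)) (lem r s))
        (trans (cong₂ _*_ r+s≡t r+s≡t) t²≡′))
      where
      lem : ∀ r s → r * r + s * (r + (r + s)) ≡ (r + s) * (r + s)
      lem = solveℕ-∀
    small : ∀ r → r * r ≡ r → r ≤ 1
    small zero _ = z≤n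
    small (suc r) eq = ℕ.≤-reflexive (ℕ.*-cancelˡ-≡ (suc r) 1 (suc r) (trans eq (sym (ℕ.*-identityʳ (suc r)))))
    second : q ∣ r + t → q ≤ suc t
    second (divides zero e) = contradiction (ℕ.≤-trans (ℕ.≤-trans r<t (ℕ.m≤n+m t r)) (ℕ.≤-reflexive e)) λ ()
    -- Here r + t = q, so s = m; comparing t = r + s with t = m + r² gives r² = r, hence r is at
    -- most 1.
    second (divides (suc zero) e) = subst (_≤ suc t) (trans e (ℕ.+-identityʳ q)) (ℕ.+-monoˡ-≤ t (small r r²≡r))
      where
      s≡m : s ≡ m
      s≡m = ℕ.*-cancelʳ-≡ s m q {{prime⇒nonZero pq}} (trans (cong (s *_) (trans (sym (ℕ.+-identityʳ q)) (sym e))) s[r+t]≡)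
      r²≡r : r * r ≡ r
      r²≡r = ℕ.+-cancelˡ-≡ m _ _ (trans (sym t≡) (trans (sym r+s≡t) (trans (ℕ.+-comm r s) (cong (_+ r) s≡m))))
    second (divides (suc (suc c)) e) = contradiction
      (ℕ.≤-trans (ℕ.+-mono-≤ (ℕ.≤-refl {q}) (ℕ.m≤m+n q (c * q))) (ℕ.≤-reflexive (sym e)))
      (ℕ.<⇒≱ (ℕ.+-mono-<-≤ (ℕ.≤-trans r<t t≤q) t≤q))

lookup-injective : ∀ {m} (S T : Subset m) → (∀ k → lookup S k ≡ lookup T k) → S ≡ T
lookup-injective S T eq = trans (sym (tabulate∘lookup S)) (trans (tabulate-cong eq) (tabulate∘lookup T))

%-cancel : ∀ D .{{_ : NonZero D}} w a → (w + a) % D ≡ a % D → D ∣ w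
%-cancel D w a eq = ∣m+n∣m⇒∣n (divides ((w + a) / D) (trans (ℕ.+-comm (a / D * D) w) w+)) (divides (a / D) refl)
  where
  lem : ∀ r w c → r + (w + c) ≡ w + (r + c)
  lem = solveℕ-∀
  w+ : w + a / D * D ≡ (w + a) / D * D
  w+ = ℕ.+-cancelˡ-≡ (a % D) _ _ (trans (lem (a % D) w (a / D * D)) (trans (cong (λ z → w + z) (sym (m≡m%n+[m/n]*n a D)))
    (trans (m≡m%n+[m/n]*n (w + a) D) (cong (_+ (w + a) / D * D) eq))))

-- The residue modulo p d consists of the residue modulo d and of the next digit, the quotient by d
-- taken modulo p.
%-product : ∀ p d .{{_ : NonZero p}} .{{_ : NonZero d}} .{{_ : NonZero (p * d)}} {k l} →
  k % d ≡ l % d → (k / d) % p ≡ (l / d) % p → k % (p * d) ≡ l % (p * d)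
%-product p d {k} {l} e₁ e₂ = trans (expand k) (trans (cong₂ (λ a b → (a + b * d) % (p * d)) e₁ e₂) (sym (expand l)))
  where
  lem : ∀ r s c p d → r + (s + c * p) * d ≡ r + s * d + c * (p * d)
  lem = solveℕ-∀
  expand : ∀ k → k % (p * d) ≡ (k % d + (k / d) % p * d) % (p * d)
  expand k = trans (cong (_% (p * d)) (trans (m≡m%n+[m/n]*n k d)
      (trans (cong (λ z → k % d + z * d) (m≡m%n+[m/n]*n (k / d) p))
    (lem (k % d) ((k / d) % p) (k / d / p) p d)))) ([m+kn]%n≡m%n (k % d + (k / d) % p * d) (k / d / p) (p * d))

multiple<⇒0 : ∀ {n x} → n ∣ x → x < n → x ≡ 0
multiple<⇒0 {x = zero} _ _ = refl
multiple<⇒0 {x = suc x} n∣x x<n = contradiction (∣⇒≤ n∣x) (ℕ.<⇒≱ x<n)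

-- Differences of elements of a 2-integral set

module TwoIntegralSets (n : ℕ) .{{nz : NonZero n}} (S : Subset n)
  (d m₂ : ℕ) (d∣n : d ∣ n) (d≢n : d ≢ n) (1≤m₂ : 1 ≤ m₂)
  (mult≡ : ∀ m → Dihedral.mult n S m ≡ (if does (m Fin.≟ Dihedral.e n) then card S else 0) + (if Dihedral.inAtom? n d m then m₂ else 0)) where

  open Dihedral n
  open CyclicGroup n
  open CyclicGroupOperators n
  open BooleanAlgebra n

  private
    t : ℕ
    t = card S

    instance
      d-nz : NonZero d
      d-nz = ℕ.≢-nonZero λ { refl → ℕ.≢-nonZero⁻¹ n (0∣⇒≡0 d∣n) }

    d<n : d < n
    d<n = ℕ.≤∧≢⇒< (∣⇒≤ d∣n) d≢n

    pd∤d : ∀ {p} → Prime p → ¬ p * d ∣ d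
    pd∤d {p} pp pd∣d = contradiction (∣⇒≤ pd∣d) (ℕ.<⇒≱ (subst (_< p * d) (ℕ.*-identityˡ d)
        (ℕ.*-monoˡ-< d (ℕ.nonTrivial⇒n>1 p {{prime⇒nonTrivial pp}}))))

  -- The condition gcd(x, n) = d, tested prime by prime so that it can be checked on residues modulo
  -- d and modulo the multiples p d that divide n.
  Atomic : Fin n → Set
  Atomic x = d ∣ toℕ x × (∀ p → Prime p → p * d ∣ n → ¬ p * d ∣ toℕ x)

  private
    atom? : (x : Fin n) → Dec (cyc (toℕ x) ≡ cyc d)
    atom? x = ≡-dec Bool._≟_ (cyc (toℕ x)) (cyc d)

    ∣mod : ∀ {D a} → D ∣ n → D ∣ a → D ∣ toℕ (a mod n)
    ∣mod {D} {a} D∣n D∣a = subst (D ∣_) (sym (toℕ-mod a)) (%-presˡ-∣ D∣a D∣n)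

    ∣mod⁻¹ : ∀ {D a} → D ∣ n → D ∣ toℕ (a mod n) → D ∣ a
    ∣mod⁻¹ {D} {a} D∣n D∣ = ∣n∣m%n⇒∣m D∣n (subst (D ∣_) (toℕ-mod a) D∣)

    self : ∀ a → lookup (cyc a) (a mod n) ≡ true
    self a = cyc⇐ a (1 mod n , trans (⊙-mod a 1) (cong (_mod n) (ℕ.*-identityʳ a)))

    cyc-⊆ : ∀ a b → lookup (cyc b) (a mod n) ≡ true → ∀ {l} → lookup (cyc a) l ≡ true → lookup (cyc b) l ≡ true
    cyc-⊆ a b a∈ {l} l∈ = let i , b⊙i = cyc⇒ b a∈ ; j , a⊙j = cyc⇒ a l∈ in
      cyc⇐ b (toℕ j ⊙ i , (begin
        b ⊙ toℕ j ⊙ i ≡⟨ trans (⊙-assoc b (toℕ j) i) (trans (cong (_⊙ i) (ℕ.*-comm b (toℕ j))) (sym (⊙-assoc (toℕ j) b i)))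
            ⟩
        toℕ j ⊙ b ⊙ i ≡⟨ cong (toℕ j ⊙_) b⊙i ⟩
        toℕ j ⊙ (a mod n) ≡⟨ trans (⊙-mod (toℕ j) a) (cong (_mod n) (ℕ.*-comm (toℕ j) a)) ⟩
        a ⊙ j ≡⟨ a⊙j ⟩
        l ∎))
      where open ≡-Reasoning

  inAtom⇒atomic : ∀ {x} → inAtom? d x ≡ true → Atomic x
  inAtom⇒atomic {x} eq = d∣x , pd∤x
    where
    same : cyc (toℕ x) ≡ cyc d
    same = does⇒ (atom? x) eq
    x∈ : ∃[ j ] d ⊙ j ≡ x
    x∈ = cyc⇒ d (trans (cong (λ C → lookup C x) (sym same))
        (subst (λ y → lookup (cyc (toℕ x)) y ≡ true) (mod-toℕ x) (self (toℕ x))))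
    d∈ : ∃[ j ] toℕ x ⊙ j ≡ d mod n
    d∈ = cyc⇒ (toℕ x) (trans (cong (λ C → lookup C (d mod n)) same) (self d))
    d∣x : d ∣ toℕ x
    d∣x = subst (λ y → d ∣ toℕ y) (proj₂ x∈) (∣mod d∣n (m∣m*n (toℕ (proj₁ x∈))))
    pd∤x : ∀ p → Prime p → p * d ∣ n → ¬ p * d ∣ toℕ x
    pd∤x p pp pd∣n pd∣x = pd∤d pp (∣mod⁻¹ pd∣n (subst (λ y → p * d ∣ toℕ y) (proj₂ d∈)
        (∣mod pd∣n (∣m⇒∣m*n (toℕ (proj₁ d∈)) pd∣x))))

  -- If gcd(x, n) were a proper multiple of d, a prime p of the quotient would make p d divide both
  -- x and n. So the gcd is d, and Bézout writes d as a multiple of x modulo n.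
  atomic⇒inAtom : ∀ {x} → Atomic x → inAtom? d x ≡ true
  atomic⇒inAtom {x} (d∣x , pd∤x) = dec-true (atom? x) (lookup-injective (cyc (toℕ x)) (cyc d) λ l →
      bool-ext (cyc-⊆ (toℕ x) d x∈cyc-d) (cyc-⊆ d (toℕ x) d∈cyc-x))
    where
    g = gcd (toℕ x) n
    g∣x : g ∣ toℕ x
    g∣x = gcd[m,n]∣m (toℕ x) n
    g∣n : g ∣ n
    g∣n = gcd[m,n]∣n (toℕ x) n
    d∣g : d ∣ g
    d∣g = gcd-greatest d∣x d∣n
    c = quotient d∣g
    g≡ : g ≡ c * d
    g≡ = m∣n⇒n≡quotient*m d∣g
    c≢0 : NonZero c
    c≢0 = ℕ.≢-nonZero λ c≡0 → gcd[m,n]≢0 (toℕ x) n (inj₂ (ℕ.≢-nonZero⁻¹ n)) (trans g≡ (cong (_* d) c≡0))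
    g≡d : g ≡ d
    g≡d with c ℕ.≟ 1
    ... | yes c≡1 = trans g≡ (trans (cong (_* d) c≡1) (ℕ.*-identityˡ d))
    ... | no c≢1 = let p , pp , p∣c = prime-factor c {{c≢0}} c≢1
                       pd∣g = subst (p * d ∣_) (sym g≡) (*-monoˡ-∣ d p∣c)
                   in contradiction (∣-trans pd∣g g∣x) (pd∤x p pp (∣-trans pd∣g g∣n))
    x∈cyc-d : lookup (cyc d) (toℕ x mod n) ≡ true
    x∈cyc-d = cyc⇐ d (quotient d∣x mod n , trans (⊙-mod d (quotient d∣x)) (cong (_mod n) (sym (m∣n⇒n≡m*quotient d∣x))))
    bezout : Bézout.Identity g (toℕ x) n → ∃[ j ] toℕ x ⊙ j ≡ d mod n
    bezout (Bézout.+- a b eq) = a mod n , trans (⊙-mod (toℕ x) a)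
        (mod-cong (trans (cong (_% n) (trans (ℕ.*-comm (toℕ x) a) (sym eq)))
      (trans ([m+kn]%n≡m%n g b n) (cong (_% n) g≡d))))
    bezout (Bézout.-+ a b eq) = ⊖ (a mod n) , trans (⊙-⊖ (toℕ x) (a mod n))
        (sym (inverseˡ-unique (d mod n) (toℕ x ⊙ (a mod n)) (begin
      (d mod n) ⊕ toℕ x ⊙ (a mod n) ≡⟨ cong ((d mod n) ⊕_) (⊙-mod (toℕ x) a) ⟩
      (d mod n) ⊕ ((toℕ x * a) mod n) ≡⟨ mod-⊕ d (toℕ x * a) ⟩
      (d + toℕ x * a) mod n ≡⟨ mod-cong (trans (cong (_% n) (trans (cong₂ _+_ (sym g≡d) (ℕ.*-comm (toℕ x) a)) eq))
          (trans (m*n%n≡0 b n) (sym (m<n⇒m%n≡m (ℕ.>-nonZero⁻¹ n))))) ⟩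
      e ∎)))
      where
      open ≡-Reasoning
      open import Algebra.Properties.AbelianGroup group using (inverseˡ-unique)
    d∈cyc-x : lookup (cyc (toℕ x)) (d mod n) ≡ true
    d∈cyc-x = cyc⇐ (toℕ x) (bezout (Bézout.identity (gcd-GCD (toℕ x) n)))

  residue : ∀ {D} .{{_ : NonZero D}} → D ∣ n → ∀ a → toℕ (a mod n) % D ≡ a % D
  residue {D} D∣n a = trans (cong (_% D) (toℕ-mod a)) (m∣n⇒o%n%m≡o%m D n a D∣n)

  residue-difference : ∀ {D} .{{_ : NonZero D}} → D ∣ n → ∀ k l → (toℕ (l ⊕ (⊖ k)) + toℕ k) % D ≡ toℕ l % D
  residue-difference D∣n k l = trans (sym (residue D∣n _)) (cong (λ z → toℕ z % _) (⊖-⊕-cancel l k))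

  same-residue⇒∣ : ∀ {D} .{{_ : NonZero D}} → D ∣ n → ∀ {k l} → toℕ k % D ≡ toℕ l % D → D ∣ toℕ (l ⊕ (⊖ k))
  same-residue⇒∣ {D} D∣n {k} {l} eq = %-cancel D _ (toℕ k) (trans (residue-difference D∣n k l) (sym eq))

  ∣⇒same-residue : ∀ {D} .{{_ : NonZero D}} → D ∣ n → ∀ {k l} → D ∣ toℕ (l ⊕ (⊖ k)) → toℕ k % D ≡ toℕ l % D
  ∣⇒same-residue {D} D∣n {k} {l} D∣ = trans (sym (%-remove-+ˡ (toℕ k) D∣)) (residue-difference D∣n k l)

  private
    mult-term : Fin n → Fin n → Fin n → ℕ
    mult-term m k l = if lookup S k ∧ lookup S l ∧ does ((l ⊕ (⊖ k)) Fin.≟ m) then 1 else 0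

  mult-positive : ∀ {k l} → lookup S k ≡ true → lookup S l ≡ true → 1 ≤ mult S (l ⊕ (⊖ k))
  mult-positive {k} {l} Sk Sl = ℕ.≤-trans (ℕ.≤-reflexive (sym is-one))
      (ℕ.≤-trans (≤-sumFℕ (mult-term m k) l) (≤-sumFℕ (λ k → sumFℕ (mult-term m k)) k))
    where
    m = l ⊕ (⊖ k)
    is-one : mult-term m k l ≡ 1
    is-one = cong (if_then 1 else 0) (trans (cong (_∧ (lookup S l ∧ does (m Fin.≟ m))) Sk)
        (trans (cong (_∧ does (m Fin.≟ m)) Sl) (dec-true (m Fin.≟ m) refl)))

  mult-witness : ∀ {m} → 1 ≤ mult S m → ∃[ k ] ∃[ l ] lookup S k ≡ true × lookup S l ≡ true × l ⊕ (⊖ k) ≡ m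
  mult-witness {m} pos =
    let k , pos′ = sumFℕ-positive (λ k → sumFℕ (mult-term m k)) pos
        l , pos″ = sumFℕ-positive (mult-term m k) pos′
        a , b , c = decode (lookup S k) (lookup S l) (does ((l ⊕ (⊖ k)) Fin.≟ m)) pos″
    in k , l , a , b , does⇒ ((l ⊕ (⊖ k)) Fin.≟ m) c
    where
    decode : ∀ a b c → 1 ≤ (if a ∧ b ∧ c then 1 else 0) → a ≡ true × b ≡ true × c ≡ true
    decode true true true _ = refl , refl , refl

  difference-atomic : ∀ {k l} → lookup S k ≡ true → lookup S l ≡ true → k ≢ l → Atomic (l ⊕ (⊖ k))
  difference-atomic {k} {l} Sk Sl k≢l = inAtom⇒atomic (positive (inAtom? d m) refl)
    where
    m = l ⊕ (⊖ k)
    m≢e : m ≢ e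
    m≢e eq = k≢l (sym (trans (sym (⊖-⊕-cancel l k)) (trans (cong (_⊕ k) eq) (⊕-identityˡ k))))
    positive : ∀ b → inAtom? d m ≡ b → inAtom? d m ≡ true
    positive true eq = eq
    positive false eq = contradiction (subst (1 ≤_) (trans
        (mult≡ m) (cong₂ (λ a b → (if a then t else 0) + (if b then m₂ else 0)) (dec-false (m Fin.≟ e) m≢e) eq))
        (mult-positive Sk Sl)) λ ()

  pair-with-difference : ∀ {x} → Atomic x → ∃[ k ] ∃[ l ] lookup S k ≡ true × lookup S l ≡ true × l ⊕ (⊖ k) ≡ x
  pair-with-difference {x} at = mult-witness (ℕ.≤-trans 1≤m₂ (ℕ.≤-trans (ℕ.m≤n+m m₂ _)
    (ℕ.≤-reflexive (sym (trans (mult≡ x) (cong (λ b → (if does (x Fin.≟ e) then t else 0) + (if b then m₂ else 0))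
        (atomic⇒inAtom at)))))))

  private
    t≡count : t ≡ count (lookup S)
    t≡count = card≡count S

  -- Two elements of S agree modulo d but not modulo p d.
  upper-bound : ∀ {p} → Prime p → p * d ∣ n → t ≤ p
  upper-bound {p} pp pd∣n = ℕ.≤-trans (ℕ.≤-reflexive t≡count) (ℕ.≤-trans
    (count-injection (lookup S) (λ _ → true) (λ k _ → (toℕ k / d) mod p) (λ _ _ → refl) injective)
    (ℕ.≤-reflexive (count-true p)))
    where
    instance
      p-nz : NonZero p
      p-nz = prime⇒nonZero pp
      pd-nz : NonZero (p * d)
      pd-nz = ℕ.m*n≢0 p d
    injective : ∀ k l → lookup S k ≡ true → lookup S l ≡ true → (toℕ k / d) mod p ≡ (toℕ l / d) mod p → k ≡ l
    injective k l Sk Sl eq with k Fin.≟ l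
    ... | yes k≡l = k≡l
    ... | no k≢l = let d∣ , pd∤ = difference-atomic Sk Sl k≢l in
      contradiction (same-residue⇒∣ pd∣n (%-product p d (∣⇒same-residue d∣n d∣) (CyclicGroup.mod-injective p eq)))
          (pd∤ p pp pd∣n)

  -- The setting of a composite order n / d: it is divisible by q p, where q and p may coincide.
  -- With z = n / q, adding multiples of z keeps the residue modulo p d, so pairs with such
  -- differences can be counted by their first components.
  module _ {q p : ℕ} (pq : Prime q) (pp : Prime p) (z′ : ℕ) (n≡ : n ≡ q * (z′ * d)) (p∣z′ : p ∣ z′) where

    private
      z : ℕ
      z = z′ * d
      instance
        q-nz : NonZero q
        q-nz = prime⇒nonZero pq
        p-nz : NonZero p
        p-nz = prime⇒nonZero pp
        pd-nz : NonZero (p * d)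
        pd-nz = ℕ.m*n≢0 p d
        z-nz : NonZero z
        z-nz = ℕ.≢-nonZero λ z≡0 → ℕ.≢-nonZero⁻¹ n (trans n≡ (trans (cong (q *_) z≡0) (ℕ.*-zeroʳ q)))
      z∣n : z ∣ n
      z∣n = divides q n≡
      pd∣z : p * d ∣ z
      pd∣z = *-monoˡ-∣ d p∣z′

    -- Removing one factor q from n / d costs divisibility by no other prime, so adding a multiple
    -- of z can spoil `Atomic` at q only.
    other-primes : ∀ {ℓ} → Prime ℓ → ℓ ≢ q → ℓ * d ∣ n → ℓ * d ∣ z
    other-primes {ℓ} pℓ ℓ≢q ℓd∣n = *-monoˡ-∣ d ([ (λ ℓ∣q →
        contradiction (prime-divisor-of-prime pq ℓ∣q (prime≢1 pℓ)) ℓ≢q) , (λ ℓ∣z′ → ℓ∣z′) ]′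
      (euclidsLemma q z′ pℓ (*-cancelʳ-∣ d (subst (ℓ * d ∣_) (trans n≡ (sym (ℕ.*-assoc q z′ d))) ℓd∣n))))

    private
      y : Fin q → Fin n
      y i = (d + toℕ i * z) mod n

      -- As d + i z = (1 + i z′) d, the element `y i` can fail to generate ⟨a^d⟩ only if q divides 1
      -- + i z′.
      bad : Fin q → Bool
      bad i = does (q ∣? (1 + toℕ i * z′))

      not-bad : ∀ i → not (bad i) ≡ true → ¬ q ∣ 1 + toℕ i * z′
      not-bad i eq q∣ = contradiction (trans (sym eq) (cong not (dec-true (q ∣? (1 + toℕ i * z′)) q∣))) λ ()

      y-atomic : ∀ i → ¬ q ∣ 1 + toℕ i * z′ → Atomic (y i)
      y-atomic i q∤ = ∣mod d∣n (∣m∣n⇒∣m+n ∣-refl (∣n⇒∣m*n (toℕ i) (n∣m*n z′))) , no-prime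
        where
        lem : ∀ i z d → d + i * (z * d) ≡ (1 + i * z) * d
        lem = solveℕ-∀
        no-prime : ∀ ℓ → Prime ℓ → ℓ * d ∣ n → ¬ ℓ * d ∣ toℕ (y i)
        no-prime ℓ pℓ ℓd∣n ℓd∣y with ℓ ℕ.≟ q
        ... | yes refl = q∤ (*-cancelʳ-∣ d (subst (ℓ * d ∣_) (lem (toℕ i) z′ d) (∣mod⁻¹ ℓd∣n ℓd∣y)))
        ... | no ℓ≢q = pd∤d pℓ (∣m+n∣m⇒∣n (subst (ℓ * d ∣_) (ℕ.+-comm d _) (∣mod⁻¹ ℓd∣n ℓd∣y))
            (∣n⇒∣m*n (toℕ i) (other-primes pℓ ℓ≢q ℓd∣n)))

      choice : ∀ i → not (bad i) ≡ true → ∃[ k ] ∃[ l ] lookup S k ≡ true × lookup S l ≡ true × l ⊕ (⊖ k) ≡ y i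
      choice i eq = pair-with-difference (y-atomic i (not-bad i eq))

      y-residue : ∀ i → toℕ (y i) % (p * d) ≡ d % (p * d)
      y-residue i = trans (residue (∣-trans pd∣z z∣n) (d + toℕ i * z)) (%-remove-+ʳ d (∣n⇒∣m*n (toℕ i) pd∣z))

      y-injective : ∀ {i j} → y i ≡ y j → i ≡ j
      y-injective {i} {j} eq = Fin.toℕ-injective (ℕ.*-cancelʳ-≡ (toℕ i) (toℕ j) z
        (trans (sym (m<n⇒m%n≡m (small i))) (trans (mod-injective
            (⊕-cancelˡ (d mod n) _ _ (trans (mod-⊕ d (toℕ i * z)) (trans eq (sym (mod-⊕ d (toℕ j * z)))))))
            (m<n⇒m%n≡m (small j)))))
        where
        small : ∀ i → toℕ i * z < n
        small i = subst (toℕ i * z <_) (sym n≡) (ℕ.*-monoˡ-< z (Fin.toℕ<n i))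

      -- With equal first components, l and l′ agree modulo p d because all the `y i` do; two
      -- distinct elements of S never agree modulo p d, so l = l′ and the differences coincide.
      same-first : ∀ {i j k k′ l l′} → lookup S l ≡ true → lookup S l′ ≡ true → l ⊕ (⊖ k) ≡ y i → l′ ⊕ (⊖ k′) ≡ y j →
          k ≡ k′ → i ≡ j
      same-first {i} {j} {k} {k′} {l} {l′} Sl Sl′ l-k≡ l′-k′≡ eq with l Fin.≟ l′
      ... | yes refl = y-injective (trans (sym l-k≡) (trans (cong (λ k → l ⊕ (⊖ k)) eq) l′-k′≡))
      ... | no l≢l′ = contradiction (same-residue⇒∣ (∣-trans pd∣z z∣n) same)
          (proj₂ (difference-atomic Sl Sl′ l≢l′) p pp (∣-trans pd∣z z∣n))
        where
        through : ∀ {k l x} → l ⊕ (⊖ k) ≡ x → toℕ l % (p * d) ≡ (toℕ x + toℕ k) % (p * d)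
        through {k} {l} refl = sym (residue-difference (∣-trans pd∣z z∣n) k l)
        +-cong-% : ∀ a b c → a % (p * d) ≡ b % (p * d) → (a + c) % (p * d) ≡ (b + c) % (p * d)
        +-cong-% a b c eq = trans (%-distribˡ-+ a c (p * d))
            (trans (cong (λ w → (w + c % (p * d)) % (p * d)) eq) (sym (%-distribˡ-+ b c (p * d))))
        same : toℕ l % (p * d) ≡ toℕ l′ % (p * d)
        same = trans (through l-k≡) (trans (+-cong-% (toℕ (y i)) (toℕ (y j)) (toℕ k)
            (trans (y-residue i) (sym (y-residue j))))
          (trans (cong (λ k → (toℕ (y j) + toℕ k) % (p * d)) eq) (sym (through l′-k′≡))))

      choice-injective : ∀ i j p q → proj₁ (choice i p) ≡ proj₁ (choice j q) → i ≡ j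
      choice-injective i j bi bj = same-first (proj₁ (proj₂ (proj₂ (proj₂ (choice i bi)))))
          (proj₁ (proj₂ (proj₂ (proj₂ (choice j bj)))))
        (proj₂ (proj₂ (proj₂ (proj₂ (choice i bi))))) (proj₂ (proj₂ (proj₂ (proj₂ (choice j bj)))))

      good≤t : count (not ∘ bad) ≤ t
      good≤t = ℕ.≤-trans (count-injection (not ∘ bad) (lookup S) (λ i b → proj₁ (choice i b))
        (λ i b → proj₁ (proj₂ (proj₂ (choice i b)))) choice-injective) (ℕ.≤-reflexive (sym t≡count))

    -- The elements d + i n / q agree modulo p d, and at most one of them fails to generate ⟨a^d⟩;
    -- the others are differences of pairs in S with distinct first components.
    lower-bound : q ≤ suc t
    lower-bound = ℕ.≤-trans (ℕ.≤-reflexive (sym (count-complement bad))) (ℕ.+-mono-≤ bad≤1 good≤t)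
      where
      bad⇒ : ∀ i → bad i ≡ true → q ∣ 1 + toℕ i * z′
      bad⇒ i = does⇒ (q ∣? (1 + toℕ i * z′))
      ordered : ∀ a b → a ≤ b → b < q → q ∣ 1 + a * z′ → q ∣ 1 + b * z′ → a ≡ b
      ordered a b a≤b b<q qa qb with ℕ.m≤n⇒∃[o]m+o≡n a≤b
      ... | c , refl = sym (trans (cong (λ w → a + w) c≡0) (ℕ.+-identityʳ a))
        where
        lem : ∀ a c z → 1 + (a + c) * z ≡ 1 + a * z + c * z
        lem = solveℕ-∀
        -- The difference of two multiples of q. As q does not divide z′, it divides c, the gap
        -- between two indices below q.
        q∣cz : q ∣ c * z′
        q∣cz = ∣m+n∣m⇒∣n (subst (q ∣_) (lem a c z′) qb) qa
        q∤z′ : ¬ q ∣ z′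
        q∤z′ q∣z′ = prime≢1 pq (∣1⇒≡1 (∣m+n∣m⇒∣n (subst (q ∣_) (ℕ.+-comm 1 (a * z′)) qa) (∣n⇒∣m*n a q∣z′)))
        c≡0 : c ≡ 0
        c≡0 = multiple<⇒0 ([ (λ q∣c → q∣c) , (λ q∣z′ → contradiction q∣z′ q∤z′) ]′ (euclidsLemma c z′ pq q∣cz))
            (ℕ.≤-<-trans (ℕ.m≤n+m c a) b<q)
      unique : ∀ i j → bad i ≡ true → bad j ≡ true → i ≡ j
      unique i j bi bj = [ (λ i≤j → Fin.toℕ-injective (ordered (toℕ i) (toℕ j) i≤j (Fin.toℕ<n j) (bad⇒ i bi) (bad⇒ j bj)))
        , (λ j≤i → sym (Fin.toℕ-injective (ordered (toℕ j) (toℕ i) j≤i (Fin.toℕ<n i) (bad⇒ j bj) (bad⇒ i bi)))) ]′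
            (ℕ.≤-total (toℕ i) (toℕ j))
      bad≤1 : count bad ≤ 1
      bad≤1 = count-injection {b = 1} bad (λ _ → true) (λ _ _ → zero) (λ _ _ → refl) (λ i j bi bj _ → unique i j bi bj)

    -- When q divides z′, the number 1 + i z′ is 1 modulo q, so no index is bad and the bound
    -- improves by one.
    lower-bound-full : q ∣ z′ → q ≤ t
    lower-bound-full q∣z′ = ℕ.≤-trans (ℕ.≤-reflexive (sym (count-true q)))
        (ℕ.≤-trans (count-⊆ {m = q} {P = λ _ → true} {Q = not ∘ bad} λ i _ → cong not
      (dec-false (q ∣? (1 + toℕ i * z′)) λ q∣ → prime≢1 pq
          (∣1⇒≡1 (∣m+n∣m⇒∣n (subst (q ∣_) (ℕ.+-comm 1 (toℕ i * z′)) q∣) (∣n⇒∣m*n (toℕ i) q∣z′))))) good≤t)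

    -- When q divides z′, every ℓ d with ℓ prime that divides n also divides z, so adding z changes
    -- none of the residues on which `Atomic` depends.
    translate-atomic : q ∣ z′ → ∀ x → inAtom? d ((z mod n) ⊕ x) ≡ inAtom? d x
    translate-atomic q∣z′ x = bool-ext
      (λ eq → atomic⇒inAtom (transfer (λ D∣z D∣n → trans (residue D∣n _) (%-remove-+ˡ (toℕ x) (∣mod D∣n D∣z)))
          (inAtom⇒atomic eq)))
      (λ eq → atomic⇒inAtom (transfer (λ D∣z D∣n → sym (trans (residue D∣n _) (%-remove-+ˡ (toℕ x) (∣mod D∣n D∣z))))
          (inAtom⇒atomic eq)))
      where
      all-primes : ∀ {ℓ} → Prime ℓ → ℓ * d ∣ n → ℓ * d ∣ z
      all-primes {ℓ} pℓ ℓd∣n with ℓ ℕ.≟ q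
      ... | yes refl = *-monoˡ-∣ d q∣z′
      ... | no ℓ≢q = other-primes pℓ ℓ≢q ℓd∣n
      transfer : ∀ {a b} → (∀ {D} .{{_ : NonZero D}} → D ∣ z → D ∣ n → toℕ a % D ≡ toℕ b % D) → Atomic a → Atomic b
      transfer {a} {b} same (d∣a , pd∤a) = m%n≡0⇒n∣m _ d (trans (sym (same (n∣m*n z′) d∣n)) (n∣m⇒m%n≡0 _ d d∣a)) ,
        λ ℓ pℓ ℓd∣n ℓd∣b → let instance ℓd-nz = ℕ.m*n≢0 ℓ d {{prime⇒nonZero pℓ}} in
          pd∤a ℓ pℓ ℓd∣n (m%n≡0⇒n∣m _ (ℓ * d) (trans (same (all-primes pℓ ℓd∣n) ℓd∣n) (n∣m⇒m%n≡0 _ (ℓ * d) ℓd∣b)))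

-- The shape of S₂: prime index and nearly full cosets

module Classification (n : ℕ) .{{nz : NonZero n}} (odd : ∀ p → Prime p → p ∣ n → 3 ≤ p) (S : Subset n)
  (d m₂ : ℕ) (d∣n : d ∣ n) (d≢n : d ≢ n) (1≤m₂ : 1 ≤ m₂)
  (mult≡ : ∀ m → Dihedral.mult n S m ≡ (if does (m Fin.≟ Dihedral.e n) then card S else 0) +
      (if Dihedral.inAtom? n d m then m₂ else 0))
  (eigenvalue-square : ∀ (v : Dihedral.D n → ℤ) (c : ℕ) →
    (∀ x → CyclicGroup.convolve n (λ m → + Dihedral.mult n S m) v x ≡ + c ℤ.* v x) → ∀ x → v x ≢ + 0 → ∃[ r ] r * r ≡ c) where

  open Dihedral n
  open CyclicGroup n
  open CyclicGroupOperators n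
  open BooleanAlgebra n
  open TwoIntegralSets n S d m₂ d∣n d≢n 1≤m₂ mult≡

  private
    t : ℕ
    t = card S

    instance
      d-nz : NonZero d
      d-nz = ℕ.≢-nonZero λ { refl → ℕ.≢-nonZero⁻¹ n (0∣⇒≡0 d∣n) }

    pick : ∀ (F : Fin n → ℤ) x k → sumF (λ m → F m ℤ.* δ x (k ⊕ m)) ≡ F (x ⊕ (⊖ k))
    pick F x k = begin
      sumF (λ m → F m ℤ.* δ x (k ⊕ m)) ≡⟨ sumF-translate (λ m → F m ℤ.* δ x (k ⊕ m)) (⊖ k) ⟨
      sumF (λ m → F (m ⊕ (⊖ k)) ℤ.* δ x (k ⊕ (m ⊕ (⊖ k)))) ≡⟨ sumF-cong (λ m → trans
          (cong (λ z → F (m ⊕ (⊖ k)) ℤ.* δ x z) (trans (⊕-comm k _) (⊖-⊕-cancel m k))) (ℤ.*-comm (F (m ⊕ (⊖ k))) (δ x m))) ⟩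
      sumF (λ m → δ x m ℤ.* F (m ⊕ (⊖ k))) ≡⟨ sumF-δˡ x (λ m → F (m ⊕ (⊖ k))) ⟩
      F (x ⊕ (⊖ k)) ∎
      where open ≡-Reasoning

    scaled-δ : ∀ c x k → + (if does ((x ⊕ (⊖ k)) Fin.≟ e) then c else 0) ≡ + c ℤ.* δ x k
    scaled-δ c x k = trans (cong (λ b → + (if b then c else 0)) same) (lem (does (x Fin.≟ k)))
      where
      same : does ((x ⊕ (⊖ k)) Fin.≟ e) ≡ does (x Fin.≟ k)
      same = bool-ext
        (λ p → dec-true (x Fin.≟ k) (trans (sym (⊖-⊕-cancel x k))
            (trans (cong (_⊕ k) (does⇒ ((x ⊕ (⊖ k)) Fin.≟ e) p)) (⊕-identityˡ k))))
        (λ p → dec-true ((x ⊕ (⊖ k)) Fin.≟ e) (trans (cong (_⊕ (⊖ k)) (does⇒ (x Fin.≟ k) p)) (⊕-inverseʳ k)))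
      lem : ∀ b → + (if b then c else 0) ≡ + c ℤ.* (if b then + 1 else + 0)
      lem true = sym (ℤ.*-identityʳ (+ c))
      lem false = sym (ℤ.*-zeroʳ (+ c))

  -- If the multiplicities are c at 1 plus a function invariant under y, then δ_1 - δ_y is an eigenvector for c.
  eigenvalue-at : ∀ y → y ≢ e → ∀ c (w : Fin n → ℕ) → (∀ x → mult S x ≡ (if does (x Fin.≟ e) then c else 0) + w x) →
    (∀ x → w (y ⊕ x) ≡ w x) → ∃[ r ] r * r ≡ c
  eigenvalue-at y y≢e c w mult-w w-inv = eigenvalue-square v c eig (false , e) v≢0
    where
    v : D → ℤ
    v (_ , k) = δ e k ℤ.+ - + 1 ℤ.* δ y k
    v≢0 : v (false , e) ≢ + 0
    v≢0 eq = contradiction (trans (sym (cong₂ (λ a b → a ℤ.+ - + 1 ℤ.* b) (δ-refl e) (δ-≢ y≢e))) eq) λ ()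
    F : Fin n → ℤ
    F m = + mult S m
    F≡ : ∀ x k → F (x ⊕ (⊖ k)) ≡ + c ℤ.* δ x k ℤ.+ + w (x ⊕ (⊖ k))
    F≡ x k = trans (cong +_ (mult-w (x ⊕ (⊖ k)))) (cong (λ z → z ℤ.+ + w (x ⊕ (⊖ k))) (scaled-δ c x k))
    eig : ∀ x → convolve F v x ≡ + c ℤ.* v x
    eig (b , k) = begin
      sumF (λ m → F m ℤ.* (δ e (k ⊕ m) ℤ.+ - + 1 ℤ.* δ y (k ⊕ m))) ≡⟨ sumF-cong
          (λ m → lem₁ (F m) (δ e (k ⊕ m)) (δ y (k ⊕ m))) ⟩
      sumF (λ m → F m ℤ.* δ e (k ⊕ m) ℤ.+ - + 1 ℤ.* (F m ℤ.* δ y (k ⊕ m))) ≡⟨ sumF-linear (- + 1)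
          (λ m → F m ℤ.* δ e (k ⊕ m)) (λ m → F m ℤ.* δ y (k ⊕ m)) ⟩
      sumF (λ m → F m ℤ.* δ e (k ⊕ m)) ℤ.+ - + 1 ℤ.* sumF (λ m → F m ℤ.* δ y (k ⊕ m)) ≡⟨ cong₂ (λ a b → a ℤ.+ - + 1 ℤ.* b)
          (pick F e k) (pick F y k) ⟩
      F (e ⊕ (⊖ k)) ℤ.+ - + 1 ℤ.* F (y ⊕ (⊖ k)) ≡⟨ cong₂ (λ a b → a ℤ.+ - + 1 ℤ.* b) (F≡ e k) (F≡ y k) ⟩
      + c ℤ.* δ e k ℤ.+ + w (e ⊕ (⊖ k)) ℤ.+ - + 1 ℤ.* (+ c ℤ.* δ y k ℤ.+ + w (y ⊕ (⊖ k)))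
        ≡⟨ cong₂ (λ a b → + c ℤ.* δ e k ℤ.+ + a ℤ.+ - + 1 ℤ.* (+ c ℤ.* δ y k ℤ.+ + b)) (cong w (⊕-identityˡ (⊖ k)))
            (w-inv (⊖ k)) ⟩
      + c ℤ.* δ e k ℤ.+ + w (⊖ k) ℤ.+ - + 1 ℤ.* (+ c ℤ.* δ y k ℤ.+ + w (⊖ k)) ≡⟨ lem₂ (+ c) (δ e k) (δ y k) (+ w (⊖ k)) ⟩
      + c ℤ.* (δ e k ℤ.+ - + 1 ℤ.* δ y k) ∎
      where
      open ≡-Reasoning
      lem₁ : ∀ f u v → f ℤ.* (u ℤ.+ - + 1 ℤ.* v) ≡ f ℤ.* u ℤ.+ - + 1 ℤ.* (f ℤ.* v)
      lem₁ = solve-∀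
      lem₂ : ∀ c u v w → c ℤ.* u ℤ.+ w ℤ.+ - + 1 ℤ.* (c ℤ.* v ℤ.+ w) ≡ c ℤ.* (u ℤ.+ - + 1 ℤ.* v)
      lem₂ = solve-∀

  mod≢e : ∀ a → a ≢ 0 → a < n → a mod n ≢ e
  mod≢e a a≢0 a<n eq = a≢0 (trans (sym (trans (toℕ-mod a) (m<n⇒m%n≡m a<n))) (trans (cong toℕ eq) toℕ-e))

  -- The upper and lower bounds pin t to the prime q, while invariance of the atom under a^(n/q)
  -- makes t an eigenvalue of h, hence a square.
  not-square-order : ∀ {q} → Prime q → ∀ z′ → n ≡ q * (z′ * d) → q ∣ z′ → ⊥
  not-square-order {q} pq z′ n≡ q∣z′ = uncurry (eigenvalue-at (z mod n) (mod≢e z z≢0 z<n) t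
      (λ x → if inAtom? d x then m₂ else 0) mult≡
      (λ x → cong (if_then m₂ else 0) (translate-atomic pq pq z′ n≡ q∣z′ q∣z′ x)))
    where
    z = z′ * d
    z≢0 : z ≢ 0
    z≢0 z≡0 = ℕ.≢-nonZero⁻¹ n (trans n≡ (trans (cong (q *_) z≡0) (ℕ.*-zeroʳ q)))
    z<n : z < n
    z<n = subst (z <_) (sym n≡) (subst (_< q * z) (ℕ.*-identityˡ z)
        (ℕ.*-monoˡ-< z {{ℕ.≢-nonZero z≢0}} (ℕ.nonTrivial⇒n>1 q {{prime⇒nonTrivial pq}})))
    t≡q : t ≡ q
    t≡q = ℕ.≤-antisym (upper-bound pq (subst (q * d ∣_) (sym n≡) (*-monoʳ-∣ q (n∣m*n z′))))
        (lower-bound-full pq pq z′ n≡ q∣z′ q∣z′)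
    uncurry : (∃[ r ] r * r ≡ t) → ⊥
    uncurry (r , eq) = prime-not-square pq r (trans eq t≡q)

  -- A composite n / d has a prime factor q and a further prime p. If p = q, the previous lemma
  -- applies. If they differ, the lower bound for each against the upper bound for the other puts
  -- them at distance one, which two odd primes cannot have.
  prime-index : ∃[ q ] Prime q × n ≡ q * d
  prime-index = go (m∣n⇒n≡quotient*m d∣n)
    where
    c = quotient d∣n
    go : n ≡ c * d → ∃[ q ] Prime q × n ≡ q * d
    go n≡ = with-factor (prime-factor c {{c≢0}} c≢1)
      where
      c≢0 : NonZero c
      c≢0 = ℕ.≢-nonZero λ c≡0 → ℕ.≢-nonZero⁻¹ n (trans n≡ (cong (_* d) c≡0))
      c≢1 : c ≢ 1
      c≢1 c≡1 = d≢n (sym (trans n≡ (trans (cong (_* d) c≡1) (ℕ.*-identityˡ d))))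
      with-factor : ∃[ q ] Prime q × q ∣ c → ∃[ q ] Prime q × n ≡ q * d
      with-factor (q , pq , divides M c≡) with M ℕ.≟ 1
      ... | yes M≡1 = q , pq , trans n≡ (cong (_* d) (trans c≡ (trans (cong (_* q) M≡1) (ℕ.*-identityˡ q))))
      ... | no M≢1 = ⊥-elim (second-factor (prime-factor M {{M≢0}} M≢1))
        where
        M≢0 : NonZero M
        M≢0 = ℕ.≢-nonZero λ M≡0 → ℕ.≢-nonZero⁻¹ c {{c≢0}} (trans c≡ (cong (_* q) M≡0))
        lem : ∀ M q d → M * q * d ≡ q * (M * d)
        lem = solveℕ-∀
        n≡q : n ≡ q * (M * d)
        n≡q = trans n≡ (trans (cong (_* d) c≡) (lem M q d))
        ∣order : ∀ {p z} → n ≡ p * (z * d) → p ∣ n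
        ∣order {p} {z} eq = subst (p ∣_) (sym eq) (m∣m*n (z * d))
        ∣order′ : ∀ {p z} → n ≡ p * (z * d) → p * d ∣ n
        ∣order′ {p} {z} eq = subst (p * d ∣_) (sym eq) (*-monoʳ-∣ p (n∣m*n z))
        second-factor : ∃[ p ] Prime p × p ∣ M → ⊥
        second-factor (p , pp , p∣M@(divides M′ M≡)) with p ℕ.≟ q
        ... | yes refl = not-square-order pq M n≡q p∣M
        ... | no p≢q = apart (ℕ.<-cmp p q)
          where
      
          lem′ : ∀ M p q d → q * (M * p * d) ≡ p * (M * q * d)
          lem′ = solveℕ-∀
          n≡p : n ≡ p * (M′ * q * d)
          n≡p = trans n≡q (trans (cong (λ M → q * (M * d)) M≡) (lem′ M′ p q d))
          p≤1+q : p ≤ suc q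
          p≤1+q = ℕ.≤-trans (lower-bound pp pq (M′ * q) n≡p (n∣m*n M′)) (s≤s (upper-bound pq (∣order′ {q} {M} n≡q)))
          q≤1+p : q ≤ suc p
          q≤1+p = ℕ.≤-trans (lower-bound pq pp M n≡q p∣M) (s≤s (upper-bound pp (∣order′ {p} {M′ * q} n≡p)))
          3≤p = odd p pp (∣order {p} {M′ * q} n≡p)
          3≤q = odd q pq (∣order {q} {M} n≡q)
          apart : Tri (p < q) (p ≡ q) (q < p) → ⊥
          apart (tri< p<q _ _) = odd-primes-not-adjacent pp pq 3≤p 3≤q (ℕ.≤-antisym p<q q≤1+p)
          apart (tri≈ _ p≡q _) = p≢q p≡q
          apart (tri> _ _ q<p) = odd-primes-not-adjacent pq pp 3≤q 3≤p (ℕ.≤-antisym q<p p≤1+q)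

  module PrimeIndex {q : ℕ} (pq : Prime q) (n≡ : n ≡ q * d) where

    private
      instance
        q-nz : NonZero q
        q-nz = prime⇒nonZero pq

      multiples : Fin n → Bool
      multiples x = does (d ∣? toℕ x)

      d<n : d < n
      d<n = ℕ.≤∧≢⇒< (∣⇒≤ d∣n) d≢n

      d∣e : d ∣ toℕ e
      d∣e = subst (d ∣_) (sym toℕ-e) (divides 0 refl)

    inAtom-e : inAtom? d e ≡ false
    inAtom-e = false-if λ eq → proj₂ (inAtom⇒atomic eq) q pq (subst (q * d ∣_) (sym n≡) ∣-refl)
        (subst (q * d ∣_) (sym toℕ-e) (divides 0 refl))
      where
      false-if : ∀ {b} → (b ≡ true → ⊥) → b ≡ false
      false-if {true} f = contradiction refl f
      false-if {false} f = refl

    -- With n = q d the only prime ℓ with ℓ d dividing n is q itself, and no nonzero residue is a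
    -- multiple of q d. So ⟨a^d⟩ is its atom together with the identity.
    inAtom-≢e : ∀ x → x ≢ e → inAtom? d x ≡ multiples x
    inAtom-≢e x x≢e = bool-ext (λ eq → dec-true (d ∣? toℕ x) (proj₁ (inAtom⇒atomic eq)))
      (λ eq → atomic⇒inAtom (does⇒ (d ∣? toℕ x) eq , λ ℓ pℓ ℓd∣n ℓd∣x →
        let ℓ∣q = *-cancelʳ-∣ d (subst (ℓ * d ∣_) n≡ ℓd∣n)
            ℓ≡q = prime-divisor-of-prime pq ℓ∣q (prime≢1 pℓ)
        in x≢e (Fin.toℕ-injective (trans (multiple<⇒0 (subst (_∣ toℕ x) (trans (cong (_* d) ℓ≡q) (sym n≡)) ℓd∣x) (Fin.toℕ<n x)) (sym toℕ-e)))))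

    count-residue-class : ∀ (P : Fin n → Bool) → (∀ k l → P k ≡ true → P l ≡ true → toℕ k % d ≡ toℕ l % d) → count P ≤ q
    count-residue-class P same = ℕ.≤-trans (count-injection P (λ _ → true) (λ k _ → fromℕ< (quotient<q k)) (λ _ _ → refl)
        (λ k l Pk Pl eq → Fin.toℕ-injective (trans (m≡m%n+[m/n]*n (toℕ k) d) (trans
          (cong₂ (λ a b → a + b * d) (same k l Pk Pl) (trans (sym (Fin.toℕ-fromℕ< (quotient<q k)))
              (trans (cong toℕ eq) (Fin.toℕ-fromℕ< (quotient<q l)))))
          (sym (m≡m%n+[m/n]*n (toℕ l) d))))))
      (ℕ.≤-reflexive (count-true q))
      where
      quotient<q : ∀ k → toℕ k / d < q
      quotient<q k = m<n*o⇒m/o<n (subst (toℕ k <_) n≡ (Fin.toℕ<n k))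

    count-multiples : count multiples ≡ q
    count-multiples = ℕ.≤-antisym
      (count-residue-class multiples λ k l dk dl → trans (n∣m⇒m%n≡0 (toℕ k) d (does⇒ (d ∣? toℕ k) dk))
          (sym (n∣m⇒m%n≡0 (toℕ l) d (does⇒ (d ∣? toℕ l) dl))))
      (ℕ.≤-trans (ℕ.≤-reflexive (sym (count-true q))) (count-injection (λ _ → true) multiples (λ i _ → (toℕ i * d) mod n)
        (λ i _ → dec-true (d ∣? _) (subst (d ∣_) (sym (toℕ-multiple i)) (n∣m*n (toℕ i))))
        (λ i j _ _ eq → Fin.toℕ-injective (ℕ.*-cancelʳ-≡ (toℕ i) (toℕ j) d
            (trans (sym (toℕ-multiple i)) (trans (cong toℕ eq) (toℕ-multiple j)))))))
      where
      toℕ-multiple : ∀ (i : Fin q) → toℕ ((toℕ i * d) mod n) ≡ toℕ i * d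
      toℕ-multiple i = trans (toℕ-mod (toℕ i * d)) (m<n⇒m%n≡m (subst (toℕ i * d <_) (sym n≡) (ℕ.*-monoˡ-< d (Fin.toℕ<n i))))

    count-atom : suc (count (λ x → inAtom? d x)) ≡ q
    count-atom = trans (cong suc (count-cong agree)) (trans
        (sym (count-remove multiples e (dec-true (d ∣? toℕ e) d∣e))) count-multiples)
      where
      agree : ∀ x → inAtom? d x ≡ remove multiples e x
      agree x with e Fin.≟ x
      ... | yes refl = trans inAtom-e (sym (lem (multiples e)))
        where
        lem : ∀ b → b ∧ false ≡ false
        lem true = refl
        lem false = refl
      ... | no e≢x = trans (inAtom-≢e x (e≢x ∘ sym)) (sym (lem (multiples x)))
        where
        lem : ∀ b → b ∧ true ≡ b
        lem true = refl
        lem false = refl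

    private
      +count : ∀ {m} (P : Fin m → Bool) → + count P ≡ sumF (λ i → ind (P i))
      +count P = trans (+sumFℕ (λ i → if P i then 1 else 0)) (sumF-cong λ i → lem (P i))
        where
        lem : ∀ b → + (if b then 1 else 0) ≡ ind b
        lem true = refl
        lem false = refl

      +t : + t ≡ sumF (indicator S)
      +t = trans (cong +_ (card≡count S)) (+count (lookup S))

    -- Both sides are the value of β² on the constant function 1: once as the square of |S|, once as
    -- the sum of all multiplicities.
    total-multiplicity : t * t ≡ t + m₂ * count (λ x → inAtom? d x)
    total-multiplicity = ℤ.+-injective (begin
      + (t * t) ≡⟨ trans (ℤ.pos-* t t) (cong (+ t ℤ.*_) +t) ⟩
      + t ℤ.* sumF g ≡⟨ cong (ℤ._* sumF g) +t ⟩
      sumF g ℤ.* sumF g ≡⟨ sumF-* (sumF g) g ⟨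
      sumF (λ l → sumF g ℤ.* g l) ≡⟨ sumF-cong (λ l → trans (ℤ.*-comm (sumF g) (g l))
          (cong (g l ℤ.*_) (sym (sumF-cong (λ l → ℤ.*-identityʳ (g l)))))) ⟩
      reflected g (reflected g (λ _ → + 1)) (false , e) ≡⟨ convolve-mult S (λ _ → + 1) (false , e) ⟩
      sumF (λ m → + mult S m ℤ.* + 1) ≡⟨ sumF-cong (λ m →
          trans (ℤ.*-identityʳ (+ mult S m)) (trans (cong +_ (mult≡ m)) (lem (does (m Fin.≟ e)) (inAtom? d m)))) ⟩
      sumF (λ m → + t ℤ.* ind (does (m Fin.≟ e)) ℤ.+ + m₂ ℤ.* ind (inAtom? d m)) ≡⟨ sumF-linear (+ m₂)
          (λ m → + t ℤ.* δ m e) (λ m → ind (inAtom? d m)) ⟩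
      sumF (λ m → + t ℤ.* δ m e) ℤ.+ + m₂ ℤ.* sumF (λ m → ind (inAtom? d m)) ≡⟨ cong₂ (λ a b → a ℤ.+ + m₂ ℤ.* b)
          (sumF-δʳ e (λ _ → + t)) (sym (+count (λ x → inAtom? d x))) ⟩
      + t ℤ.+ + m₂ ℤ.* + count (λ x → inAtom? d x) ≡⟨ cong (λ z → + t ℤ.+ z) (ℤ.pos-* m₂ _) ⟨
      + (t + m₂ * count (λ x → inAtom? d x)) ∎)
      where
      open ≡-Reasoning
      g : Fin n → ℤ
      g = indicator S
      scaled : ∀ c b → + (if b then c else 0) ≡ + c ℤ.* ind b
      scaled c true = sym (ℤ.*-identityʳ (+ c))
      scaled c false = sym (ℤ.*-zeroʳ (+ c))
      lem : ∀ a b → + ((if a then t else 0) + (if b then m₂ else 0)) ≡ + t ℤ.* ind a ℤ.+ + m₂ ℤ.* ind b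
      lem a b = cong₂ ℤ._+_ (scaled t a) (scaled m₂ b)

    t≤q : t ≤ q
    t≤q = upper-bound pq (subst (q * d ∣_) (sym n≡) ∣-refl)

    t²≡ : t * t + m₂ ≡ t + m₂ * q
    t²≡ = trans (cong (_+ m₂) total-multiplicity) (trans
        (lem t m₂ (count (λ x → inAtom? d x))) (cong (λ z → t + m₂ * z) count-atom))
      where
      lem : ∀ t m a → t + m * a + m ≡ t + m * suc a
      lem = solveℕ-∀

    -- Ensures that `t ∸ m₂` is a genuine difference. It follows from m₂ (q - 1) = t (t - 1) and t ≤
    -- q.
    m₂≤t : m₂ ≤ t
    m₂≤t = bound t refl
      where
      bound : ∀ s → t ≡ s → m₂ ≤ s
      -- An empty set would give m₂ = m₂ q with m₂ positive and q above 1.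
      bound zero t≡0 = contradiction (trans (cong (λ t → t * t + m₂) (sym t≡0)) (trans t²≡ (cong (_+ m₂ * q) t≡0))) λ eq →
        ℕ.<-irrefl eq (subst (_< m₂ * q) (ℕ.*-identityʳ m₂)
            (ℕ.*-monoʳ-< m₂ {{ℕ.>-nonZero 1≤m₂}} (ℕ.nonTrivial⇒n>1 q {{prime⇒nonTrivial pq}})))
      bound s@(suc s′) t≡s = ℕ.*-cancelʳ-≤ m₂ s a {{a≢0}} (ℕ.≤-trans (ℕ.≤-reflexive m₂a≡) (ℕ.*-monoʳ-≤ s s′≤a))
        where
        a = count (λ x → inAtom? d x)
        a≢0 : NonZero a
        a≢0 = ℕ.≢-nonZero λ a≡0 → prime≢1 pq (trans (sym count-atom) (cong suc a≡0))
        m₂a≡ : m₂ * a ≡ s * s′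
        m₂a≡ = ℕ.+-cancelˡ-≡ s _ _ (trans (cong (_+ m₂ * a) (sym t≡s))
            (trans (sym total-multiplicity) (trans (cong₂ _*_ t≡s t≡s) (ℕ.*-suc s s′))))
        s′≤a : s′ ≤ a
        s′≤a = ℕ.s≤s⁻¹ (subst₂ _≤_ t≡s (sym count-atom) t≤q)


    -- Since the atom is ⟨a^d⟩ without the identity, h is t - m₂ times 1 plus m₂ times the sum over
    -- ⟨a^d⟩; the second part is invariant under a^d.
    square : ∃[ r ] r * r ≡ t ∸ m₂
    square = eigenvalue-at (d mod n) (mod≢e d (ℕ.≢-nonZero⁻¹ d) d<n) (t ∸ m₂)
        (λ x → if multiples x then m₂ else 0) mult-w invariant
      where
      mult-w : ∀ x → mult S x ≡ (if does (x Fin.≟ e) then t ∸ m₂ else 0) + (if multiples x then m₂ else 0)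
      mult-w x = trans (mult≡ x) (by-case (x Fin.≟ e))
        where
        by-case : (x≟e : Dec (x ≡ e)) → (if does x≟e then t else 0) + (if inAtom? d x then m₂ else 0) ≡
          (if does x≟e then t ∸ m₂ else 0) + (if multiples x then m₂ else 0)
        by-case (yes refl) = trans (cong (λ b → t + (if b then m₂ else 0)) inAtom-e)
            (trans (ℕ.+-identityʳ t) (trans (sym (ℕ.m∸n+n≡m m₂≤t))
          (cong (λ b → (t ∸ m₂) + (if b then m₂ else 0)) (sym (dec-true (d ∣? toℕ e) d∣e)))))
        by-case (no x≢e) = cong (if_then m₂ else 0) (inAtom-≢e x x≢e)
      invariant : ∀ x → (if multiples ((d mod n) ⊕ x) then m₂ else 0) ≡ (if multiples x then m₂ else 0)
      invariant x = cong (if_then m₂ else 0) (bool-ext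
        (λ eq → dec-true (d ∣? toℕ x) (m%n≡0⇒n∣m _ d (trans (sym same) (n∣m⇒m%n≡0 _ d (does⇒ (d ∣? _) eq)))))
        (λ eq → dec-true (d ∣? _) (m%n≡0⇒n∣m _ d (trans same (n∣m⇒m%n≡0 _ d (does⇒ (d ∣? toℕ x) eq))))))
        where
        same : toℕ ((d mod n) ⊕ x) % d ≡ toℕ x % d
        same = trans (residue d∣n _) (%-remove-+ˡ (toℕ x) (subst (d ∣_) (sym (trans (toℕ-mod d) (m<n⇒m%n≡m d<n))) ∣-refl))

    q≤1+t : q ≤ suc t
    q≤1+t = nearly-full {r = proj₁ square} pq 1≤m₂ t≤q (trans
        (sym (ℕ.m+[n∸m]≡n m₂≤t)) (cong (λ z → m₂ + z) (sym (proj₂ square)))) t²≡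

    -- All elements of S agree modulo d, so S lies in one coset of ⟨a^d⟩, which has at most q
    -- elements; with at least q - 1 elements S misses at most one point of it.
    coset-form : ∃[ k ] ∃[ j ] (k < q × j < d × (S ≡ coset j d ∩ ∁ ⁅ (k * d + j) mod n ⁆ ⊎ S ≡ coset j d))
    -- From q > 1 and q ≤ 1 + t the set S has a member, which fixes the coset.
    coset-form = from-member (sumFℕ-positive (λ k → if lookup S k then 1 else 0)
        (subst (1 ≤_) (card≡count S) (ℕ.s≤s⁻¹ (ℕ.≤-trans (ℕ.nonTrivial⇒n>1 q {{prime⇒nonTrivial pq}}) q≤1+t))))
      where
      from-member : ∃[ k ] 1 ≤ (if lookup S k then 1 else 0) →
          ∃[ k ] ∃[ j ] (k < q × j < d × (S ≡ coset j d ∩ ∁ ⁅ (k * d + j) mod n ⁆ ⊎ S ≡ coset j d))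
      from-member (k₀ , pos) = missing (Fin.any? λ x → (lookup C x Bool.≟ true) ×-dec (lookup S x Bool.≟ false))
        where
        j = toℕ k₀ % d
        C : Subset n
        C = coset j d
        Sk₀ : lookup S k₀ ≡ true
        Sk₀ = decode (lookup S k₀) pos
          where
          decode : ∀ b → 1 ≤ (if b then 1 else 0) → b ≡ true
          decode true _ = refl
        S-residue : ∀ {l} → lookup S l ≡ true → toℕ l % d ≡ j
        S-residue {l} Sl with k₀ Fin.≟ l
        ... | yes refl = refl
        ... | no k₀≢l = sym (∣⇒same-residue d∣n (proj₁ (difference-atomic Sk₀ Sl k₀≢l)))
        S⊆C : ∀ {l} → lookup S l ≡ true → lookup C l ≡ true
        S⊆C {l} Sl = coset⇐ j d ((toℕ l / d) mod n , (begin
          (j mod n) ⊕ d ⊙ ((toℕ l / d) mod n) ≡⟨ cong ((j mod n) ⊕_) (⊙-mod d (toℕ l / d)) ⟩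
          (j mod n) ⊕ ((d * (toℕ l / d)) mod n) ≡⟨ mod-⊕ j (d * (toℕ l / d)) ⟩
          (j + d * (toℕ l / d)) mod n ≡⟨ cong (_mod n) (trans
              (cong₂ _+_ (sym (S-residue Sl)) (ℕ.*-comm d (toℕ l / d))) (sym (m≡m%n+[m/n]*n (toℕ l) d))) ⟩
          toℕ l mod n ≡⟨ mod-toℕ l ⟩
          l ∎))
          where open ≡-Reasoning
        C-residue : ∀ {l} → lookup C l ≡ true → toℕ l % d ≡ j
        C-residue {l} Cl = let i , eq = coset⇒ j d Cl in
          trans (cong (λ l → toℕ l % d) (trans (sym eq) (trans (cong ((j mod n) ⊕_) refl) (mod-⊕ j (d * toℕ i)))))
            (trans (residue d∣n (j + d * toℕ i)) (trans (%-remove-+ʳ j {d = d} (m∣m*n (toℕ i))) (m%n%n≡m%n (toℕ k₀) d)))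
        count-C : count (lookup C) ≤ q
        count-C = count-residue-class (lookup C) λ k l Ck Cl → trans (C-residue Ck) (sym (C-residue Cl))
        missing : Dec (∃[ x ] (lookup C x ≡ true × lookup S x ≡ false)) →
            ∃[ k ] ∃[ j ] (k < q × j < d × (S ≡ coset j d ∩ ∁ ⁅ (k * d + j) mod n ⁆ ⊎ S ≡ coset j d))
        -- For a full coset k has no meaning; 0 is the default below q.
        missing (no none) = 0 , j , ℕ.>-nonZero⁻¹ q , m%n<n (toℕ k₀) d ,
            inj₂ (lookup-injective S C λ l → bool-ext S⊆C λ Cl → filled l (lookup S l) refl Cl)
          where
          filled : ∀ l b → lookup S l ≡ b → lookup C l ≡ true → lookup S l ≡ true
          filled l true eq _ = eq
          filled l false eq Cl = contradiction (l , Cl , eq) none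
        missing (yes (x , Cx , Sx)) = toℕ x / d , j , m<n*o⇒m/o<n (subst (toℕ x <_) n≡ (Fin.toℕ<n x)) , m%n<n (toℕ k₀) d ,
            inj₁ (lookup-injective S _ λ l → trans (bool-ext (forward l) (backward l)) (sym (punctured l)))
          where
          x≡ : (toℕ x / d * d + j) mod n ≡ x
          x≡ = trans (cong (_mod n) (trans (ℕ.+-comm _ j) (trans
              (cong (_+ toℕ x / d * d) (sym (C-residue Cx))) (sym (m≡m%n+[m/n]*n (toℕ x) d))))) (mod-toℕ x)
          punctured : ∀ l → lookup (C ∩ ∁ ⁅ (toℕ x / d * d + j) mod n ⁆) l ≡ remove (lookup C) x l
          punctured l = trans (cong (λ x → lookup (C ∩ ∁ ⁅ x ⁆) l) x≡) (trans (lookup-zipWith _∧_ l C (∁ ⁅ x ⁆))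
            (cong (lookup C l ∧_) (trans (lookup-map l not ⁅ x ⁆) (cong not (lookup-⁅⁆ x l)))))
          forward : ∀ l → lookup S l ≡ true → remove (lookup C) x l ≡ true
          forward l Sl = cong₂ (λ a b → a ∧ not b) (S⊆C Sl) (dec-false
              (x Fin.≟ l) λ { refl → contradiction (trans (sym Sl) Sx) λ () })
          backward : ∀ l → remove (lookup C) x l ≡ true → lookup S l ≡ true
          backward l Cl = filled (lookup S l) refl
            where
            filled : ∀ b → lookup S l ≡ b → lookup S l ≡ true
            filled true eq = eq
            -- A second missing point l besides x would leave S at most q - 2 elements.
            filled false eq = contradiction (ℕ.≤-trans (s≤s q≤1+t)
                (ℕ.≤-trans (s≤s (s≤s too-few)) (ℕ.≤-trans (ℕ.≤-reflexive (sym count-eq)) count-C))) (ℕ.<-irrefl refl)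
              where
              rest : Fin n → Bool
              rest = remove (remove (lookup C) x) l
              count-eq : count (lookup C) ≡ suc (suc (count rest))
              count-eq = trans (count-remove (lookup C) x Cx) (cong suc (count-remove (remove (lookup C) x) l Cl))
              too-few : t ≤ count rest
              too-few = ℕ.≤-trans (ℕ.≤-reflexive (card≡count S)) (count-⊆ λ i Si →
                cong₂ (λ a b → a ∧ not b) (forward i Si) (dec-false
                    (l Fin.≟ i) λ { refl → contradiction (trans (sym Si) eq) λ () }))

-- The equivalence

theorem4p1 : (n : ℕ) .{{_ : NonZero n}} →
    (∀ p → Prime p → p ∣ n → 3 ≤ p) →
    (S1 S2 : Subset n) →
    Dihedral.e n ∉ S1 →
    (∀ k → k ∈ S1 → Dihedral.⊖_ n k ∈ S1) →
    Dihedral.TwoIntegral n S2 →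
    (Dihedral.IntegralCayley n S1 S2 ⇔
    (Dihedral.InB n S1 ×
    ∃[ p ] ∃[ q ] (Prime p × q * p ≡ n ×
    ∃[ k ] ∃[ j ] (k < p × j < q ×
    (S2 ≡ Dihedral.coset n j q ∩ ∁ ⁅ (k * q + j) mod n ⁆
    ⊎ S2 ≡ Dihedral.coset n j q)))))
theorem4p1 n odd S1 S2 _ S1-inv (d , m₂ , d∣n , d≢n , 1≤m₂ , mult≡) = mk⇔ necessary sufficient
  where
  open Dihedral n
  open CyclicGroup n
  open CyclicGroupOperators n
  open BooleanAlgebra n

  S1-symmetric : Symmetric (indicator S1)
  S1-symmetric k = cong ind (bool-ext
    (λ p → []=⇒lookup (subst (_∈ S1) (⊖-involutive k) (S1-inv (⊖ k) (lookup⇒[]= (⊖ k) S1 p))))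
    (λ p → []=⇒lookup (S1-inv k (lookup⇒[]= k S1 p))))

  Form : Set
  Form = ∃[ p ] ∃[ q ] (Prime p × q * p ≡ n × ∃[ k ] ∃[ j ] (k < p × j < q ×
    (S2 ≡ coset j q ∩ ∁ ⁅ (k * q + j) mod n ⁆ ⊎ S2 ≡ coset j q)))

  necessary : IntegralCayley S1 S2 → InB S1 × Form
  necessary int = Atoms.multiplier-closed⇒InB n S1 (λ p pp 3≤p cop → prime-multiplier p pp 3≤p cop S1 (proj₁ summands)) ,
      form Cl.prime-index
    where
    summands : Split (λ φ x → + 2 ℤ.* convolve (indicator S1) φ x) × Split (λ φ x → + 2 ℤ.* reflected (indicator S2) φ x)
    summands = split-summands (indicator S1) (indicator S2) S1-symmetric (integral⇒split-adjacency S1 S2 int)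
    module Cl = Classification n odd S2 d m₂ d∣n d≢n 1≤m₂ mult≡
      (λ v c eig → square-eigenvalue (reflected-linear (indicator S2)) (proj₂ summands)
          (λ x → trans (convolve-mult S2 v x) (eig x)))
    form : ∃[ q ] Prime q × n ≡ q * d → Form
    form (q , pq , n≡) = q , d , pq , trans (ℕ.*-comm d q) (sym n≡) , Cl.PrimeIndex.coset-form pq n≡

  sufficient : InB S1 × Form → IntegralCayley S1 S2
  sufficient (b , p , q , _ , _ , k , j , _ , _ , shape) = split-adjacency⇒integral S1 S2
    (split-sum (indicator S1) (indicator S2) S1-symmetric (split-convolve (span-indicator b)) ([ punctured , full ]′ shape))
    where
    full : S2 ≡ coset j q → Split (reflected (indicator S2))
    full eq = subst (λ S → Split (reflected (indicator S))) (sym eq) (split-coset j q)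
    punctured : S2 ≡ coset j q ∩ ∁ ⁅ (k * q + j) mod n ⁆ → Split (reflected (indicator S2))
    punctured eq = subst (λ S → Split (reflected (indicator S))) (sym eq) (split-punctured-coset j q
      (coset⇐ j q (k mod n , trans (cong ((j mod n) ⊕_) (⊙-mod q k))
          (trans (mod-⊕ j (q * k)) (cong (_mod n) (trans (ℕ.+-comm j (q * k)) (cong (_+ j) (ℕ.*-comm q k))))))))
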